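{- For every $\varepsilon>0$ there is an integer $p_\varepsilon\ge 5$ such that, for every prime $p\ge p_\varepsilon$, there is a set $A\subseteq\mathbb Z/p\mathbb Z$, with $|A|\ge 2$ and no unique sum, for which $$|A|\le \frac{(\log p)^2}{2(\log 3)^2}+\left(\frac{2}{\log 3}+\varepsilon\right)\frac{(\log p)^2}{\log\log p}.$$ Consequently, as $p\to\infty$ through the primes, $$m(p)\le \frac{(\log p)^2}{2(\log 3)^2}+\left(\frac{2}{\log 3}+o(1)\right)\frac{(\log p)^2}{\log\log p}.$$ In particular, $$m(p)\le\left(\frac{1}{2(\log_2 3)^2}+o(1)\right)(\log_2 p)^2,$$ where $\frac{1}{2(\log_2 3)^2}=0.199036176970870\ldots$.
   Context: $\log$ is the natural logarithm and $\log_2$ the base-two logarithm. For an abelian group $G$, a set $A\subseteq G$ has no unique sum if for all $a,b\in A$ there are $c,d\in A$ with $a+b=c+d$ and not ($(a=c$ and $b=d)$ or $(a=d$ and $b=c)$); i.e. no element of $A+A$ has exactly one representation as the sum of an unordered pair (two-element multiset, repetition allowed) of elements of $A$. For a prime $p\ge3$, $m(p)$ is the minimum of $|A|$ over all $A\subseteq\mathbb Z/p\mathbb Z$ with $|A|\ge2$ having no unique sum (this minimum exists). -}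

module Defs where

open import Level using (0ℓ)
open import Algebra.Bundles using (AbelianGroup; CommutativeRing)
open import Data.Empty using (⊥-elim)
open import Data.Fin using (Fin; zero; suc; toℕ)
import Data.Fin.Properties as Fin
open import Data.Fin.Subset as Subset using (Subset)
import Data.Fin.Subset.Properties as Subset
open import Data.Integer as ℤ using (+_; +[1+_]; -[1+_])
import Data.Integer.Properties as ℤ
open import Data.Nat as ℕ using (ℕ; zero; suc; NonZero; z≤n; s≤s)
import Data.Nat.DivMod as ℕ
import Data.Nat.Properties as ℕ
open import Data.Nat.Primality using (Prime)
open import Data.Product using (∃; ∃₂; _×_; _,_; proj₁; proj₂)
open import Data.Rational as ℚ using (ℚ; mkℚ; 0ℚ; 1ℚ; ½; 1/_)
import Data.Rational.Properties as ℚ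
open import Data.Rational.Solver using (module +-*-Solver)
import Data.Rational.Unnormalised as ℚᵘ
import Data.Rational.Unnormalised.Properties as ℚᵘ
open import Data.Sum using (_⊎_; inj₁; inj₂)
open import Relation.Binary.PropositionalEquality using (_≡_; _≢_; refl; sym; trans; cong; cong₂; subst; subst₂; isEquivalence)
open import Relation.Nullary using (¬_; Dec; yes; no)
open import Relation.Nullary.Decidable using (_×-dec_; _⊎-dec_; _→-dec_; ¬?)
open import Relation.Unary using (Pred; _∈_)
open import Algebra.Properties.Semiring.Exp (CommutativeRing.semiring ℚ.+-*-commutativeRing) using (_^_)

module Estimates where

  open import Data.Rational using (_+_; _*_; _-_; -_; ∣_∣; _≤_; _<_; positive; nonNegative)
  open +-*-Solver using (solve; _:=_; _:+_; _:*_; _:-_; :-_; con)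

  recip : ℚ → ℚ
  recip (mkℚ (+ 0) _ _)        = 0ℚ
  recip q@(mkℚ +[1+ _ ] _ _)   = 1/ q
  recip q@(mkℚ (-[1+ _ ]) _ _) = 1/ q

  recip-pos : ∀ {q} → 0ℚ < q → 0ℚ < recip q × q * recip q ≡ 1ℚ
  recip-pos {mkℚ (+ 0) _ _} (ℚ.*<* (ℤ.+<+ ()))
  recip-pos {q@(mkℚ +[1+ _ ] _ _)} 0<q =
    ℚ.positive⁻¹ (1/ q) {{ℚ.1/pos⇒pos q}} , ℚ.*-inverseʳ q
  recip-pos {mkℚ (-[1+ _ ]) _ _} (ℚ.*<* ())

  0<1 : 0ℚ < 1ℚ
  0<1 = ℚ.positive⁻¹ 1ℚ

  pos*pos : ∀ {a b} → 0ℚ < a → 0ℚ < b → 0ℚ < a * b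
  pos*pos {a} {b} 0<a 0<b =
    ℚ.positive⁻¹ (a * b) {{ℚ.pos*pos⇒pos a {{positive 0<a}} b {{positive 0<b}}}}

  *-monoˡ : ∀ {c a b} → 0ℚ ≤ c → a ≤ b → c * a ≤ c * b
  *-monoˡ {c} 0≤c = ℚ.*-monoˡ-≤-nonNeg c {{nonNegative 0≤c}}

  *-monoʳ : ∀ {c a b} → 0ℚ ≤ c → a ≤ b → a * c ≤ b * c
  *-monoʳ {c} 0≤c = ℚ.*-monoʳ-≤-nonNeg c {{nonNegative 0≤c}}

  *-mono : ∀ {a b c d} → 0ℚ ≤ a → a ≤ b → 0ℚ ≤ c → c ≤ d → a * c ≤ b * d
  *-mono 0≤a a≤b 0≤c c≤d =
    ℚ.≤-trans (*-monoʳ 0≤c a≤b) (*-monoˡ (ℚ.≤-trans 0≤a a≤b) c≤d)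

  *-nonNeg : ∀ {a b} → 0ℚ ≤ a → 0ℚ ≤ b → 0ℚ ≤ a * b
  *-nonNeg {a} {b} 0≤a 0≤b = subst (_≤ a * b) (ℚ.*-zeroʳ a) (*-monoˡ 0≤a 0≤b)

  cancel : ∀ {c a b} → 0ℚ < c → c * a ≤ c * b → a ≤ b
  cancel {c} 0<c = ℚ.*-cancelˡ-≤-pos c {{positive 0<c}}

  ≤-shift : ∀ {a b c} → a + c ≤ b → a ≤ b - c
  ≤-shift {a} {b} {c} h = subst (_≤ b - c)
    (solve 2 (λ a c → (a :+ c) :- c := a) refl a c) (ℚ.+-monoˡ-≤ (- c) h)

  diff-nonNeg : ∀ {a b} → a ≤ b → 0ℚ ≤ b - a
  diff-nonNeg {a} a≤b = ≤-shift (subst (_≤ _) (sym (ℚ.+-identityˡ a)) a≤b)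

  diff-pos : ∀ {a b} → a < b → 0ℚ < b - a
  diff-pos {a} {b} a<b = subst (_< b - a) (ℚ.+-inverseʳ a) (ℚ.+-monoˡ-< (- a) a<b)

  ≤∣∣ : ∀ a → a ≤ ∣ a ∣
  ≤∣∣ a with ℚ.≤-total 0ℚ a
  ... | inj₁ 0≤a = ℚ.≤-reflexive (sym (ℚ.0≤p⇒∣p∣≡p 0≤a))
  ... | inj₂ a≤0 = ℚ.≤-trans a≤0 (ℚ.0≤∣p∣ a)

  ∣∣≤ : ∀ {a b} → a ≤ b → - a ≤ b → ∣ a ∣ ≤ b
  ∣∣≤ {a} {b} h h′ with ℚ.∣p∣≡p∨∣p∣≡-p a
  ... | inj₁ e = subst (_≤ b) (sym e) h
  ... | inj₂ e = subst (_≤ b) (sym e) h′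

  ∣-∣-sym : ∀ a b → ∣ a - b ∣ ≡ ∣ b - a ∣
  ∣-∣-sym a b = trans (sym (ℚ.∣-p∣≡∣p∣ (a - b)))
    (cong ∣_∣ (solve 2 (λ a b → :- (a :- b) := b :- a) refl a b))

  halves : ∀ ε → ε * ½ + ε * ½ ≡ ε
  halves ε = trans (sym (ℚ.*-distribˡ-+ ε ½ ½)) (ℚ.*-identityʳ ε)

  half-pos : ∀ {ε} → 0ℚ < ε → 0ℚ < ε * ½
  half-pos 0<ε = pos*pos 0<ε (ℚ.positive⁻¹ ½)

  divide : ∀ {r ε} → 0ℚ < r → 0ℚ < ε → ∃ λ δ → 0ℚ < δ × r * δ ≡ ε
  divide {r} {ε} 0<r 0<ε = recip r * ε , pos*pos (proj₁ (recip-pos 0<r)) 0<ε ,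
    trans (sym (ℚ.*-assoc r (recip r) ε))
      (trans (cong (_* ε) (proj₂ (recip-pos 0<r))) (ℚ.*-identityˡ ε))

  ι : ℕ → ℚ
  ι n = + n ℚ./ 1

  ι-mono : ∀ {m n} → m ℕ.≤ n → ι m ≤ ι n
  ι-mono {m} {n} m≤n = ℚ.toℚᵘ-cancel-≤
    (ℚᵘ.≤-respˡ-≃ (ℚᵘ.≃-sym (ℚ.toℚᵘ-fromℚᵘ (ℚᵘ.mkℚᵘ (+ m) 0)))
    (ℚᵘ.≤-respʳ-≃ (ℚᵘ.≃-sym (ℚ.toℚᵘ-fromℚᵘ (ℚᵘ.mkℚᵘ (+ n) 0)))
    (ℚᵘ.*≤* (ℤ.*-monoʳ-≤-nonNeg (+ 1) (ℤ.+≤+ m≤n)))))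

  ι-suc : ∀ n → ι (suc n) ≡ 1ℚ + ι n
  ι-suc n = ℚ.toℚᵘ-injective (begin
    ℚ.toℚᵘ (ι (suc n))               ≈⟨ ℚ.toℚᵘ-fromℚᵘ (ℚᵘ.mkℚᵘ (+ suc n) 0) ⟩
    ℚᵘ.mkℚᵘ (+ suc n) 0              ≈⟨ ℚᵘ.*≡* (cong (λ i → (+ 1 ℤ.+ i) ℤ.* + 1) (sym (ℤ.*-identityʳ (+ n)))) ⟩
    ℚᵘ.1ℚᵘ ℚᵘ.+ ℚᵘ.mkℚᵘ (+ n) 0      ≈⟨ ℚᵘ.+-congʳ ℚᵘ.1ℚᵘ (ℚ.toℚᵘ-fromℚᵘ (ℚᵘ.mkℚᵘ (+ n) 0)) ⟨
    ℚᵘ.1ℚᵘ ℚᵘ.+ ℚ.toℚᵘ (ι n)         ≈⟨ ℚ.toℚᵘ-homo-+ 1ℚ (ι n) ⟨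
    ℚ.toℚᵘ (1ℚ + ι n)                ∎)
    where open ℚᵘ.≃-Reasoning

  archimedean : ∀ q → ∃ λ n → q ≤ ι n
  archimedean q@(mkℚ i d _) = ℤ.∣ i ∣ , ℚ.toℚᵘ-cancel-≤
    (ℚᵘ.≤-respʳ-≃ (ℚᵘ.≃-sym (ℚ.toℚᵘ-fromℚᵘ (ℚᵘ.mkℚᵘ (+ ℤ.∣ i ∣) 0)))
    (ℚᵘ.*≤* (ℤ.≤-trans (ℤ.≤-reflexive (ℤ.*-identityʳ i)) (bound i))))
    where
    bound : ∀ i → i ℤ.≤ + ℤ.∣ i ∣ ℤ.* + suc d
    bound (+ n)    = ℤ.≤-trans (ℤ.+≤+ (ℕ.m≤m*n n (suc d))) (ℤ.≤-reflexive (ℤ.pos-* n (suc d)))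
    bound -[1+ n ] = ℤ.-≤+

  unitFrac : ∀ n → (+ 1 ℚ./ suc n) * ι (suc n) ≡ 1ℚ
  unitFrac n = ℚ.toℚᵘ-injective (begin
    ℚ.toℚᵘ ((+ 1 ℚ./ suc n) * ι (suc n))
      ≈⟨ ℚ.toℚᵘ-homo-* (+ 1 ℚ./ suc n) (ι (suc n)) ⟩
    ℚ.toℚᵘ (+ 1 ℚ./ suc n) ℚᵘ.* ℚ.toℚᵘ (ι (suc n))
      ≈⟨ ℚᵘ.*-cong (ℚ.toℚᵘ-fromℚᵘ (ℚᵘ.mkℚᵘ (+ 1) n)) (ℚ.toℚᵘ-fromℚᵘ (ℚᵘ.mkℚᵘ (+ suc n) 0)) ⟩
    ℚᵘ.mkℚᵘ (+ 1) n ℚᵘ.* ℚᵘ.mkℚᵘ (+ suc n) 0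
      ≈⟨ ℚᵘ.*≡* (cong +_ (ℕ.*-assoc 1 (suc n) 1)) ⟩
    ℚᵘ.1ℚᵘ ∎)
    where open ℚᵘ.≃-Reasoning

  unitFrac-pos : ∀ n → 0ℚ < + 1 ℚ./ suc n
  unitFrac-pos n = ℚ.positive⁻¹ (+ 1 ℚ./ suc n) {{ℚ.normalize-pos 1 (suc n)}}

  Cauchy : (ℕ → ℚ) → Set
  Cauchy s = ∀ ε → 0ℚ < ε →
    ∃ λ N → ∀ m n → N ℕ.≤ m → N ℕ.≤ n → ∣ s m - s n ∣ ≤ ε

  Eventually : (ℕ → Set) → Set
  Eventually P = ∃ λ N → ∀ n → N ℕ.≤ n → P n

  both : ∀ {P Q R : ℕ → Set} → (∀ n → P n → Q n → R n) →
         Eventually P → Eventually Q → Eventually R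
  both f (M , p) (N , q) = M ℕ.⊔ N , λ n h →
    f n (p n (ℕ.≤-trans (ℕ.m≤m⊔n M N) h)) (q n (ℕ.≤-trans (ℕ.m≤n⊔m M N) h))

  cauchy-const : ∀ q → Cauchy (λ _ → q)
  cauchy-const q ε 0<ε = 0 , λ _ _ _ _ →
    subst (λ t → ∣ t ∣ ≤ ε) (sym (ℚ.+-inverseʳ q)) (ℚ.<⇒≤ 0<ε)

  cauchy-- : ∀ {s} → Cauchy s → Cauchy (λ n → - s n)
  cauchy-- {s} cs ε 0<ε with cs ε 0<ε
  ... | N , h = N , λ m n N≤m N≤n → subst (_≤ ε)
    (trans (∣-∣-sym (s m) (s n))
      (cong ∣_∣ (solve 2 (λ a b → b :- a := :- a :- (:- b)) refl (s m) (s n))))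
    (h m n N≤m N≤n)

  cauchy-∣∣ : ∀ {s} → Cauchy s → Cauchy (λ n → ∣ s n ∣)
  cauchy-∣∣ {s} cs ε 0<ε with cs ε 0<ε
  ... | N , h = N , λ m n N≤m N≤n → ∣∣≤
    (ℚ.≤-trans (one-sided (s m) (s n)) (h m n N≤m N≤n))
    (subst (_≤ ε) (solve 2 (λ a b → b :- a := :- (a :- b)) refl ∣ s m ∣ ∣ s n ∣)
      (ℚ.≤-trans (one-sided (s n) (s m)) (h n m N≤n N≤m)))
    where
    one-sided : ∀ a b → ∣ a ∣ - ∣ b ∣ ≤ ∣ a - b ∣
    one-sided a b = ℚ.≤-trans
      (ℚ.+-monoˡ-≤ (- ∣ b ∣) (subst (λ t → ∣ t ∣ ≤ ∣ a - b ∣ + ∣ b ∣)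
        (solve 2 (λ a b → (a :- b) :+ b := a) refl a b) (ℚ.∣p+q∣≤∣p∣+∣q∣ (a - b) b)))
      (ℚ.≤-reflexive (solve 2 (λ x y → (x :+ y) :- y := x) refl ∣ a - b ∣ ∣ b ∣))

  cauchy-+ : ∀ {s t} → Cauchy s → Cauchy t → Cauchy (λ n → s n + t n)
  cauchy-+ {s} {t} cs ct ε 0<ε with cs _ (half-pos 0<ε) | ct _ (half-pos 0<ε)
  ... | M , h | N , k = M ℕ.⊔ N , λ m n p q → begin
    ∣ (s m + t m) - (s n + t n) ∣
      ≡⟨ cong ∣_∣ (solve 4 (λ a b c d → (a :+ b) :- (c :+ d) := (a :- c) :+ (b :- d))
           refl (s m) (t m) (s n) (t n)) ⟩
    ∣ (s m - s n) + (t m - t n) ∣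
      ≤⟨ ℚ.∣p+q∣≤∣p∣+∣q∣ (s m - s n) (t m - t n) ⟩
    ∣ s m - s n ∣ + ∣ t m - t n ∣
      ≤⟨ ℚ.+-mono-≤
           (h m n (ℕ.≤-trans (ℕ.m≤m⊔n M N) p) (ℕ.≤-trans (ℕ.m≤m⊔n M N) q))
           (k m n (ℕ.≤-trans (ℕ.m≤n⊔m M N) p) (ℕ.≤-trans (ℕ.m≤n⊔m M N) q)) ⟩
    ε * ½ + ε * ½
      ≡⟨ halves ε ⟩
    ε ∎
    where open ℚ.≤-Reasoning

  cauchy-bounded : ∀ {s} → Cauchy s → ∃ λ B → 0ℚ < B × Eventually (λ n → ∣ s n ∣ ≤ B)
  cauchy-bounded {s} cs with cs 1ℚ 0<1
  ... | N , h = 1ℚ + ∣ s N ∣ ,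
    ℚ.<-≤-trans 0<1 (subst (_≤ 1ℚ + ∣ s N ∣) (ℚ.+-identityʳ 1ℚ) (ℚ.+-monoʳ-≤ 1ℚ (ℚ.0≤∣p∣ (s N)))) ,
    N , λ n N≤n → begin
      ∣ s n ∣                     ≡⟨ cong ∣_∣ (solve 2 (λ a b → a := (a :- b) :+ b) refl (s n) (s N)) ⟩
      ∣ (s n - s N) + s N ∣       ≤⟨ ℚ.∣p+q∣≤∣p∣+∣q∣ (s n - s N) (s N) ⟩
      ∣ s n - s N ∣ + ∣ s N ∣     ≤⟨ ℚ.+-monoˡ-≤ ∣ s N ∣ (h n N N≤n ℕ.≤-refl) ⟩
      1ℚ + ∣ s N ∣                ∎
    where open ℚ.≤-Reasoning

  ∣ab-cd∣≤ : ∀ a b c d → ∣ a * b - c * d ∣ ≤ ∣ a ∣ * ∣ b - d ∣ + ∣ d ∣ * ∣ a - c ∣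
  ∣ab-cd∣≤ a b c d = begin
    ∣ a * b - c * d ∣
      ≡⟨ cong ∣_∣ (solve 4 (λ a b c d → a :* b :- c :* d := a :* (b :- d) :+ d :* (a :- c))
           refl a b c d) ⟩
    ∣ a * (b - d) + d * (a - c) ∣
      ≤⟨ ℚ.∣p+q∣≤∣p∣+∣q∣ (a * (b - d)) (d * (a - c)) ⟩
    ∣ a * (b - d) ∣ + ∣ d * (a - c) ∣
      ≡⟨ cong₂ _+_ (ℚ.∣p*q∣≡∣p∣*∣q∣ a (b - d)) (ℚ.∣p*q∣≡∣p∣*∣q∣ d (a - c)) ⟩
    ∣ a ∣ * ∣ b - d ∣ + ∣ d ∣ * ∣ a - c ∣ ∎
    where open ℚ.≤-Reasoning

  *-close : ∀ {A B α β ε} → A * α ≡ ε * ½ → B * β ≡ ε * ½ → ∀ a b c d →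
            ∣ a ∣ ≤ A → ∣ d ∣ ≤ B → ∣ b - d ∣ ≤ α → ∣ a - c ∣ ≤ β →
            ∣ a * b - c * d ∣ ≤ ε
  *-close {A} {B} {α} {β} {ε} eα eβ a b c d a≤A d≤B δ₁ δ₂ = begin
    ∣ a * b - c * d ∣                          ≤⟨ ∣ab-cd∣≤ a b c d ⟩
    ∣ a ∣ * ∣ b - d ∣ + ∣ d ∣ * ∣ a - c ∣      ≤⟨ ℚ.+-mono-≤ (*-mono (ℚ.0≤∣p∣ a) a≤A (ℚ.0≤∣p∣ (b - d)) δ₁)
                                                             (*-mono (ℚ.0≤∣p∣ d) d≤B (ℚ.0≤∣p∣ (a - c)) δ₂) ⟩
    A * α + B * β                              ≡⟨ cong₂ _+_ eα eβ ⟩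
    ε * ½ + ε * ½                              ≡⟨ halves ε ⟩
    ε ∎
    where open ℚ.≤-Reasoning

  cauchy-* : ∀ {s t} → Cauchy s → Cauchy t → Cauchy (λ n → s n * t n)
  cauchy-* {s} {t} cs ct ε 0<ε =
    let A , 0<A , K , s≤A = cauchy-bounded cs
        B , 0<B , L , t≤B = cauchy-bounded ct
        α , 0<α , eα      = divide 0<A (half-pos 0<ε)
        β , 0<β , eβ      = divide 0<B (half-pos 0<ε)
        M , h             = cs β 0<β
        N , k             = ct α 0<α
        K≤                = ℕ.≤-trans (ℕ.m≤m⊔n K L) (ℕ.m≤m⊔n (K ℕ.⊔ L) (M ℕ.⊔ N))
        L≤                = ℕ.≤-trans (ℕ.m≤n⊔m K L) (ℕ.m≤m⊔n (K ℕ.⊔ L) (M ℕ.⊔ N))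
        M≤                = ℕ.≤-trans (ℕ.m≤m⊔n M N) (ℕ.m≤n⊔m (K ℕ.⊔ L) (M ℕ.⊔ N))
        N≤                = ℕ.≤-trans (ℕ.m≤n⊔m M N) (ℕ.m≤n⊔m (K ℕ.⊔ L) (M ℕ.⊔ N))
    in (K ℕ.⊔ L) ℕ.⊔ (M ℕ.⊔ N) , λ m n p q →
         *-close eα eβ (s m) (t m) (s n) (t n)
           (s≤A m (ℕ.≤-trans K≤ p)) (t≤B n (ℕ.≤-trans L≤ q))
           (k m n (ℕ.≤-trans N≤ p) (ℕ.≤-trans N≤ q))
           (h m n (ℕ.≤-trans M≤ p) (ℕ.≤-trans M≤ q))

  ∣recip-recip∣ : ∀ {c} → 0ℚ < c → ∀ a b → c ≤ a → c ≤ b →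
                  (c * c) * ∣ recip a - recip b ∣ ≤ ∣ a - b ∣
  ∣recip-recip∣ {c} 0<c a b c≤a c≤b = begin
    (c * c) * ∣ recip a - recip b ∣
      ≤⟨ *-monoʳ (ℚ.0≤∣p∣ (recip a - recip b)) (*-mono (ℚ.<⇒≤ 0<c) c≤a (ℚ.<⇒≤ 0<c) c≤b) ⟩
    (a * b) * ∣ recip a - recip b ∣
      ≡⟨ cong (_* ∣ recip a - recip b ∣) (ℚ.0≤p⇒∣p∣≡p (ℚ.<⇒≤ (pos*pos 0<a 0<b))) ⟨
    ∣ a * b ∣ * ∣ recip a - recip b ∣
      ≡⟨ ℚ.∣p*q∣≡∣p∣*∣q∣ (a * b) (recip a - recip b) ⟨
    ∣ (a * b) * (recip a - recip b) ∣
      ≡⟨ cong ∣_∣ (solve 4 (λ a b x y → (a :* b) :* (x :- y) := b :* (a :* x) :- a :* (b :* y))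
           refl a b (recip a) (recip b)) ⟩
    ∣ b * (a * recip a) - a * (b * recip b) ∣
      ≡⟨ cong₂ (λ x y → ∣ b * x - a * y ∣) (proj₂ (recip-pos 0<a)) (proj₂ (recip-pos 0<b)) ⟩
    ∣ b * 1ℚ - a * 1ℚ ∣
      ≡⟨ cong₂ (λ x y → ∣ x - y ∣) (ℚ.*-identityʳ b) (ℚ.*-identityʳ a) ⟩
    ∣ b - a ∣
      ≡⟨ ∣-∣-sym b a ⟩
    ∣ a - b ∣ ∎
    where
    open ℚ.≤-Reasoning
    0<a : 0ℚ < a
    0<a = ℚ.<-≤-trans 0<c c≤a
    0<b : 0ℚ < b
    0<b = ℚ.<-≤-trans 0<c c≤b

  cauchy-recip : ∀ {s c} → 0ℚ < c → Eventually (λ n → c ≤ s n) →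
                 Cauchy s → Cauchy (λ n → recip (s n))
  cauchy-recip {s} {c} 0<c (K , c≤s) cs ε 0<ε =
    let N , h = cs _ (pos*pos (pos*pos 0<c 0<c) 0<ε)
    in K ℕ.⊔ N , λ m n p q → cancel (pos*pos 0<c 0<c)
      (ℚ.≤-trans
        (∣recip-recip∣ 0<c (s m) (s n)
          (c≤s m (ℕ.≤-trans (ℕ.m≤m⊔n K N) p)) (c≤s n (ℕ.≤-trans (ℕ.m≤m⊔n K N) q)))
        (h m n (ℕ.≤-trans (ℕ.m≤n⊔m K N) p) (ℕ.≤-trans (ℕ.m≤n⊔m K N) q)))

  -- artanh z = Σ z^(2k+1) / (2k+1)  for |z| < 1

  artanhTerm : ℕ → ℚ → ℚ
  artanhTerm k z = (+ 1 ℚ./ suc (2 ℕ.* k)) * z ^ suc (2 ℕ.* k)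

  artanhSum : ℕ → ℚ → ℚ
  artanhSum zero    z = 0ℚ
  artanhSum (suc n) z = artanhSum n z + artanhTerm n z

  module _ {r : ℚ} (0≤r : 0ℚ ≤ r) (r<1 : r < 1ℚ) where

    private
      e : ℚ
      e = 1ℚ - r

      0<e : 0ℚ < e
      0<e = diff-pos r<1

    ^-nonNeg : ∀ j → 0ℚ ≤ r ^ j
    ^-nonNeg zero    = ℚ.<⇒≤ 0<1
    ^-nonNeg (suc j) = *-nonNeg 0≤r (^-nonNeg j)

    ^-dec : ∀ j k → r ^ (j ℕ.+ k) ≤ r ^ k
    ^-dec zero    k = ℚ.≤-refl
    ^-dec (suc j) k = ℚ.≤-trans (*-mono 0≤r (ℚ.<⇒≤ r<1) (^-nonNeg (j ℕ.+ k)) (^-dec j k))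
      (ℚ.≤-reflexive (ℚ.*-identityˡ (r ^ k)))

    ^-even : ∀ k → r ^ (2 ℕ.* k) ≤ r ^ k
    ^-even k = subst (λ j → r ^ (k ℕ.+ j) ≤ r ^ k) (sym (ℕ.+-identityʳ k)) (^-dec k k)

    bernoulli : ∀ n → r ^ n * (1ℚ + ι n * e) ≤ 1ℚ
    bernoulli zero    = ℚ.≤-reflexive (trans (ℚ.*-identityˡ _)
      (trans (cong (λ t → 1ℚ + t) (ℚ.*-zeroˡ e)) (ℚ.+-identityʳ 1ℚ)))
    bernoulli (suc n) = begin
      r ^ suc n * (1ℚ + ι (suc n) * e)
        ≡⟨ cong (λ t → r ^ suc n * (1ℚ + t * e)) (ι-suc n) ⟩
      (r * r ^ n) * (1ℚ + (1ℚ + ι n) * (1ℚ - r))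
        ≡⟨ solve 3 (λ r p i → (r :* p) :* (con 1ℚ :+ (con 1ℚ :+ i) :* (con 1ℚ :- r)) :=
             p :* (con 1ℚ :+ i :* (con 1ℚ :- r)) :- p :* ((con 1ℚ :+ i) :* ((con 1ℚ :- r) :* (con 1ℚ :- r))))
             refl r (r ^ n) (ι n) ⟩
      r ^ n * (1ℚ + ι n * e) - r ^ n * ((1ℚ + ι n) * (e * e))
        ≤⟨ ℚ.+-monoʳ-≤ (r ^ n * (1ℚ + ι n * e)) (ℚ.neg-antimono-≤
             (*-nonNeg (^-nonNeg n) (*-nonNeg
               (subst (0ℚ ≤_) (ι-suc n) (ι-mono {0} {suc n} z≤n))
               (ℚ.<⇒≤ (pos*pos 0<e 0<e))))) ⟩
      r ^ n * (1ℚ + ι n * e) - 0ℚ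
        ≡⟨ ℚ.+-identityʳ _ ⟩
      r ^ n * (1ℚ + ι n * e)
        ≤⟨ bernoulli n ⟩
      1ℚ ∎
      where open ℚ.≤-Reasoning

    ^-small : ∀ δ → 0ℚ < δ → Eventually (λ n → r ^ n ≤ δ)
    ^-small δ 0<δ = let N , inv≤N = archimedean (recip (δ * e)) in
      N , λ n N≤n → bound n (ℚ.≤-trans inv≤N (ι-mono N≤n))
      where
      open ℚ.≤-Reasoning
      0<δe : 0ℚ < δ * e
      0<δe = pos*pos 0<δ 0<e
      bound : ∀ n → recip (δ * e) ≤ ι n → r ^ n ≤ δ
      bound n h = begin
        r ^ n
          ≡⟨ ℚ.*-identityʳ (r ^ n) ⟨
        r ^ n * 1ℚ
          ≡⟨ cong (λ t → r ^ n * t) (proj₂ (recip-pos 0<δe)) ⟨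
        r ^ n * ((δ * e) * recip (δ * e))
          ≤⟨ *-monoˡ (^-nonNeg n) (*-monoˡ (ℚ.<⇒≤ 0<δe) h) ⟩
        r ^ n * ((δ * e) * ι n)
          ≡⟨ solve 4 (λ p d e i → p :* ((d :* e) :* i) := d :* (p :* (i :* e))) refl (r ^ n) δ e (ι n) ⟩
        δ * (r ^ n * (ι n * e))
          ≤⟨ *-monoˡ (ℚ.<⇒≤ 0<δ) (*-monoˡ (^-nonNeg n)
               (subst (_≤ 1ℚ + ι n * e) (ℚ.+-identityˡ _) (ℚ.+-monoˡ-≤ (ι n * e) (ℚ.<⇒≤ 0<1)))) ⟩
        δ * (r ^ n * (1ℚ + ι n * e))
          ≤⟨ *-monoˡ (ℚ.<⇒≤ 0<δ) (bernoulli n) ⟩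
        δ * 1ℚ
          ≡⟨ ℚ.*-identityʳ δ ⟩
        δ ∎

    ∣^∣≤ : ∀ {z} → ∣ z ∣ ≤ r → ∀ j → ∣ z ^ j ∣ ≤ r ^ j
    ∣^∣≤ h zero    = ℚ.≤-refl
    ∣^∣≤ {z} h (suc j) = subst (_≤ r ^ suc j) (sym (ℚ.∣p*q∣≡∣p∣*∣q∣ z (z ^ j)))
      (*-mono (ℚ.0≤∣p∣ z) h (ℚ.0≤∣p∣ (z ^ j)) (∣^∣≤ h j))

    ^-lipschitz : ∀ {z w} → ∣ z ∣ ≤ r → ∣ w ∣ ≤ r → ∀ j →
                  ∣ z ^ suc j - w ^ suc j ∣ ≤ ι (suc j) * (r ^ j * ∣ z - w ∣)
    ^-lipschitz {z} {w} hz hw zero = ℚ.≤-reflexive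
      (trans (cong₂ (λ a b → ∣ a - b ∣) (ℚ.*-identityʳ z) (ℚ.*-identityʳ w))
        (solve 1 (λ d → d := con 1ℚ :* (con 1ℚ :* d)) refl ∣ z - w ∣))
    ^-lipschitz {z} {w} hz hw (suc j) = begin
      ∣ z * z ^ suc j - w * w ^ suc j ∣
        ≡⟨ cong ∣_∣ (solve 4 (λ z p w q → z :* p :- w :* q := z :* (p :- q) :+ q :* (z :- w))
             refl z (z ^ suc j) w (w ^ suc j)) ⟩
      ∣ z * (z ^ suc j - w ^ suc j) + w ^ suc j * (z - w) ∣
        ≤⟨ ℚ.∣p+q∣≤∣p∣+∣q∣ (z * (z ^ suc j - w ^ suc j)) (w ^ suc j * (z - w)) ⟩
      ∣ z * (z ^ suc j - w ^ suc j) ∣ + ∣ w ^ suc j * (z - w) ∣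
        ≡⟨ cong₂ _+_ (ℚ.∣p*q∣≡∣p∣*∣q∣ z _) (ℚ.∣p*q∣≡∣p∣*∣q∣ (w ^ suc j) _) ⟩
      ∣ z ∣ * ∣ z ^ suc j - w ^ suc j ∣ + ∣ w ^ suc j ∣ * ∣ z - w ∣
        ≤⟨ ℚ.+-mono-≤
             (*-mono (ℚ.0≤∣p∣ z) hz (ℚ.0≤∣p∣ _) (^-lipschitz hz hw j))
             (*-monoʳ (ℚ.0≤∣p∣ (z - w)) (∣^∣≤ hw (suc j))) ⟩
      r * (ι (suc j) * (r ^ j * ∣ z - w ∣)) + (r * r ^ j) * ∣ z - w ∣
        ≡⟨ solve 4 (λ r i p d → r :* (i :* (p :* d)) :+ (r :* p) :* d :=
                                (con 1ℚ :+ i) :* ((r :* p) :* d)) refl r (ι (suc j)) (r ^ j) ∣ z - w ∣ ⟩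
      (1ℚ + ι (suc j)) * (r ^ suc j * ∣ z - w ∣)
        ≡⟨ cong (_* (r ^ suc j * ∣ z - w ∣)) (ι-suc (suc j)) ⟨
      ι (suc (suc j)) * (r ^ suc j * ∣ z - w ∣) ∎
      where open ℚ.≤-Reasoning

    unitFrac≤1 : ∀ n → + 1 ℚ./ suc n ≤ 1ℚ
    unitFrac≤1 n = subst₂ _≤_ (ℚ.*-identityʳ _) (unitFrac n)
      (*-monoˡ (ℚ.<⇒≤ (unitFrac-pos n)) (ι-mono {1} {suc n} (s≤s z≤n)))

    term-bound : ∀ {z} → ∣ z ∣ ≤ r → ∀ k → ∣ artanhTerm k z ∣ ≤ r ^ k
    term-bound {z} h k = begin
      ∣ artanhTerm k z ∣
        ≡⟨ ℚ.∣p*q∣≡∣p∣*∣q∣ c (z ^ suc (2 ℕ.* k)) ⟩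
      ∣ c ∣ * ∣ z ^ suc (2 ℕ.* k) ∣
        ≡⟨ cong (_* ∣ z ^ suc (2 ℕ.* k) ∣) (ℚ.0≤p⇒∣p∣≡p (ℚ.<⇒≤ (unitFrac-pos (2 ℕ.* k)))) ⟩
      c * ∣ z ^ suc (2 ℕ.* k) ∣
        ≤⟨ *-mono (ℚ.<⇒≤ (unitFrac-pos (2 ℕ.* k))) (unitFrac≤1 (2 ℕ.* k)) (ℚ.0≤∣p∣ _)
             (∣^∣≤ h (suc (2 ℕ.* k))) ⟩
      1ℚ * r ^ suc (2 ℕ.* k)
        ≡⟨ ℚ.*-identityˡ _ ⟩
      r ^ suc (2 ℕ.* k)
        ≤⟨ ^-dec 1 (2 ℕ.* k) ⟩
      r ^ (2 ℕ.* k)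
        ≤⟨ ^-even k ⟩
      r ^ k ∎
      where
      open ℚ.≤-Reasoning
      c = + 1 ℚ./ suc (2 ℕ.* k)

    term-lipschitz : ∀ {z w} → ∣ z ∣ ≤ r → ∣ w ∣ ≤ r → ∀ k →
                     ∣ artanhTerm k z - artanhTerm k w ∣ ≤ r ^ k * ∣ z - w ∣
    term-lipschitz {z} {w} hz hw k = begin
      ∣ c * z ^ j - c * w ^ j ∣
        ≡⟨ cong ∣_∣ (solve 3 (λ c p q → c :* p :- c :* q := c :* (p :- q)) refl c (z ^ j) (w ^ j)) ⟩
      ∣ c * (z ^ j - w ^ j) ∣
        ≡⟨ ℚ.∣p*q∣≡∣p∣*∣q∣ c _ ⟩
      ∣ c ∣ * ∣ z ^ j - w ^ j ∣
        ≡⟨ cong (_* ∣ z ^ j - w ^ j ∣) (ℚ.0≤p⇒∣p∣≡p 0≤c) ⟩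
      c * ∣ z ^ j - w ^ j ∣
        ≤⟨ *-monoˡ 0≤c (^-lipschitz hz hw (2 ℕ.* k)) ⟩
      c * (ι j * (r ^ (2 ℕ.* k) * ∣ z - w ∣))
        ≡⟨ ℚ.*-assoc c (ι j) _ ⟨
      (c * ι j) * (r ^ (2 ℕ.* k) * ∣ z - w ∣)
        ≡⟨ cong (_* (r ^ (2 ℕ.* k) * ∣ z - w ∣)) (unitFrac (2 ℕ.* k)) ⟩
      1ℚ * (r ^ (2 ℕ.* k) * ∣ z - w ∣)
        ≡⟨ ℚ.*-identityˡ _ ⟩
      r ^ (2 ℕ.* k) * ∣ z - w ∣
        ≤⟨ *-monoʳ (ℚ.0≤∣p∣ (z - w)) (^-even k) ⟩
      r ^ k * ∣ z - w ∣ ∎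
      where
      open ℚ.≤-Reasoning
      j = suc (2 ℕ.* k)
      c = + 1 ℚ./ j
      0≤c = ℚ.<⇒≤ (unitFrac-pos (2 ℕ.* k))

    geometric : ∀ (D : ℕ → ℚ) {C} → 0ℚ ≤ C → D 0 ≡ 0ℚ →
                (∀ k → ∣ D (suc k) - D k ∣ ≤ r ^ k * C) →
                ∀ k → e * ∣ D k ∣ ≤ C
    geometric D {C} 0≤C D0 step k = ℚ.≤-trans
      (subst (_≤ e * ∣ D k ∣ + r ^ k * C) (ℚ.+-identityʳ _)
        (ℚ.+-monoʳ-≤ (e * ∣ D k ∣) (*-nonNeg (^-nonNeg k) 0≤C)))
      (invariant k)
      where
      open ℚ.≤-Reasoning
      invariant : ∀ k → e * ∣ D k ∣ + r ^ k * C ≤ C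
      invariant zero = ℚ.≤-reflexive (trans (cong (λ t → e * ∣ t ∣ + 1ℚ * C) D0)
        (trans (cong₂ _+_ (ℚ.*-zeroʳ e) (ℚ.*-identityˡ C)) (ℚ.+-identityˡ C)))
      invariant (suc k) = begin
        e * ∣ D (suc k) ∣ + (r * r ^ k) * C
          ≡⟨ cong (λ t → e * ∣ t ∣ + (r * r ^ k) * C)
               (solve 2 (λ a b → a := (a :- b) :+ b) refl (D (suc k)) (D k)) ⟩
        e * ∣ (D (suc k) - D k) + D k ∣ + (r * r ^ k) * C
          ≤⟨ ℚ.+-monoˡ-≤ _ (*-monoˡ (ℚ.<⇒≤ 0<e) (ℚ.≤-trans
               (ℚ.∣p+q∣≤∣p∣+∣q∣ (D (suc k) - D k) (D k))
               (ℚ.+-monoˡ-≤ ∣ D k ∣ (step k)))) ⟩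
        (1ℚ - r) * (r ^ k * C + ∣ D k ∣) + (r * r ^ k) * C
          ≡⟨ solve 4 (λ r p c d → (con 1ℚ :- r) :* (p :* c :+ d) :+ (r :* p) :* c :=
                                  (con 1ℚ :- r) :* d :+ p :* c) refl r (r ^ k) C ∣ D k ∣ ⟩
        e * ∣ D k ∣ + r ^ k * C
          ≤⟨ invariant k ⟩
        C ∎

    sum-lipschitz : ∀ {z w} → ∣ z ∣ ≤ r → ∣ w ∣ ≤ r → ∀ n →
                    e * ∣ artanhSum n z - artanhSum n w ∣ ≤ ∣ z - w ∣
    sum-lipschitz {z} {w} hz hw = geometric (λ n → artanhSum n z - artanhSum n w)
      (ℚ.0≤∣p∣ (z - w)) refl
      (λ k → subst (λ t → ∣ t ∣ ≤ r ^ k * ∣ z - w ∣)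
        (solve 4 (λ a b c d → c :- d := ((a :+ c) :- (b :+ d)) :- (a :- b)) refl
          (artanhSum k z) (artanhSum k w) (artanhTerm k z) (artanhTerm k w))
        (term-lipschitz hz hw k))

    sum-tail : ∀ {z} → ∣ z ∣ ≤ r → ∀ n k →
               e * ∣ artanhSum (k ℕ.+ n) z - artanhSum n z ∣ ≤ r ^ n
    sum-tail {z} hz n = geometric (λ k → artanhSum (k ℕ.+ n) z - artanhSum n z)
      (^-nonNeg n) (ℚ.+-inverseʳ (artanhSum n z))
      (λ k → subst₂ (λ t u → ∣ t ∣ ≤ u)
        (solve 3 (λ a b c → c := ((a :+ c) :- b) :- (a :- b)) refl
          (artanhSum (k ℕ.+ n) z) (artanhSum n z) (artanhTerm (k ℕ.+ n) z))
        (^-+ k n)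
        (term-bound hz (k ℕ.+ n)))
      where
      ^-+ : ∀ k n → r ^ (k ℕ.+ n) ≡ r ^ k * r ^ n
      ^-+ zero    n = sym (ℚ.*-identityˡ (r ^ n))
      ^-+ (suc k) n = trans (cong (r *_) (^-+ k n)) (sym (ℚ.*-assoc r (r ^ k) (r ^ n)))

    sum-close : ∀ {z w ε} → ∣ z ∣ ≤ r → ∣ w ∣ ≤ r → ∀ m k →
                r ^ m ≤ (e * ε) * ½ → ∣ z - w ∣ ≤ (e * ε) * ½ →
                ∣ artanhSum (k ℕ.+ m) z - artanhSum m w ∣ ≤ ε
    sum-close {z} {w} {ε} hz hw m k small close = cancel 0<e (begin
      e * ∣ artanhSum n z - artanhSum m w ∣
        ≡⟨ cong (λ t → e * ∣ t ∣) (solve 3 (λ a b c → a :- c := (a :- b) :+ (b :- c)) refl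
             (artanhSum n z) (artanhSum m z) (artanhSum m w)) ⟩
      e * ∣ (artanhSum n z - artanhSum m z) + (artanhSum m z - artanhSum m w) ∣
        ≤⟨ *-monoˡ (ℚ.<⇒≤ 0<e)
             (ℚ.∣p+q∣≤∣p∣+∣q∣ (artanhSum n z - artanhSum m z) (artanhSum m z - artanhSum m w)) ⟩
      e * (∣ artanhSum n z - artanhSum m z ∣ + ∣ artanhSum m z - artanhSum m w ∣)
        ≡⟨ ℚ.*-distribˡ-+ e ∣ artanhSum n z - artanhSum m z ∣ ∣ artanhSum m z - artanhSum m w ∣ ⟩
      e * ∣ artanhSum n z - artanhSum m z ∣ + e * ∣ artanhSum m z - artanhSum m w ∣
        ≤⟨ ℚ.+-mono-≤ (sum-tail hz m k) (sum-lipschitz hz hw m) ⟩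
      r ^ m + ∣ z - w ∣
        ≤⟨ ℚ.+-mono-≤ small close ⟩
      (e * ε) * ½ + (e * ε) * ½
        ≡⟨ halves (e * ε) ⟩
      e * ε ∎)
      where
      open ℚ.≤-Reasoning
      n = k ℕ.+ m

    cauchy-artanh : ∀ {s} → Eventually (λ n → ∣ s n ∣ ≤ r) →
                    Cauchy s → Cauchy (λ n → artanhSum n (s n))
    cauchy-artanh {s} (K , s≤r) cs ε 0<ε =
      let M , h     = cs _ (half-pos (pos*pos 0<e 0<ε))
          L , small = ^-small _ (half-pos (pos*pos 0<e 0<ε))
          N         = (K ℕ.⊔ M) ℕ.⊔ L
          K≤N       = ℕ.≤-trans (ℕ.m≤m⊔n K M) (ℕ.m≤m⊔n (K ℕ.⊔ M) L)
          M≤N       = ℕ.≤-trans (ℕ.m≤n⊔m K M) (ℕ.m≤m⊔n (K ℕ.⊔ M) L)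
          L≤N       = ℕ.m≤n⊔m (K ℕ.⊔ M) L
      in N , symmetric N λ m k N≤m →
           let N≤n = ℕ.≤-trans N≤m (ℕ.m≤n+m m k) in
           sum-close (s≤r (k ℕ.+ m) (ℕ.≤-trans K≤N N≤n)) (s≤r m (ℕ.≤-trans K≤N N≤m)) m k
             (small m (ℕ.≤-trans L≤N N≤m))
             (h (k ℕ.+ m) m (ℕ.≤-trans M≤N N≤n) (ℕ.≤-trans M≤N N≤m))
      where
      symmetric : ∀ N →
        (∀ m k → N ℕ.≤ m → ∣ artanhSum (k ℕ.+ m) (s (k ℕ.+ m)) - artanhSum m (s m) ∣ ≤ ε) →
        ∀ m n → N ℕ.≤ m → N ℕ.≤ n → ∣ artanhSum m (s m) - artanhSum n (s n) ∣ ≤ ε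
      symmetric N ordered m n N≤m N≤n with ℕ.≤-total m n
      ... | inj₁ m≤n = subst (_≤ ε) (∣-∣-sym (artanhSum n (s n)) (artanhSum m (s m)))
        (subst (λ j → ∣ artanhSum j (s j) - artanhSum m (s m) ∣ ≤ ε) (ℕ.m∸n+n≡m m≤n)
          (ordered m (n ℕ.∸ m) N≤m))
      ... | inj₂ n≤m =
        subst (λ j → ∣ artanhSum j (s j) - artanhSum n (s n) ∣ ≤ ε) (ℕ.m∸n+n≡m n≤m)
          (ordered n (m ℕ.∸ n) N≤n)

  recip-anti : ∀ {a b} → 0ℚ < a → a ≤ b → recip b ≤ recip a
  recip-anti {a} {b} 0<a a≤b = begin
    recip b                    ≡⟨ ℚ.*-identityʳ (recip b) ⟨
    recip b * 1ℚ               ≡⟨ cong (λ t → recip b * t) (proj₂ (recip-pos 0<a)) ⟨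
    recip b * (a * recip a)    ≤⟨ *-monoˡ (ℚ.<⇒≤ (proj₁ (recip-pos 0<b))) (*-monoʳ (ℚ.<⇒≤ (proj₁ (recip-pos 0<a))) a≤b) ⟩
    recip b * (b * recip a)    ≡⟨ solve 3 (λ x b y → x :* (b :* y) := (b :* x) :* y) refl (recip b) b (recip a) ⟩
    (b * recip b) * recip a    ≡⟨ cong (_* recip a) (proj₂ (recip-pos 0<b)) ⟩
    1ℚ * recip a               ≡⟨ ℚ.*-identityˡ (recip a) ⟩
    recip a ∎
    where
    open ℚ.≤-Reasoning
    0<b : 0ℚ < b
    0<b = ℚ.<-≤-trans 0<a a≤b

  lower-unit : ∀ {c} → 0ℚ < c → ∃ λ c′ → 0ℚ < c′ × c′ ≤ c × c′ ≤ 1ℚ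
  lower-unit {c} 0<c with ℚ.≤-total c 1ℚ
  ... | inj₁ c≤1 = c  , 0<c , ℚ.≤-refl , c≤1
  ... | inj₂ 1≤c = 1ℚ , 0<1 , 1≤c , ℚ.≤-refl

  pos+1 : ∀ {q} → 0ℚ < q → 0ℚ < q + 1ℚ
  pos+1 0<q = ℚ.+-mono-< 0<q 0<1

  ≤+ʳ : ∀ {a b} → 0ℚ ≤ b → a ≤ a + b
  ≤+ʳ {a} {b} 0≤b = subst (_≤ a + b) (ℚ.+-identityʳ a) (ℚ.+-monoʳ-≤ a 0≤b)

  mobius : ℚ → ℚ
  mobius q = (q - 1ℚ) * recip (q + 1ℚ)

  mobius-<1 : ∀ {c q B} → 0ℚ < c → c ≤ 1ℚ → c ≤ q → ∣ q ∣ ≤ B →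
              ∣ mobius q ∣ + c * recip (B + 1ℚ) ≤ 1ℚ
  mobius-<1 {c} {q} {B} 0<c c≤1 c≤q q≤B = ≤-unshift (∣∣≤ upper lower)
    where
    open ℚ.≤-Reasoning
    u = recip (q + 1ℚ)
    v = recip (B + 1ℚ)
    0<q : 0ℚ < q
    0<q = ℚ.<-≤-trans 0<c c≤q
    0<u : 0ℚ < u
    0<u = proj₁ (recip-pos (pos+1 0<q))
    0≤v : 0ℚ ≤ v
    0≤v = ℚ.<⇒≤ (proj₁ (recip-pos (pos+1 (ℚ.<-≤-trans 0<q (ℚ.≤-trans (≤∣∣ q) q≤B)))))
    v≤u : v ≤ u
    v≤u = recip-anti (pos+1 0<q) (ℚ.+-monoˡ-≤ 1ℚ (ℚ.≤-trans (≤∣∣ q) q≤B))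
    unit : (q + 1ℚ) * u ≡ 1ℚ
    unit = proj₂ (recip-pos (pos+1 0<q))
    ≤-unshift : ∀ {a b d} → a ≤ b - d → a + d ≤ b
    ≤-unshift {a} {b} {d} h = subst (a + d ≤_)
      (solve 2 (λ b d → (b :- d) :+ d := b) refl b d) (ℚ.+-monoˡ-≤ d h)
    upper : mobius q ≤ 1ℚ - c * v
    upper = ≤-shift (begin
      (q - 1ℚ) * u + c * v    ≤⟨ ℚ.+-monoʳ-≤ ((q - 1ℚ) * u) (*-mono (ℚ.<⇒≤ 0<c) c≤1 0≤v v≤u) ⟩
      (q - 1ℚ) * u + 1ℚ * u   ≤⟨ ≤+ʳ (ℚ.<⇒≤ 0<u) ⟩
      ((q - 1ℚ) * u + 1ℚ * u) + u
        ≡⟨ solve 2 (λ q u → ((q :- con 1ℚ) :* u :+ con 1ℚ :* u) :+ u := (q :+ con 1ℚ) :* u) refl q u ⟩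
      (q + 1ℚ) * u            ≡⟨ unit ⟩
      1ℚ ∎)
    lower : - mobius q ≤ 1ℚ - c * v
    lower = ≤-shift (begin
      - ((q - 1ℚ) * u) + c * v    ≤⟨ ℚ.+-monoʳ-≤ (- ((q - 1ℚ) * u)) (*-mono (ℚ.<⇒≤ 0<c) c≤q 0≤v v≤u) ⟩
      - ((q - 1ℚ) * u) + q * u    ≤⟨ ≤+ʳ (*-nonNeg (ℚ.<⇒≤ 0<q) (ℚ.<⇒≤ 0<u)) ⟩
      (- ((q - 1ℚ) * u) + q * u) + q * u
        ≡⟨ solve 2 (λ q u → (:- ((q :- con 1ℚ) :* u) :+ q :* u) :+ q :* u := (q :+ con 1ℚ) :* u) refl q u ⟩
      (q + 1ℚ) * u                ≡⟨ unit ⟩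
      1ℚ ∎)

  mobius-≥ : ∀ {ε q B} → 0ℚ < ε → 1ℚ + ε ≤ q → ∣ q ∣ ≤ B → ε * recip (B + 1ℚ) ≤ mobius q
  mobius-≥ {ε} {q} {B} 0<ε h q≤B = *-mono (ℚ.<⇒≤ 0<ε)
    (≤-shift (subst (_≤ q) (ℚ.+-comm 1ℚ ε) h))
    (ℚ.<⇒≤ (proj₁ (recip-pos (pos+1 (ℚ.<-≤-trans 0<q (ℚ.≤-trans (≤∣∣ q) q≤B))))))
    (recip-anti (pos+1 0<q) (ℚ.+-monoˡ-≤ 1ℚ (ℚ.≤-trans (≤∣∣ q) q≤B)))
    where
    0<q : 0ℚ < q
    0<q = ℚ.<-≤-trans 0<1 (ℚ.≤-trans (≤+ʳ (ℚ.<⇒≤ 0<ε)) h)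

  mobius-≥½ : ∀ {q} → ι 3 ≤ q → ½ ≤ mobius q
  mobius-≥½ {q} 3≤q = begin
    ½                                ≡⟨ ℚ.*-identityʳ ½ ⟨
    ½ * 1ℚ                           ≡⟨ cong (λ t → ½ * t) (proj₂ (recip-pos (pos+1 0<q))) ⟨
    ½ * ((q + 1ℚ) * recip (q + 1ℚ))  ≡⟨ ℚ.*-assoc ½ (q + 1ℚ) (recip (q + 1ℚ)) ⟨
    (½ * (q + 1ℚ)) * recip (q + 1ℚ)  ≤⟨ *-monoʳ (ℚ.<⇒≤ (proj₁ (recip-pos (pos+1 0<q)))) half ⟩
    (q - 1ℚ) * recip (q + 1ℚ) ∎
    where
    open ℚ.≤-Reasoning
    0<q : 0ℚ < q
    0<q = ℚ.<-≤-trans (ℚ.positive⁻¹ (ι 3)) 3≤q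
    half : ½ * (q + 1ℚ) ≤ q - 1ℚ
    half = begin
      ½ * (q + 1ℚ)                      ≤⟨ ≤+ʳ (*-nonNeg (ℚ.<⇒≤ (ℚ.positive⁻¹ ½)) (diff-nonNeg 3≤q)) ⟩
      ½ * (q + 1ℚ) + ½ * (q - ι 3)
        ≡⟨ solve 1 (λ q → con ½ :* (q :+ con 1ℚ) :+ con ½ :* (q :- con (ι 3)) := q :- con 1ℚ) refl q ⟩
      q - 1ℚ ∎

  ^-mono : ∀ {z w} → 0ℚ ≤ z → z ≤ w → ∀ j → 0ℚ ≤ z ^ j × z ^ j ≤ w ^ j
  ^-mono 0≤z z≤w zero    = ℚ.<⇒≤ 0<1 , ℚ.≤-refl
  ^-mono 0≤z z≤w (suc j) =
    let 0≤zʲ , zʲ≤wʲ = ^-mono 0≤z z≤w j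
    in *-nonNeg 0≤z 0≤zʲ , *-mono 0≤z z≤w 0≤zʲ zʲ≤wʲ

  term-mono : ∀ {z w} → 0ℚ ≤ z → z ≤ w → ∀ k →
              0ℚ ≤ artanhTerm k z × artanhTerm k z ≤ artanhTerm k w
  term-mono 0≤z z≤w k =
    let 0≤zʲ , zʲ≤wʲ = ^-mono 0≤z z≤w (suc (2 ℕ.* k))
        0≤c          = ℚ.<⇒≤ (unitFrac-pos (2 ℕ.* k))
    in *-nonNeg 0≤c 0≤zʲ , *-monoˡ 0≤c zʲ≤wʲ

  sum-mono : ∀ {z w} → 0ℚ ≤ z → z ≤ w → ∀ n → artanhSum n z ≤ artanhSum n w
  sum-mono 0≤z z≤w zero    = ℚ.≤-refl
  sum-mono 0≤z z≤w (suc n) = ℚ.+-mono-≤ (sum-mono 0≤z z≤w n) (proj₂ (term-mono 0≤z z≤w n))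

  sum-inc : ∀ {z} → 0ℚ ≤ z → ∀ {m n} → m ℕ.≤ n → artanhSum m z ≤ artanhSum n z
  sum-inc {z} 0≤z {m} {n} m≤n = subst (λ j → artanhSum m z ≤ artanhSum j z) (ℕ.m∸n+n≡m m≤n) (go (n ℕ.∸ m))
    where
    go : ∀ k → artanhSum m z ≤ artanhSum (k ℕ.+ m) z
    go zero    = ℚ.≤-refl
    go (suc k) = ℚ.≤-trans (go k) (≤+ʳ (proj₁ (term-mono 0≤z ℚ.≤-refl (k ℕ.+ m))))

  sum-≥ : ∀ {z n} → 0ℚ ≤ z → 1 ℕ.≤ n → z ≤ artanhSum n z
  sum-≥ {z} {n} 0≤z 1≤n = subst (_≤ artanhSum n z)
    (solve 1 (λ z → con 0ℚ :+ con 1ℚ :* (z :* con 1ℚ) := z) refl z) (sum-inc 0≤z 1≤n)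

  -- 2 artanh (1/2) ≥ 2 (1/2 + (1/2)³/3) = 13/12
  sum-≥13/24 : ∀ {z n} → ½ ≤ z → 2 ℕ.≤ n → + 13 ℚ./ 24 ≤ artanhSum n z
  sum-≥13/24 {z} {n} ½≤z 2≤n = ℚ.≤-trans
    (ℚ.≤-reflexive {+ 13 ℚ./ 24} {artanhSum 2 ½} refl)
    (ℚ.≤-trans (sum-mono (ℚ.<⇒≤ (ℚ.positive⁻¹ ½)) ½≤z 2)
      (sum-inc (ℚ.≤-trans (ℚ.<⇒≤ (ℚ.positive⁻¹ ½)) ½≤z) 2≤n))

open Estimates using (Cauchy; Eventually; ι; artanhSum)

infix 4 _<_ _≤_

-- Reals as Cauchy sequences of rationals; equality of reals is  x ≤ y × y ≤ x.

record ℝ : Set where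
  constructor mkℝ
  field
    seq    : ℕ → ℚ
    cauchy : Cauchy seq

open ℝ public

record _≤_ (x y : ℝ) : Set where
  constructor *≤*
  field
    drop-*≤* : ∀ ε → 0ℚ ℚ.< ε → Eventually λ n → seq x n ℚ.≤ seq y n ℚ.+ ε

record _<_ (x y : ℝ) : Set where
  constructor *<*
  field
    drop-*<* : ∃ λ ε → 0ℚ ℚ.< ε × Eventually λ n → seq x n ℚ.+ ε ℚ.≤ seq y n

open _≤_ public
open _<_ public

fromℚ : ℚ → ℝ
fromℚ q = mkℝ (λ _ → q) (Estimates.cauchy-const q)

fromℕ : ℕ → ℝ
fromℕ n = fromℚ (ι n)

0ℝ 1ℝ 2ℝ : ℝ
0ℝ = fromℚ 0ℚ
1ℝ = fromℚ 1ℚ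
2ℝ = fromℕ 2

infix  8 -_
infix  9 _²
infixl 7 _*_ _/_[_]
infixl 6 _+_ _-_

-- The operations are opaque so that type checking does not unfold rational
-- arithmetic; each is applied termwise, as the accompanying equation says.

opaque

  _+_ : ℝ → ℝ → ℝ
  x + y = mkℝ (λ n → seq x n ℚ.+ seq y n)
    (Estimates.cauchy-+ {seq x} {seq y} (cauchy x) (cauchy y))

  -_ : ℝ → ℝ
  - x = mkℝ (λ n → ℚ.- seq x n) (Estimates.cauchy-- {seq x} (cauchy x))

  _*_ : ℝ → ℝ → ℝ
  x * y = mkℝ (λ n → seq x n ℚ.* seq y n)
    (Estimates.cauchy-* {seq x} {seq y} (cauchy x) (cauchy y))

  ∣_∣ : ℝ → ℝ
  ∣ x ∣ = mkℝ (λ n → ℚ.∣ seq x n ∣) (Estimates.cauchy-∣∣ {seq x} (cauchy x))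

  -- Estimates.recip q  is 1/q, or 0 if q = 0; since x is positive only finitely
  -- many terms of seq x can be 0.
  recip : (x : ℝ) → 0ℝ < x → ℝ
  recip x (*<* (ε , 0<ε , N , ε≤x)) = mkℝ (λ n → Estimates.recip (seq x n))
    (Estimates.cauchy-recip {seq x} 0<ε
      (N , λ n N≤n → subst (ℚ._≤ seq x n) (ℚ.+-identityˡ ε) (ε≤x n N≤n)) (cauchy x))

  seq-+ : ∀ x y n → seq (x + y) n ≡ seq x n ℚ.+ seq y n
  seq-+ _ _ _ = refl

  seq-- : ∀ x n → seq (- x) n ≡ ℚ.- seq x n
  seq-- _ _ = refl

  seq-* : ∀ x y n → seq (x * y) n ≡ seq x n ℚ.* seq y n
  seq-* _ _ _ = refl

  seq-∣∣ : ∀ x n → seq ∣ x ∣ n ≡ ℚ.∣ seq x n ∣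
  seq-∣∣ _ _ = refl

  seq-recip : ∀ x 0<x n → seq (recip x 0<x) n ≡ Estimates.recip (seq x n)
  seq-recip _ _ _ = refl

_-_ : ℝ → ℝ → ℝ
x - y = x + (- y)

_/_[_] : (x y : ℝ) → 0ℝ < y → ℝ
x / y [ 0<y ] = x * recip y 0<y

_² : ℝ → ℝ
x ² = x * x

pos+ : ∀ {x y} → 0ℝ < x → 0ℝ < y → 0ℝ < x + y
pos+ {x} {y} (*<* (δ , 0<δ , D)) (*<* (ε , 0<ε , E)) =
  *<* (δ ℚ.+ ε , ℚ.+-mono-< 0<δ 0<ε , Estimates.both
    (λ n p q → subst₂ ℚ._≤_
      (trans (cong₂ ℚ._+_ (ℚ.+-identityˡ δ) (ℚ.+-identityˡ ε)) (sym (ℚ.+-identityˡ (δ ℚ.+ ε))))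
      (sym (seq-+ x y n))
      (ℚ.+-mono-≤ p q))
    D E)

pos* : ∀ {x y} → 0ℝ < x → 0ℝ < y → 0ℝ < x * y
pos* {x} {y} (*<* (δ , 0<δ , D)) (*<* (ε , 0<ε , E)) =
  *<* (δ ℚ.* ε , Estimates.pos*pos 0<δ 0<ε , Estimates.both
    (λ n p q → subst₂ ℚ._≤_ (sym (ℚ.+-identityˡ (δ ℚ.* ε))) (sym (seq-* x y n))
      (Estimates.*-mono (ℚ.<⇒≤ 0<δ) (subst (ℚ._≤ seq x n) (ℚ.+-identityˡ δ) p)
                        (ℚ.<⇒≤ 0<ε) (subst (ℚ._≤ seq y n) (ℚ.+-identityˡ ε) q)))
    D E)

pos-recip : ∀ {x} (0<x : 0ℝ < x) → 0ℝ < recip x 0<x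
pos-recip {x} 0<x@(*<* (ε , 0<ε , N , ε≤x)) = close (Estimates.cauchy-bounded {seq x} (cauchy x))
  where
  close : (∃ λ B → 0ℚ ℚ.< B × Eventually (λ n → ℚ.∣ seq x n ∣ ℚ.≤ B)) → 0ℝ < recip x 0<x
  close (B , 0<B , bounded) = *<*
    (Estimates.recip B , proj₁ (Estimates.recip-pos 0<B) , Estimates.both
      (λ n p q → subst₂ ℚ._≤_ (sym (ℚ.+-identityˡ (Estimates.recip B))) (sym (seq-recip x 0<x n))
        (Estimates.recip-anti {seq x n} {B}
          (ℚ.<-≤-trans 0<ε (subst (ℚ._≤ seq x n) (ℚ.+-identityˡ ε) p))
          (ℚ.≤-trans (Estimates.≤∣∣ (seq x n)) q)))
      (N , ε≤x) bounded)

pos/ : ∀ {x y} → 0ℝ < x → (0<y : 0ℝ < y) → 0ℝ < x / y [ 0<y ]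
pos/ 0<x 0<y = pos* 0<x (pos-recip 0<y)

0<1 : 0ℝ < 1ℝ
0<1 = *<* (1ℚ , Estimates.0<1 , 0 , λ _ _ → ℚ.≤-refl)

0<2 : 0ℝ < 2ℝ
0<2 = *<* (ι 2 , ℚ.positive⁻¹ (ι 2) , 0 , λ _ _ → ℚ.≤-refl)

∣∣<1-bound : ∀ x ε n → seq ∣ x ∣ n ℚ.+ ε ℚ.≤ 1ℚ → ℚ.∣ seq x n ∣ ℚ.≤ 1ℚ ℚ.- ε
∣∣<1-bound x ε n h = Estimates.≤-shift (subst (λ t → t ℚ.+ ε ℚ.≤ 1ℚ) (seq-∣∣ x n) h)

opaque

  artanh : (x : ℝ) → ∣ x ∣ < 1ℝ → ℝ
  artanh x (*<* (ε , 0<ε , N , ∣x∣+ε≤1)) = mkℝ (λ n → artanhSum n (seq x n))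
    (Estimates.cauchy-artanh {1ℚ ℚ.- ε}
      (ℚ.≤-trans (ℚ.0≤∣p∣ (seq x N)) (∣∣<1-bound x ε N (∣x∣+ε≤1 N ℕ.≤-refl)))
      (subst (1ℚ ℚ.- ε ℚ.<_) (ℚ.+-identityʳ 1ℚ) (ℚ.+-monoʳ-< 1ℚ (ℚ.neg-antimono-< 0<ε)))
      {seq x} (N , λ n N≤n → ∣∣<1-bound x ε n (∣x∣+ε≤1 n N≤n)) (cauchy x))

  seq-artanh : ∀ x ∣x∣<1 n → seq (artanh x ∣x∣<1) n ≡ artanhSum n (seq x n)
  seq-artanh _ _ _ = refl

mobius : ∀ x → 0ℝ < x → ℝ
mobius x 0<x = (x - 1ℝ) / (x + 1ℝ) [ pos+ 0<x 0<1 ]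

seq-mobius : ∀ x (0<x : 0ℝ < x) n → seq (mobius x 0<x) n ≡ Estimates.mobius (seq x n)
seq-mobius x 0<x n = trans (seq-* (x - 1ℝ) (recip (x + 1ℝ) (pos+ 0<x 0<1)) n)
  (cong₂ ℚ._*_
    (trans (seq-+ x (- 1ℝ) n) (cong (seq x n ℚ.+_) (seq-- 1ℝ n)))
    (trans (seq-recip (x + 1ℝ) (pos+ 0<x 0<1) n) (cong Estimates.recip (seq-+ x 1ℝ n))))

∣mobius∣<1 : ∀ x (0<x : 0ℝ < x) → ∣ mobius x 0<x ∣ < 1ℝ
∣mobius∣<1 x 0<x@(*<* (ε , 0<ε , E)) =
  close (Estimates.lower-unit 0<ε) (Estimates.cauchy-bounded {seq x} (cauchy x))
  where
  close : (∃ λ c → 0ℚ ℚ.< c × c ℚ.≤ ε × c ℚ.≤ 1ℚ) →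
          (∃ λ B → 0ℚ ℚ.< B × Eventually (λ n → ℚ.∣ seq x n ∣ ℚ.≤ B)) →
          ∣ mobius x 0<x ∣ < 1ℝ
  close (c , 0<c , c≤ε , c≤1) (B , 0<B , bounded) = *<*
    (c ℚ.* Estimates.recip (B ℚ.+ 1ℚ) ,
     Estimates.pos*pos 0<c (proj₁ (Estimates.recip-pos (Estimates.pos+1 0<B))) ,
     Estimates.both
       (λ n p q → subst (λ t → t ℚ.+ c ℚ.* Estimates.recip (B ℚ.+ 1ℚ) ℚ.≤ 1ℚ)
         (sym (trans (seq-∣∣ (mobius x 0<x) n) (cong ℚ.∣_∣ (seq-mobius x 0<x n))))
         (Estimates.mobius-<1 {c} {seq x n} {B} 0<c c≤1
           (ℚ.≤-trans c≤ε (subst (ℚ._≤ seq x n) (ℚ.+-identityˡ ε) p)) q))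
       E bounded)

-- The natural logarithm.  For x > 0 put z = (x - 1)/(x + 1), so that |z| < 1 and
-- x = (1 + z)/(1 - z); then  log x = log (1 + z) - log (1 - z) = 2 artanh z.

log : (x : ℝ) → 0ℝ < x → ℝ
log x 0<x = 2ℝ * artanh (mobius x 0<x) (∣mobius∣<1 x 0<x)

seq-log : ∀ x (0<x : 0ℝ < x) n →
          seq (log x 0<x) n ≡ ι 2 ℚ.* artanhSum n (Estimates.mobius (seq x n))
seq-log x 0<x n = trans (seq-* 2ℝ (artanh (mobius x 0<x) (∣mobius∣<1 x 0<x)) n)
  (cong (ι 2 ℚ.*_) (trans (seq-artanh (mobius x 0<x) (∣mobius∣<1 x 0<x) n)
    (cong (artanhSum n) (seq-mobius x 0<x n))))

log-pos : ∀ x (0<x : 0ℝ < x) → 1ℝ < x → 0ℝ < log x 0<x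
log-pos x 0<x (*<* (ε , 0<ε , E)) = close (Estimates.cauchy-bounded {seq x} (cauchy x))
  where
  close : (∃ λ B → 0ℚ ℚ.< B × Eventually (λ n → ℚ.∣ seq x n ∣ ℚ.≤ B)) → 0ℝ < log x 0<x
  close (B , 0<B , bounded) = *<*
    (ι 2 ℚ.* δ , Estimates.pos*pos (ℚ.positive⁻¹ (ι 2)) 0<δ ,
     Estimates.both
       (λ n 1≤n z≥ → subst₂ ℚ._≤_ (sym (ℚ.+-identityˡ (ι 2 ℚ.* δ))) (sym (seq-log x 0<x n))
         (Estimates.*-monoˡ {ι 2} (ℚ.<⇒≤ (ℚ.positive⁻¹ (ι 2)))
           (ℚ.≤-trans z≥ (Estimates.sum-≥ {_} {n} (ℚ.≤-trans (ℚ.<⇒≤ 0<δ) z≥) 1≤n))))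
       (1 , λ _ 1≤n → 1≤n)
       (Estimates.both {R = λ n → δ ℚ.≤ Estimates.mobius (seq x n)}
         (λ n p q → Estimates.mobius-≥ {ε} {seq x n} {B} 0<ε p q) E bounded))
    where
    δ = ε ℚ.* Estimates.recip (B ℚ.+ 1ℚ)
    0<δ : 0ℚ ℚ.< δ
    0<δ = Estimates.pos*pos 0<ε (proj₁ (Estimates.recip-pos (Estimates.pos+1 0<B)))

0<fromℕ : ∀ n → .{{NonZero n}} → 0ℝ < fromℕ n
0<fromℕ (suc n) = *<* (1ℚ , Estimates.0<1 , 0 , λ _ _ → Estimates.ι-mono (s≤s (z≤n {n})))

logℕ : (n : ℕ) → .{{NonZero n}} → ℝ
logℕ n = log (fromℕ n) (0<fromℕ n)

logℕ-pos : ∀ n .{{_ : NonZero n}} → 2 ℕ.≤ n → 0ℝ < logℕ n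
logℕ-pos n 2≤n = log-pos (fromℕ n) (0<fromℕ n)
  (*<* (1ℚ , Estimates.0<1 , 0 , λ _ _ → Estimates.ι-mono 2≤n))

1<logℕ : ∀ n .{{_ : NonZero n}} → 3 ℕ.≤ n → 1ℝ < logℕ n
1<logℕ n 3≤n = *<* (+ 1 ℚ./ 12 , ℚ.positive⁻¹ (+ 1 ℚ./ 12) , 2 , λ k 2≤k →
  subst (1ℚ ℚ.+ + 1 ℚ./ 12 ℚ.≤_) (sym (seq-log (fromℕ n) (0<fromℕ n) k))
    (Estimates.*-monoˡ {ι 2} {+ 13 ℚ./ 24} (ℚ.<⇒≤ (ℚ.positive⁻¹ (ι 2)))
      (Estimates.sum-≥13/24 {_} {k} (Estimates.mobius-≥½ {ι n} (Estimates.ι-mono 3≤n)) 2≤k)))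

module _ {c ℓ} (G : AbelianGroup c ℓ) where

  open AbelianGroup G using (Carrier; _≈_; _∙_)

  NoUniqueSum : ∀ {a} → Pred Carrier a → Set _
  NoUniqueSum A = ∀ a b → a ∈ A → b ∈ A → ∃₂ λ x y →
    x ∈ A × y ∈ A × (a ∙ b ≈ x ∙ y) × ¬ ((a ≈ x × b ≈ y) ⊎ (a ≈ y × b ≈ x))

module _ (n : ℕ) .{{_ : NonZero n}} where

  private
    _⊕_ : Fin n → Fin n → Fin n
    i ⊕ j = (toℕ i ℕ.+ toℕ j) ℕ.mod n

    0# : Fin n
    0# = 0 ℕ.mod n

    neg : Fin n → Fin n
    neg i = (n ℕ.∸ toℕ i) ℕ.mod n

    toℕ-mod : ∀ k → toℕ (k ℕ.mod n) ≡ k ℕ.% n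
    toℕ-mod k = Fin.toℕ-fromℕ< (ℕ.m%n<n k n)

    toℕ-% : ∀ (i : Fin n) → toℕ i ℕ.% n ≡ toℕ i
    toℕ-% i = ℕ.m<n⇒m%n≡m (Fin.toℕ<n i)

    mod-cong : ∀ {k l} → k ℕ.% n ≡ l ℕ.% n → k ℕ.mod n ≡ l ℕ.mod n
    mod-cong {k} {l} e = Fin.toℕ-injective (trans (toℕ-mod k) (trans e (sym (toℕ-mod l))))

    mod-toℕ : ∀ i → toℕ i ℕ.mod n ≡ i
    mod-toℕ i = Fin.toℕ-injective (trans (toℕ-mod (toℕ i)) (toℕ-% i))

    %-+ˡ : ∀ k l → (k ℕ.% n ℕ.+ l) ℕ.% n ≡ (k ℕ.+ l) ℕ.% n
    %-+ˡ k l = trans (ℕ.%-distribˡ-+ (k ℕ.% n) l n)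
      (trans (cong (λ t → (t ℕ.+ l ℕ.% n) ℕ.% n) (ℕ.m%n%n≡m%n k n)) (sym (ℕ.%-distribˡ-+ k l n)))

    ⊕-mod : ∀ k j → (k ℕ.mod n) ⊕ j ≡ (k ℕ.+ toℕ j) ℕ.mod n
    ⊕-mod k j = mod-cong (trans (cong (λ t → (t ℕ.+ toℕ j) ℕ.% n) (toℕ-mod k)) (%-+ˡ k (toℕ j)))

    ⊕-comm : ∀ i j → i ⊕ j ≡ j ⊕ i
    ⊕-comm i j = cong (ℕ._mod n) (ℕ.+-comm (toℕ i) (toℕ j))

    ⊕-assoc : ∀ i j k → (i ⊕ j) ⊕ k ≡ i ⊕ (j ⊕ k)
    ⊕-assoc i j k = trans (⊕-mod (toℕ i ℕ.+ toℕ j) k) (sym (trans (⊕-comm i (j ⊕ k))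
      (trans (⊕-mod (toℕ j ℕ.+ toℕ k) i) (cong (ℕ._mod n)
        (trans (ℕ.+-comm _ (toℕ i)) (sym (ℕ.+-assoc (toℕ i) (toℕ j) (toℕ k))))))))

    ⊕-identityˡ : ∀ i → 0# ⊕ i ≡ i
    ⊕-identityˡ i = trans (⊕-mod 0 i) (mod-toℕ i)

    ⊕-inverseˡ : ∀ i → neg i ⊕ i ≡ 0#
    ⊕-inverseˡ i = trans (⊕-mod (n ℕ.∸ toℕ i) i) (mod-cong (trans
      (cong (ℕ._% n) (ℕ.m∸n+n≡m (ℕ.<⇒≤ (Fin.toℕ<n i))))
      (trans (ℕ.n%n≡0 n) (sym (ℕ.m<n⇒m%n≡m (ℕ.>-nonZero⁻¹ n))))))

  ℤ/ : AbelianGroup 0ℓ 0ℓ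
  ℤ/ = record
    { Carrier        = Fin n
    ; _≈_            = _≡_
    ; _∙_            = _⊕_
    ; ε              = 0#
    ; _⁻¹            = neg
    ; isAbelianGroup = record
      { isGroup = record
        { isMonoid = record
          { isSemigroup = record
            { isMagma = record { isEquivalence = isEquivalence ; ∙-cong = cong₂ _⊕_ }
            ; assoc   = ⊕-assoc
            }
          ; identity = ⊕-identityˡ , λ i → trans (⊕-comm i 0#) (⊕-identityˡ i)
          }
        ; inverse = ⊕-inverseˡ , λ i → trans (⊕-comm i (neg i)) (⊕-inverseˡ i)
        ; ⁻¹-cong = cong neg
        }
      ; comm = ⊕-comm
      }
    }

record Prime≥3 : Set where
  field
    value   : ℕ
    isPrime : Prime value
    ≥3      : 3 ℕ.≤ value

open Prime≥3 public

value-nonZero : ∀ p → NonZero (value p)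
value-nonZero p = ℕ.>-nonZero (ℕ.≤-trans (s≤s z≤n) (≥3 p))

ℤ/p : Prime≥3 → AbelianGroup 0ℓ 0ℓ
ℤ/p p = ℤ/ (value p) {{value-nonZero p}}

HasNoUniqueSum : (p : Prime≥3) → Subset (value p) → Set
HasNoUniqueSum p A = NoUniqueSum (ℤ/p p) (λ x → x Subset.∈ A)

IsCardinality : Prime≥3 → ℕ → Set
IsCardinality p k = ∃ λ (A : Subset (value p)) →
  2 ℕ.≤ Subset.∣ A ∣ × HasNoUniqueSum p A × Subset.∣ A ∣ ≡ k

IsMinimum : (ℕ → Set) → ℕ → Set
IsMinimum P k = P k × ∀ j → P j → k ℕ.≤ j

minimum : ∀ {P : ℕ → Set} → (∀ k → Dec (P k)) → ∀ n → P n → ∃ (IsMinimum P)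
minimum {P} P? n Pn with search (suc n)
  where
  search : ∀ m → ∃ (IsMinimum P) ⊎ (∀ j → P j → m ℕ.≤ j)
  search zero = inj₂ λ _ _ → z≤n
  search (suc m) with search m
  ... | inj₁ found = inj₁ found
  ... | inj₂ none with P? m
  ...   | yes Pm = inj₁ (m , Pm , none)
  ...   | no ¬Pm = inj₂ λ j Pj → ℕ.≤∧≢⇒< (none j Pj) λ { refl → ¬Pm Pj }
... | inj₁ found = found
... | inj₂ none  = ⊥-elim (ℕ.<-irrefl refl (none n Pn))

outside-pair : ∀ {n} → 3 ℕ.≤ n → (a b : Fin n) → ∃ λ x → a ≢ x × b ≢ x
outside-pair (s≤s (s≤s (s≤s _))) zero          zero          = suc zero , (λ ()) , (λ ())
outside-pair (s≤s (s≤s (s≤s _))) zero          (suc zero)    = suc (suc zero) , (λ ()) , (λ ())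
outside-pair (s≤s (s≤s (s≤s _))) zero          (suc (suc _)) = suc zero , (λ ()) , (λ ())
outside-pair (s≤s (s≤s (s≤s _))) (suc zero)    zero          = suc (suc zero) , (λ ()) , (λ ())
outside-pair (s≤s (s≤s (s≤s _))) (suc (suc _)) zero          = suc zero , (λ ()) , (λ ())
outside-pair (s≤s (s≤s (s≤s _))) (suc _)       (suc _)       = zero , (λ ()) , (λ ())

module _ (p : Prime≥3) where

  open AbelianGroup (ℤ/p p) using (_∙_; _⁻¹; assoc; inverseʳ; identityˡ)

  hasNoUniqueSum? : ∀ A → Dec (HasNoUniqueSum p A)
  hasNoUniqueSum? A = Fin.all? λ a → Fin.all? λ b → (a Subset.∈? A) →-dec ((b Subset.∈? A) →-dec
    Fin.any? λ x → Fin.any? λ y → (x Subset.∈? A) ×-dec ((y Subset.∈? A) ×-dec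
      (((a ∙ b) Fin.≟ (x ∙ y)) ×-dec
        ¬? (((a Fin.≟ x) ×-dec (b Fin.≟ y)) ⊎-dec ((a Fin.≟ y) ×-dec (b Fin.≟ x))))))

  whole-hasNoUniqueSum : HasNoUniqueSum p Subset.⊤
  whole-hasNoUniqueSum a b _ _ =
    let x , a≢x , b≢x = outside-pair (≥3 p) a b
    in x , x ⁻¹ ∙ (a ∙ b) , Subset.∈⊤ , Subset.∈⊤ ,
       sym (trans (sym (assoc x (x ⁻¹) (a ∙ b)))
         (trans (cong (_∙ (a ∙ b)) (inverseʳ x)) (identityˡ (a ∙ b)))) ,
       λ { (inj₁ (a≡x , _)) → a≢x a≡x ; (inj₂ (_ , b≡x)) → b≢x b≡x }

  m-exists : ∃ (IsMinimum (IsCardinality p))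
  m-exists = minimum
    (λ k → Subset.anySubset? λ A →
      (2 ℕ.≤? Subset.∣ A ∣) ×-dec (hasNoUniqueSum? A ×-dec (Subset.∣ A ∣ ℕ.≟ k)))
    (value p)
    (Subset.⊤ , subst (2 ℕ.≤_) (sym (Subset.∣⊤∣≡n (value p))) (ℕ.<⇒≤ (≥3 p)) ,
      whole-hasNoUniqueSum , Subset.∣⊤∣≡n (value p))

  m : ℕ
  m = proj₁ m-exists

  m-isMinimum : IsMinimum (IsCardinality p) m
  m-isMinimum = proj₂ m-exists

log3>0 : 0ℝ < logℕ 3
log3>0 = logℕ-pos 3 (s≤s (s≤s z≤n))

log2>0 : 0ℝ < logℕ 2
log2>0 = logℕ-pos 2 (s≤s (s≤s z≤n))

log₂ : (n : ℕ) → .{{NonZero n}} → ℝ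
log₂ n = logℕ n / logℕ 2 [ log2>0 ]

log₂3>0 : 0ℝ < log₂ 3
log₂3>0 = pos/ log3>0 log2>0

c₀ : ℝ
c₀ = 1ℝ / (2ℝ * log₂ 3 ²) [ pos* 0<2 (pos* log₂3>0 log₂3>0) ]

module _ (p : Prime≥3) where

  private instance
    p≢0 : NonZero (value p)
    p≢0 = value-nonZero p

  log-p : ℝ
  log-p = logℕ (value p)

  log₂-p : ℝ
  log₂-p = log₂ (value p)

  log-p>0 : 0ℝ < log-p
  log-p>0 = logℕ-pos (value p) (ℕ.<⇒≤ (≥3 p))

  log-log-p : ℝ
  log-log-p = log log-p log-p>0

  log-log-p>0 : 0ℝ < log-log-p
  log-log-p>0 = log-pos log-p log-p>0 (1<logℕ (value p) (≥3 p))

  bound : ℝ → ℝ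
  bound x =
    log-p ² / (2ℝ * logℕ 3 ²) [ pos* 0<2 (pos* log3>0 log3>0) ]
    + (2ℝ / logℕ 3 [ log3>0 ] + x) * (log-p ² / log-log-p [ log-log-p>0 ])

ForLargePrimes : (Prime≥3 → Set) → Set
ForLargePrimes P = ∃ λ N → ∀ p → N ℕ.≤ value p → P p

Is-o1 : (Prime≥3 → ℝ) → Set
Is-o1 f = ∀ ε → 0ℝ < ε → ForLargePrimes λ p → ∣ f p ∣ ≤ ε

{-# OPTIONS --safe #-}
-- If E ⊆ ℤ/p contains 0, 1, -1 and every e ∈ E satisfies 3e = g + h with g, h ∈ E, then
-- A = E + E has no unique sum: (x + y) + (z + w) can be regrouped unless three of x, y, z, w
-- coincide, and 3e + f = g + h + 0 + f takes care of that case.  Take the powers of 3 up to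
-- 3ⁿ ≈ p; two relations are missing, for 3 · 3ⁿ and for the element -1.  Both are supplied
-- by chains leading from an arbitrary residue Y to the powers of 3: with the base-3ᵏ
-- digits of Y grouped by value, as in Yao's addition chains, log p / (k log 3) + O(3ᵏ)
-- elements suffice.  With k slightly below log₃ log p this gives
-- |E| ≤ log p / log 3 + (2 + o(1)) log p / log log p, and |A| ≤ |E| (|E| + 1) / 2.
--
-- The logarithms are handled through (x - y)/x ≤ log x - log y ≤ (x - y)/y for x ≥ y ≥ 1;
-- these bounds are invariant under scaling, which gives log 3ᵃ = a log 3.
module Submission where

-- A chain leading to Y is an addition chain for Y read backwards and rescaled: a relation x = g + h
-- becomes 3x = 3g + 3h, so an element used q steps away from Y occurs multiplied by 3^q. This
-- factor is why the powers of 3 go beyond p, up to n = 3ᵏ + k m for m digits: Horner's scheme has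
-- depth 3ᵏ. All relations hold between natural numbers, except that 3ⁿ⁺¹ is replaced by its
-- residue.
--
-- The coefficient 2 / log 3 comes from there being two chains. Each has about one element per
-- digit, that is l / K with l = log₃ p and K = log₃ log p, so |E| is about l (1 + 2 / K) and |A|
-- about l² (1/2 + 2 / K), where 1 / K is log 3 / log log p. To keep logarithms out of the
-- construction, l and K are integer parts, and the bound for |A| is an inequality between natural
-- numbers with 1 / s in the role of ε.
--
-- A logarithm is given by a sequence of partial sums, and these satisfy log (c x) = log c + log x
-- only in the limit; hence the detour through difference quotients.

module AdditionChain where

  open import Data.Bool using (true; false; if_then_else_)
  open import Data.List using (List; []; _∷_; _++_; length)
  open import Data.List.Membership.Propositional using (_∈_)
  open import Data.List.Membership.Propositional.Properties using (∈-++⁺ˡ; ∈-++⁺ʳ; ∈-++⁻)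
  open import Data.List.Properties using (length-++)
  open import Data.List.Relation.Binary.Subset.Propositional using (_⊆_)
  open import Data.List.Relation.Unary.Any using (here; there)
  open import Data.Nat
  open import Data.Nat.DivMod
  open import Data.Nat.Properties
  open import Data.Nat.Tactic.RingSolver using (solve-∀)
  open import Data.Product using (∃₂; _×_; _,_)
  open import Data.Sum using (inj₁; inj₂)
  open import Relation.Binary.Definitions using (tri<; tri≈; tri>)
  open import Relation.Binary.PropositionalEquality
  open import Relation.Nullary using (yes; no; contradiction)

  -- Relations 3x = g + h between natural numbers.

  Supported : List ℕ → List ℕ → Set
  Supported L F = ∀ {x} → x ∈ F → ∃₂ λ g h → g ∈ L × h ∈ L × 3 * x ≡ g + h

  supported-[] : ∀ {L} → Supported L []
  supported-[] ()

  supported-∷ : ∀ {L F x g h} → g ∈ L → h ∈ L → 3 * x ≡ g + h → Supported L F → Supported L (x ∷ F)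
  supported-∷ g∈L h∈L e s (here refl) = _ , _ , g∈L , h∈L , e
  supported-∷ g∈L h∈L e s (there x∈F) = s x∈F

  supported-++ : ∀ {L} F {G} → Supported L F → Supported L G → Supported L (F ++ G)
  supported-++ F s t x∈ with ∈-++⁻ F x∈
  ... | inj₁ x∈F = s x∈F
  ... | inj₂ x∈G = t x∈G

  powers : ℕ → List ℕ
  powers zero    = 1 ∷ 0 ∷ []
  powers (suc n) = 3 ^ suc n ∷ powers n

  0∈powers : ∀ n → 0 ∈ powers n
  0∈powers zero    = there (here refl)
  0∈powers (suc n) = there (0∈powers n)

  3^∈powers : ∀ {i n} → i ≤ n → 3 ^ i ∈ powers n
  3^∈powers {n = zero}  z≤n = here refl
  3^∈powers {n = suc n} i≤1+n with m≤n⇒m<n∨m≡n i≤1+n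
  ... | inj₁ (s≤s i≤n) = there (3^∈powers i≤n)
  ... | inj₂ refl      = here refl

  length-powers : ∀ n → length (powers n) ≡ 2 + n
  length-powers zero    = refl
  length-powers (suc n) = cong suc (length-powers n)

  -- The relations are 3 · 3ⁱ = 3ⁱ⁺¹ + 0. Only the one for the top power leaves the list, so 3ⁿ⁺¹
  -- has to be supplied by `L`.
  supported-powers : ∀ {L} n → 3 ^ suc n ∈ L → powers n ⊆ L → Supported L (powers n)
  supported-powers {L} n top sub = go n top sub
    where
    triple : ∀ x → 3 * x ≡ 3 * x + 0
    triple x = sym (+-identityʳ (3 * x))
    go : ∀ m → 3 ^ suc m ∈ L → powers m ⊆ L → Supported L (powers m)
    go zero    t s = supported-∷ t (s (there (here refl))) refl
      (supported-∷ (s (there (here refl))) (s (there (here refl))) refl supported-[])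
    go (suc m) t s = supported-∷ t (sub (0∈powers n)) (triple (3 ^ suc m))
      (go m (s (here refl)) λ x∈ → s (there x∈))

  -- The base-3ᵏ digits of a number are grouped by value: T d m collects the powers
  -- 3^(k i), i < m, whose digit is d.  Multiplying by 3 while removing the largest
  -- summand keeps every removed summand among the powers up to 3ⁿ.
  module _ (k : ℕ) .{{_ : NonZero k}} (dig : ℕ → ℕ) where

    -- The sum of w (dig i) 3^(k i) over i < m. It is additive in w, so relations between such sums
    -- reduce to identities between weights of a single digit.
    weighted : (ℕ → ℕ) → ℕ → ℕ
    weighted w zero    = 0
    weighted w (suc m) = weighted w m + w (dig m) * 3 ^ (k * m)

    weighted-+ : ∀ v w m → weighted (λ e → v e + w e) m ≡ weighted v m + weighted w m
    weighted-+ v w zero    = refl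
    weighted-+ v w (suc m) = trans (cong (_+ (v (dig m) + w (dig m)) * 3 ^ (k * m)) (weighted-+ v w m))
      (interchange (weighted v m) (weighted w m) (v (dig m)) (w (dig m)) (3 ^ (k * m)))
      where
      interchange : ∀ a b c d e → a + b + (c + d) * e ≡ a + c * e + (b + d * e)
      interchange = solve-∀

    weighted-cong : ∀ {v w} → (∀ i → v (dig i) ≡ w (dig i)) → ∀ m → weighted v m ≡ weighted w m
    weighted-cong v≗w zero    = refl
    weighted-cong v≗w (suc m) = cong₂ (λ a b → a + b * 3 ^ (k * m)) (weighted-cong v≗w m) (v≗w m)

    δ : ℕ → ℕ → ℕ
    δ d e = if d ≡ᵇ e then 1 else 0

    T : ℕ → ℕ → ℕ
    T d = weighted (δ d)

    chain : ℕ → ℕ → ℕ → List ℕ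
    chain d q zero    = []
    chain d q (suc m) with d ≡ᵇ dig m
    ... | true  = 3 ^ q * T d (suc m) ∷ chain d (suc q) m
    ... | false = chain d q m

    module _ {L : List ℕ} {n : ℕ} (P⊆L : powers n ⊆ L) where

      private
        0∈L : ∀ q → 3 ^ q * 0 ∈ L
        0∈L q = subst (_∈ L) (sym (*-zeroʳ (3 ^ q))) (P⊆L (0∈powers n))

      T∈L : ∀ d q m → chain d q m ⊆ L → 3 ^ q * T d m ∈ L
      T∈L d q zero    sub = 0∈L q
      T∈L d q (suc m) sub with d ≡ᵇ dig m in eq
      ... | true  = subst (λ b → 3 ^ q * (T d m + (if b then 1 else 0) * 3 ^ (k * m)) ∈ L) eq (sub (here refl))
      ... | false = subst (λ t → 3 ^ q * t ∈ L) (sym (+-identityʳ (T d m))) (T∈L d q m sub)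

      -- Going down one position lowers k m by k ≥ 1 while q rises by at most 1. So q + k m never
      -- increases, and each removed summand is a power of 3 with exponent at most n.
      supported-chain : ∀ d q m → q + k * m ≤ n → chain d q m ⊆ L → Supported L (chain d q m)
      supported-chain d q zero    _     sub = supported-[]
      supported-chain d q (suc m) bound sub with d ≡ᵇ dig m in eq
      ... | true  = supported-∷ (T∈L d (suc q) m (λ x∈ → sub (there x∈))) (P⊆L (3^∈powers bound′))
          (begin
            3 * (3 ^ q * T d (suc m))
              ≡⟨ cong (λ b → 3 * (3 ^ q * (T d m + (if b then 1 else 0) * 3 ^ (k * m)))) eq ⟩
            3 * (3 ^ q * (T d m + 1 * 3 ^ (k * m)))
              ≡⟨ regroup (3 ^ q) (T d m) (3 ^ (k * m)) ⟩
            3 ^ suc q * T d m + 3 ^ suc q * 3 ^ (k * m)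
              ≡⟨ cong (3 ^ suc q * T d m +_) (^-distribˡ-+-* 3 (suc q) (k * m)) ⟨
            3 ^ suc q * T d m + 3 ^ (suc q + k * m) ∎)
          (supported-chain d (suc q) m bound′ (λ x∈ → sub (there x∈)))
        where
        open ≡-Reasoning
        bound′ : suc q + k * m ≤ n
        bound′ = ≤-trans (≤-trans (≤-reflexive (sym (+-suc q (k * m))))
          (+-monoʳ-≤ q (≤-trans (+-monoˡ-≤ (k * m) (>-nonZero⁻¹ k)) (≤-reflexive (sym (*-suc k m)))))) bound
        regroup : ∀ a t b → 3 * (a * (t + 1 * b)) ≡ 3 * a * t + 3 * a * b
        regroup = solve-∀
      ... | false = supported-chain d q m
          (≤-trans (+-monoʳ-≤ q (*-monoʳ-≤ k (n≤1+n m))) bound) sub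

    -- Weights whose weighted sums are G_d and S_d, built from the c digit values d, ..., d + c - 1.
    -- For e < d + c they are the indicator of d ≤ e and the difference e ∸ d.
    atLeast excess : ℕ → ℕ → ℕ → ℕ
    atLeast zero    d e = 0
    atLeast (suc c) d e = δ d e + atLeast c (suc d) e
    excess  zero    d e = 0
    excess  (suc c) d e = excess c (suc d) e + atLeast c (suc d) e

    -- Horner's scheme for Σ d T_d: with G_d = Σ_{e ≥ d} T_e and S_d = Σ_{e > d} G_e the
    -- factors 3ᵈ make 3 (3ᵈ G_d) and 3 (3ᵈ S_d) sums of two earlier elements.
    horner : ℕ → ℕ → ℕ → List ℕ
    horner m zero    d = []
    horner m (suc c) d = 3 ^ d * weighted (atLeast (suc c) d) m ∷ 3 ^ d * weighted (excess (suc c) d) m ∷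
      chain d (suc d) m ++ horner m c (suc d)

    module _ {L : List ℕ} {n m : ℕ} (P⊆L : powers n ⊆ L) where

      private
        0∈L : ∀ c w → (∀ e → w e ≡ 0) → 3 ^ c * weighted w m ∈ L
        0∈L c w w≡0 = subst (_∈ L) (sym (trans (cong (3 ^ c *_) (trans (weighted-cong (λ i → w≡0 (dig i)) m) (zeros m)))
          (*-zeroʳ (3 ^ c)))) (P⊆L (0∈powers n))
          where
          zeros : ∀ m → weighted (λ _ → 0) m ≡ 0
          zeros zero    = refl
          zeros (suc m) = trans (+-identityʳ _) (zeros m)

      atLeast∈L : ∀ c d → horner m c d ⊆ L → 3 ^ d * weighted (atLeast c d) m ∈ L
      atLeast∈L zero    d sub = 0∈L d (atLeast zero d) (λ _ → refl)
      atLeast∈L (suc c) d sub = sub (here refl)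

      excess∈L : ∀ c d → horner m c d ⊆ L → 3 ^ d * weighted (excess c d) m ∈ L
      excess∈L zero    d sub = 0∈L d (excess zero d) (λ _ → refl)
      excess∈L (suc c) d sub = sub (there (here refl))

      -- T_d enters the relation for 3ᵈ G_d with the factor 3ᵈ⁺¹, which is why its chain starts at
      -- exponent d + 1. Since c + d stays constant along the recursion, all these exponents are at
      -- most the initial c + d.
      supported-horner : ∀ c d → c + d + k * m ≤ n → horner m c d ⊆ L → Supported L (horner m c d)
      supported-horner zero    d bound sub = supported-[]
      supported-horner (suc c) d bound sub =
        supported-∷ (T∈L P⊆L d (suc d) m chain⊆) (atLeast∈L c (suc d) rest⊆)
          (step (δ d) (atLeast c (suc d)))
        (supported-∷ (excess∈L c (suc d) rest⊆) (atLeast∈L c (suc d) rest⊆)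
          (step (excess c (suc d)) (atLeast c (suc d)))
        (supported-++ (chain d (suc d) m)
          (supported-chain P⊆L d (suc d) m
            (≤-trans (+-monoˡ-≤ (k * m) (s≤s (m≤n+m d c))) bound) chain⊆)
          (supported-horner c (suc d) (subst (λ t → t + k * m ≤ n) (sym (+-suc c d)) bound) rest⊆)))
        where
        chain⊆ : chain d (suc d) m ⊆ L
        chain⊆ x∈ = sub (there (there (∈-++⁺ˡ x∈)))
        rest⊆ : horner m c (suc d) ⊆ L
        rest⊆ x∈ = sub (there (there (∈-++⁺ʳ (chain d (suc d) m) x∈)))
        step : ∀ v w → 3 * (3 ^ d * weighted (λ e → v e + w e) m) ≡
                       3 ^ suc d * weighted v m + 3 ^ suc d * weighted w m
        step v w = begin
          3 * (3 ^ d * weighted (λ e → v e + w e) m)         ≡⟨ *-assoc 3 (3 ^ d) _ ⟨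
          3 ^ suc d * weighted (λ e → v e + w e) m           ≡⟨ cong (3 ^ suc d *_) (weighted-+ v w m) ⟩
          3 ^ suc d * (weighted v m + weighted w m)          ≡⟨ *-distribˡ-+ (3 ^ suc d) (weighted v m) (weighted w m) ⟩
          3 ^ suc d * weighted v m + 3 ^ suc d * weighted w m ∎
          where open ≡-Reasoning

    -- Values of the weights and lengths of the lists.

    δ-refl : ∀ d → δ d d ≡ 1
    δ-refl zero    = refl
    δ-refl (suc d) = δ-refl d

    δ-< : ∀ {d e} → e < d → δ d e ≡ 0
    δ-< {e = zero}  (s≤s _)   = refl
    δ-< {e = suc _} (s≤s e<d) = δ-< e<d

    δ-> : ∀ {d e} → d < e → δ d e ≡ 0
    δ-> {d = zero}  (s≤s _)   = refl
    δ-> {d = suc _} (s≤s d<e) = δ-> d<e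

    atLeast-< : ∀ c {d e} → e < d → atLeast c d e ≡ 0
    atLeast-< zero    e<d = refl
    atLeast-< (suc c) e<d = cong₂ _+_ (δ-< e<d) (atLeast-< c (m<n⇒m<1+n e<d))

    atLeast-≥ : ∀ c {d e} → d ≤ e → e < c + d → atLeast c d e ≡ 1
    atLeast-≥ zero    d≤e e<d = contradiction d≤e (<⇒≱ e<d)
    atLeast-≥ (suc c) {d} {e} d≤e e<  with m≤n⇒m<n∨m≡n d≤e
    ... | inj₂ refl = cong₂ _+_ (δ-refl d) (atLeast-< c ≤-refl)
    ... | inj₁ d<e  = cong₂ _+_ (δ-> d<e) (atLeast-≥ c d<e (subst (e <_) (sym (+-suc c d)) e<))

    atLeast-≤1 : ∀ c d e → atLeast c d e ≤ 1
    atLeast-≤1 zero    d e = z≤n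
    atLeast-≤1 (suc c) d e with <-cmp d e
    ... | tri< d<e _ _  = ≤-trans (≤-reflexive (cong (_+ atLeast c (suc d) e) (δ-> d<e))) (atLeast-≤1 c (suc d) e)
    ... | tri≈ _ refl _ = ≤-reflexive (cong₂ _+_ (δ-refl d) (atLeast-< c ≤-refl))
    ... | tri> _ _ e<d  = ≤-trans (≤-reflexive (atLeast-< (suc c) e<d)) z≤n

    excess-∸ : ∀ c {d e} → e < c + d → excess c d e ≡ e ∸ d
    excess-∸ zero    e<d = sym (m≤n⇒m∸n≡0 (<⇒≤ e<d))
    excess-∸ (suc c) {d} {e} e< with d <? e
    ... | yes d<e = begin
      excess c (suc d) e + atLeast c (suc d) e  ≡⟨ cong₂ _+_ (excess-∸ c e<′) (atLeast-≥ c d<e e<′) ⟩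
      (e ∸ suc d) + 1                           ≡⟨ +-comm (e ∸ suc d) 1 ⟩
      suc (e ∸ suc d)                           ≡⟨ +-∸-assoc 1 d<e ⟨
      e ∸ d                                     ∎
      where
      open ≡-Reasoning
      e<′ : e < c + suc d
      e<′ = subst (e <_) (sym (+-suc c d)) e<
    ... | no d≮e = begin
      excess c (suc d) e + atLeast c (suc d) e
        ≡⟨ cong₂ _+_ (excess-∸ c (subst (e <_) (sym (+-suc c d)) e<)) (atLeast-< c (s≤s (≮⇒≥ d≮e))) ⟩
      (e ∸ suc d) + 0
        ≡⟨ trans (+-identityʳ _) (trans (m≤n⇒m∸n≡0 (m≤n⇒m≤1+n (≮⇒≥ d≮e))) (sym (m≤n⇒m∸n≡0 (≮⇒≥ d≮e)))) ⟩
      e ∸ d ∎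
      where open ≡-Reasoning

    -- The number of positions below m whose digit is one of d, ..., d + c - 1: the combined length
    -- of the chains for these values.
    total : ℕ → ℕ → ℕ → ℕ
    total c d zero    = 0
    total c d (suc m) = atLeast c d (dig m) + total c d m

    -- A position has a single digit, so it lengthens at most one chain: over all 3ᵏ values the
    -- chains cost m elements, not 3ᵏ m.
    total-≤ : ∀ c d m → total c d m ≤ m
    total-≤ c d zero    = z≤n
    total-≤ c d (suc m) = +-mono-≤ (atLeast-≤1 c d (dig m)) (total-≤ c d m)

    count : ℕ → ℕ → ℕ
    count d zero    = 0
    count d (suc m) = δ d (dig m) + count d m

    length-chain : ∀ d q m → length (chain d q m) ≡ count d m
    length-chain d q zero    = refl
    length-chain d q (suc m) with d ≡ᵇ dig m
    ... | true  = cong suc (length-chain d (suc q) m)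
    ... | false = length-chain d q m

    total-suc : ∀ c d m → total (suc c) d m ≡ count d m + total c (suc d) m
    total-suc c d zero    = refl
    total-suc c d (suc m) = trans (cong (δ d (dig m) + atLeast c (suc d) (dig m) +_) (total-suc c d m))
      (interchange (δ d (dig m)) (atLeast c (suc d) (dig m)) (count d m) (total c (suc d) m))
      where
      interchange : ∀ a b x y → a + b + (x + y) ≡ a + x + (b + y)
      interchange = solve-∀

    length-horner : ∀ m c d → length (horner m c d) ≡ 2 * c + total c d m
    length-horner m zero    d = sym (zeros m)
      where
      zeros : ∀ m → total 0 d m ≡ 0
      zeros zero    = refl
      zeros (suc m) = zeros m
    length-horner m (suc c) d = begin
      2 + length (chain d (suc d) m ++ horner m c (suc d))
        ≡⟨ cong (2 +_) (trans (length-++ (chain d (suc d) m)) (cong₂ _+_ (length-chain d (suc d) m) (length-horner m c (suc d)))) ⟩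
      2 + (count d m + (2 * c + total c (suc d) m))
        ≡⟨ regroup (count d m) c (total c (suc d) m) ⟩
      2 * suc c + (count d m + total c (suc d) m)
        ≡⟨ cong (2 * suc c +_) (total-suc c d m) ⟨
      2 * suc c + total (suc c) d m ∎
      where
      open ≡-Reasoning
      regroup : ∀ x c y → 2 + (x + (2 * c + y)) ≡ 2 * (1 + c) + (x + y)
      regroup = solve-∀

  -- Base-3ᵏ digits and the chain of a given number.

  _/3^_ _%3^_ : ℕ → ℕ → ℕ
  n /3^ e = _/_ n (3 ^ e) {{m^n≢0 3 e}}
  n %3^ e = _%_ n (3 ^ e) {{m^n≢0 3 e}}

  /3^-suc : ∀ n d e → n /3^ (d + e) ≡ (n /3^ e) /3^ d
  /3^-suc n d e = begin
    n /3^ (d + e)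
      ≡⟨ /-congʳ {{m^n≢0 3 (d + e)}} {{nz}} (trans (^-distribˡ-+-* 3 d e) (*-comm (3 ^ d) (3 ^ e))) ⟩
    _/_ n (3 ^ e * 3 ^ d) {{nz}}
      ≡⟨ m/n/o≡m/[n*o] n (3 ^ e) (3 ^ d) {{m^n≢0 3 e}} {{m^n≢0 3 d}} {{nz}} ⟨
    (n /3^ e) /3^ d ∎
    where
    open ≡-Reasoning
    nz : NonZero (3 ^ e * 3 ^ d)
    nz = m*n≢0 (3 ^ e) (3 ^ d) {{m^n≢0 3 e}} {{m^n≢0 3 d}}

  module _ (k : ℕ) .{{_ : NonZero k}} where

    digit : ℕ → ℕ → ℕ
    digit Y m = (Y /3^ (k * m)) %3^ k

    -- The lowest m digits together with 3^(k m) times the quotient of Y by 3^(k m) give Y for every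
    -- m; here the quotient is 0.
    weighted-digit : ∀ Y m → Y < 3 ^ (k * m) → weighted k (digit Y) (λ e → e) m ≡ Y
    weighted-digit Y m Y< = begin
      w m                       ≡⟨ +-identityʳ (w m) ⟨
      w m + 0                   ≡⟨ cong (w m +_) (*-zeroʳ (3 ^ (k * m))) ⟨
      w m + 3 ^ (k * m) * 0     ≡⟨ cong (λ t → w m + 3 ^ (k * m) * t) (m<n⇒m/n≡0 {{m^n≢0 3 (k * m)}} Y<) ⟨
      w m + 3 ^ (k * m) * q m   ≡⟨ go m ⟩
      Y                         ∎
      where
      open ≡-Reasoning
      w q : ℕ → ℕ
      w = weighted k (digit Y) (λ e → e)
      q m = Y /3^ (k * m)
      regroup : ∀ a r b x c → a + r * b + c * b * x ≡ a + b * (r + x * c)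
      regroup = solve-∀
      go : ∀ m → w m + 3 ^ (k * m) * q m ≡ Y
      -- `k * 0` does not reduce for a variable `k`, and it also occurs in the nonzero divisor;
      -- abstracting the exponent lets it be replaced by 0 everywhere at once.
      go zero    = go-zero (*-zeroʳ k)
        where
        go-zero : ∀ {e} → e ≡ 0 → 3 ^ e * (Y /3^ e) ≡ Y
        go-zero refl = trans (*-identityˡ (Y / 1)) (n/1≡n Y)
      go (suc m) = begin
        w m + q m %3^ k * 3 ^ (k * m) + 3 ^ (k * suc m) * q (suc m)
          ≡⟨ cong (λ e → w m + q m %3^ k * 3 ^ (k * m) + 3 ^ e * (Y /3^ e)) (*-suc k m) ⟩
        w m + q m %3^ k * 3 ^ (k * m) + 3 ^ (k + k * m) * (Y /3^ (k + k * m))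
          ≡⟨ cong₂ (λ a b → w m + q m %3^ k * 3 ^ (k * m) + a * b) (^-distribˡ-+-* 3 k (k * m)) (/3^-suc Y k (k * m)) ⟩
        w m + q m %3^ k * 3 ^ (k * m) + 3 ^ k * 3 ^ (k * m) * (q m /3^ k)
          ≡⟨ regroup (w m) (q m %3^ k) (3 ^ (k * m)) (q m /3^ k) (3 ^ k) ⟩
        w m + 3 ^ (k * m) * (q m %3^ k + q m /3^ k * 3 ^ k)
          ≡⟨ cong (λ t → w m + 3 ^ (k * m) * t) (m≡m%n+[m/n]*n (q m) (3 ^ k) {{m^n≢0 3 k}}) ⟨
        w m + 3 ^ (k * m) * q m
          ≡⟨ go m ⟩
        Y ∎

    yao : ℕ → ℕ → List ℕ
    yao m Y = horner k (digit Y) m (3 ^ k) 0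

    length-yao : ∀ m Y → length (yao m Y) ≤ 2 * 3 ^ k + m
    length-yao m Y = ≤-trans (≤-reflexive (length-horner k (digit Y) m (3 ^ k) 0))
      (+-monoʳ-≤ (2 * 3 ^ k) (total-≤ k (digit Y) (3 ^ k) 0 m))

    module _ {L : List ℕ} {m : ℕ} (P⊆L : powers (3 ^ k + k * m) ⊆ L) {Y : ℕ} (yao⊆L : yao m Y ⊆ L) where

      supported-yao : Supported L (yao m Y)
      supported-yao = supported-horner k (digit Y) P⊆L (3 ^ k) 0
        (≤-reflexive (cong (_+ k * m) (+-identityʳ (3 ^ k)))) yao⊆L

      -- The element 3⁰ S_0 of the Horner list is Y itself: the weight `excess` at d = 0 with all 3ᵏ
      -- digit values is the digit, so S_0 is the digit expansion.
      Y∈yao : Y < 3 ^ (k * m) → Y ∈ L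
      Y∈yao Y< = subst (_∈ L)
        (trans (*-identityˡ _) (trans (weighted-cong k (digit Y) excess≡ m) (weighted-digit Y m Y<)))
        (excess∈L k (digit Y) P⊆L (3 ^ k) 0 yao⊆L)
        where
        excess≡ : ∀ i → excess k (digit Y) (3 ^ k) 0 (digit Y i) ≡ digit Y i
        excess≡ i = excess-∸ k (digit Y) (3 ^ k) (subst (digit Y i <_) (sym (+-identityʳ (3 ^ k)))
          (m%n<n _ (3 ^ k) {{m^n≢0 3 k}}))

-- The sumset E + E in an abelian group without 2- and 3-torsion.

module Sumset where

  open import Algebra.Bundles using (AbelianGroup)
  import Algebra.Properties.Group as GroupProperties
  import Algebra.Solver.CommutativeMonoid as Solver
  open import Data.Product using (∃₂; _×_; _,_)
  open import Data.Sum using (inj₁; inj₂)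
  open import Defs using (NoUniqueSum)
  open import Relation.Binary.Definitions using (Decidable)
  open import Relation.Nullary using (¬_; Dec; yes; no; contradiction)
  open import Relation.Unary using (Pred; _∈_)

  module _ {c ℓ} (G : AbelianGroup c ℓ) where

    open AbelianGroup G

    sumset : ∀ {a} → Pred Carrier a → Pred Carrier _
    sumset E x = ∃₂ λ y z → y ∈ E × z ∈ E × x ≈ y ∙ z

    module _ {a} {E : Pred Carrier a} (_≟_ : Decidable _≈_)
             (2-torsion-free : ∀ x → x ∙ x ≈ ε → x ≈ ε)
             (3-torsion-free : ∀ x → x ∙ (x ∙ x) ≈ ε → x ≈ ε)
             {u : Carrier} (u≉ε : ¬ u ≈ ε) (ε∈E : ε ∈ E) (u∈E : u ∈ E) (-u∈E : u ⁻¹ ∈ E)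
             (thirds : ∀ {e} → e ∈ E → ∃₂ λ g h → g ∈ E × h ∈ E × e ∙ (e ∙ e) ≈ g ∙ h) where

      private
        open GroupProperties group using (∙-cancelˡ)
        open Solver commutativeMonoid using (solve; _⊜_; _⊕_)

        -- If z differs from both x and y, the pairs {z, w} and {x, y} cannot agree in either order;
        -- nothing has to be asked of w.
        Other : Carrier → Carrier → Set _
        Other x y = ∃₂ λ z w → z ∈ sumset E × w ∈ sumset E × x ∙ y ≈ z ∙ w × ¬ x ≈ z × ¬ y ≈ z

        member : ∀ {x} → x ∈ E → x ∈ sumset E
        member {x} x∈E = x , ε , x∈E , ε∈E , sym (identityʳ x)

        cancel : ∀ a {x y b c} → x ≈ y → x ≈ a ∙ b → y ≈ a ∙ c → b ≈ c
        cancel a x≈y x≈ab y≈ac = ∙-cancelˡ a _ _ (trans (sym x≈ab) (trans x≈y y≈ac))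

        respects : ∀ {x x′ y y′} → x ≈ x′ → y ≈ y′ → Other x y → Other x′ y′
        respects x≈ y≈ (z , w , z∈ , w∈ , sum , x≉z , y≉z) = z , w , z∈ , w∈ ,
          trans (sym (∙-cong x≈ y≈)) sum , (λ e → x≉z (trans x≈ e)) , λ e → y≉z (trans y≈ e)

        -- 0 + f = u + (-u + f) works unless f = u. In that case -u takes the place of u: it is
        -- different from 0, and from f = u because there is no 2-torsion.
        triple-ε : ∀ {f} → f ∈ E → Other ε f
        triple-ε {f} f∈E with f ≟ u
        ... | no f≉u = u , u ⁻¹ ∙ f , member u∈E , (u ⁻¹ , f , -u∈E , f∈E , refl) ,
          sym (trans (sym (assoc u (u ⁻¹) f)) (∙-congʳ (inverseʳ u))) , (λ e → u≉ε (sym e)) , f≉u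
        ... | yes f≈u = u ⁻¹ , u ∙ f , member -u∈E , (u , f , u∈E , f∈E , refl) ,
          sym (trans (sym (assoc (u ⁻¹) u f)) (∙-congʳ (inverseˡ u))) ,
          (λ e → u≉ε (trans (sym (identityʳ u)) (trans (∙-congˡ e) (inverseʳ u)))) ,
          λ e → u≉ε (2-torsion-free u (trans (∙-congˡ (trans (sym f≈u) e)) (inverseʳ u)))

        -- The sum is 3e + f = (g + h) + f, and 3e equals one of the old summands 2e, e + f only if
        -- e = 0, settled by `triple-ε`, or f = 2e. In the latter case the old summands are 2e and
        -- 3e, and f is joined to g or to h instead.
        triple : ∀ {e f} → e ∈ E → f ∈ E → Other (e ∙ e) (e ∙ f)
        triple {e} {f} e∈E f∈E with e ≟ ε | thirds e∈E
        ... | yes e≈ε | _ = respects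
          (sym (trans (∙-cong e≈ε e≈ε) (identityˡ ε))) (sym (trans (∙-congʳ e≈ε) (identityˡ f))) (triple-ε f∈E)
        ... | no e≉ε | g , h , g∈E , h∈E , 3e≈gh with f ≟ (e ∙ e)
        ...   | no f≉2e = g ∙ h , f , (g , h , g∈E , h∈E , refl) , member f∈E ,
          trans (solve 2 (λ e f → (e ⊕ e) ⊕ (e ⊕ f) ⊜ (e ⊕ (e ⊕ e)) ⊕ f) refl e f) (∙-congʳ 3e≈gh) ,
          (λ 2e≈gh → e≉ε (sym (cancel (e ∙ e) (trans 2e≈gh (sym 3e≈gh)) (sym (identityʳ (e ∙ e))) (sym (assoc e e e))))) ,
          λ ef≈gh → f≉2e (cancel e (trans ef≈gh (sym 3e≈gh)) refl refl)
        ...   | yes f≈2e = choose ((e ∙ e) ≟ g) ((e ∙ f) ≟ g) ((e ∙ e) ≟ h) ((e ∙ f) ≟ h)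
          where
          3e : Carrier
          3e = e ∙ (e ∙ e)
          split : ∀ {x y} → x ∈ E → y ∈ E → 3e ≈ x ∙ y → ¬ e ∙ e ≈ x → ¬ e ∙ f ≈ x → Other (e ∙ e) (e ∙ f)
          split {x} {y} x∈E y∈E 3e≈xy ≉₁ ≉₂ = x , y ∙ f , member x∈E , (y , f , y∈E , f∈E , refl) ,
            trans (solve 2 (λ e f → (e ⊕ e) ⊕ (e ⊕ f) ⊜ (e ⊕ (e ⊕ e)) ⊕ f) refl e f)
              (trans (∙-congʳ 3e≈xy) (assoc x y f)) , ≉₁ , ≉₂
          ef≈3e : e ∙ f ≈ 3e
          ef≈3e = ∙-congˡ f≈2e
          excess : ∀ {x y d} → 3e ≈ x ∙ y → x ∙ y ≈ 3e ∙ d → d ≈ ε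
          excess 3e≈xy xy≈ = sym (cancel 3e (trans 3e≈xy xy≈) (sym (identityʳ 3e)) refl)
          -- If neither g nor h can stand alone, both lie in {2e, 3e}. Then 3e = g + h is 4e, 5e or
          -- 6e, so that e, 2e or 3e vanishes, against e ≠ 0.
          choose : Dec (e ∙ e ≈ g) → Dec (e ∙ f ≈ g) → Dec (e ∙ e ≈ h) → Dec (e ∙ f ≈ h) → Other (e ∙ e) (e ∙ f)
          choose (no ≉₁) (no ≉₂) _ _ = split g∈E h∈E 3e≈gh ≉₁ ≉₂
          choose _ _ (no ≉₁) (no ≉₂) = split h∈E g∈E (trans 3e≈gh (comm g h)) ≉₁ ≉₂
          choose (yes p) _ (yes q) _ = contradiction (excess 3e≈gh (trans (sym (∙-cong p q))
            (solve 1 (λ e → (e ⊕ e) ⊕ (e ⊕ e) ⊜ (e ⊕ (e ⊕ e)) ⊕ e) refl e))) e≉ε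
          choose (yes p) _ _ (yes q) = contradiction (2-torsion-free e (excess 3e≈gh (trans (sym (∙-cong p (trans (sym ef≈3e) q)))
            (comm (e ∙ e) 3e)))) e≉ε
          choose _ (yes p) (yes q) _ = contradiction (2-torsion-free e (excess 3e≈gh
            (sym (∙-cong (trans (sym ef≈3e) p) q)))) e≉ε
          choose _ (yes p) _ (yes q) = contradiction (3-torsion-free e (excess 3e≈gh
            (sym (∙-cong (trans (sym ef≈3e) p) (trans (sym ef≈3e) q))))) e≉ε

        swap : ∀ {x y z w} → x ∈ E → y ∈ E → z ∈ E → w ∈ E → ¬ y ≈ z → ¬ x ≈ w → Other (x ∙ y) (z ∙ w)
        swap {x} {y} {z} {w} x∈E y∈E z∈E w∈E y≉z x≉w =
          x ∙ z , y ∙ w , (x , z , x∈E , z∈E , refl) , (y , w , y∈E , w∈E , refl) ,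
          solve 4 (λ x y z w → (x ⊕ y) ⊕ (z ⊕ w) ⊜ (x ⊕ z) ⊕ (y ⊕ w)) refl x y z w ,
          (λ e → y≉z (cancel x e refl refl)) , λ e → x≉w (sym (cancel z e refl (comm x z)))

        commute : ∀ {a b} → Other a b → Other b a
        commute {a} {b} (z , w , z∈ , w∈ , sum , ≉₁ , ≉₂) = z , w , z∈ , w∈ , trans (comm b a) sum , ≉₂ , ≉₁

        -- Regrouping as (x + z) + (y + w) needs y ≠ z and x ≠ w; as (x + w) + (y + z) it needs y ≠
        -- w and x ≠ z. If both fail, one equality from each pair holds, and in all four
        -- combinations three of the elements coincide.
        other : ∀ {x y z w} → x ∈ E → y ∈ E → z ∈ E → w ∈ E → Other (x ∙ y) (z ∙ w)
        other {x} {y} {z} {w} x∈E y∈E z∈E w∈E = cases (y ≟ z) (x ≟ w) (y ≟ w) (x ≟ z)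
          where
          cases : Dec (y ≈ z) → Dec (x ≈ w) → Dec (y ≈ w) → Dec (x ≈ z) → Other (x ∙ y) (z ∙ w)
          cases (no y≉z) (no x≉w) _ _ = swap x∈E y∈E z∈E w∈E y≉z x≉w
          cases _ _ (no y≉w) (no x≉z) = respects refl (comm w z) (swap x∈E y∈E w∈E z∈E y≉w x≉z)
          cases (yes y≈z) _ (yes y≈w) _ = commute (respects (∙-cong y≈z y≈w) (comm y x) (triple y∈E x∈E))
          cases (yes y≈z) _ _ (yes x≈z) = respects (∙-congˡ (trans x≈z (sym y≈z))) (∙-congʳ x≈z) (triple x∈E w∈E)
          cases _ (yes x≈w) (yes y≈w) _ = respects (∙-congˡ (trans x≈w (sym y≈w)))
            (trans (comm x z) (∙-congˡ x≈w)) (triple x∈E z∈E)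
          cases _ (yes x≈w) _ (yes x≈z) = commute (respects (∙-cong x≈z x≈w) refl (triple x∈E y∈E))

      sumset-noUniqueSum : NoUniqueSum G (sumset E)
      sumset-noUniqueSum a b (x , y , x∈E , y∈E , a≈) (z , w , z∈E , w∈E , b≈)
        with respects (sym a≈) (sym b≈) (other x∈E y∈E z∈E w∈E)
      ... | c , d , c∈ , d∈ , sum , a≉c , b≉c = c , d , c∈ , d∈ , sum ,
        λ { (inj₁ (a≈c , _)) → a≉c a≈c ; (inj₂ (_ , b≈c)) → b≉c b≈c }

-- The set A in ℤ/p for given window length and number of digits.

module Construction where

  open import Algebra.Bundles using (AbelianGroup)
  open import Data.Fin using (Fin; toℕ; zero; suc)
  import Data.Fin.Properties as Fin
  open import Data.Fin.Subset as Subset using (Subset; ⁅_⁆; _∪_; ⊥; ∣_∣; inside; outside)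
  open import Data.Fin.Subset.Properties as Subset using (x∈⁅x⁆; x∈⁅y⁆⇒x≡y; x∈p∪q⁻; x∈p∪q⁺; ∉⊥; ∣⊥∣≡0; ∪-identityˡ; p⊆q⇒∣p∣≤∣q∣; x∈p⇒∣p-x∣<∣p∣; x∈p∧x≢y⇒x∈p-y; ∣⁅x⁆∣≡1)
  open import Data.List using (List; []; _∷_; _++_; length; map)
  open import Data.List.Membership.Propositional using (_∈_)
  open import Data.List.Membership.Propositional.Properties using (∈-++⁺ˡ; ∈-++⁺ʳ; ∈-++⁻; ∈-map⁺; ∈-map⁻)
  open import Data.List.Properties using (length-++; length-map)
  open import Data.List.Relation.Unary.Any using (here; there)
  open import Data.Nat
  open import Data.Nat.Divisibility using (_∣_; m%n≡0⇒n∣m; ∣⇒≤)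
  open import Data.Nat.DivMod
  open import Data.Nat.Primality using (euclidsLemma)
  open import Data.Nat.Properties
  open import Data.Nat.Tactic.RingSolver using (solve-∀)
  open import Data.Product using (∃; ∃₂; _×_; _,_)
  open import Data.Sum using (inj₁; inj₂)
  open import Data.Vec using (_∷_)
  open import Defs using (Prime≥3; value; isPrime; value-nonZero; ℤ/p; HasNoUniqueSum)
  open import Relation.Binary.PropositionalEquality
  open import Relation.Nullary using (contradiction)
  open import Relation.Unary using () renaming (_∈_ to _∈ₚ_)
  open AdditionChain
  open Sumset

  ∣⁅x⁆∪p∣≤1+∣p∣ : ∀ {n} (x : Fin n) p → ∣ ⁅ x ⁆ ∪ p ∣ ≤ suc ∣ p ∣
  ∣⁅x⁆∪p∣≤1+∣p∣ zero    (inside  ∷ p) = s≤s (≤-trans (≤-reflexive (cong ∣_∣ (∪-identityˡ p))) (n≤1+n ∣ p ∣))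
  ∣⁅x⁆∪p∣≤1+∣p∣ zero    (outside ∷ p) = s≤s (≤-reflexive (cong ∣_∣ (∪-identityˡ p)))
  ∣⁅x⁆∪p∣≤1+∣p∣ (suc x) (inside  ∷ p) = s≤s (∣⁅x⁆∪p∣≤1+∣p∣ x p)
  ∣⁅x⁆∪p∣≤1+∣p∣ (suc x) (outside ∷ p) = ∣⁅x⁆∪p∣≤1+∣p∣ x p

  fromList : ∀ {n} → List (Fin n) → Subset n
  fromList []       = ⊥
  fromList (x ∷ xs) = ⁅ x ⁆ ∪ fromList xs

  ∣fromList∣≤length : ∀ {n} (xs : List (Fin n)) → ∣ fromList xs ∣ ≤ length xs
  ∣fromList∣≤length {n} [] = ≤-reflexive (∣⊥∣≡0 n)
  ∣fromList∣≤length (x ∷ xs) = ≤-trans (∣⁅x⁆∪p∣≤1+∣p∣ x (fromList xs)) (s≤s (∣fromList∣≤length xs))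

  ∈-fromList⁺ : ∀ {n} {x : Fin n} {xs} → x ∈ xs → x Subset.∈ fromList xs
  ∈-fromList⁺ {x = x} (here refl) = x∈p∪q⁺ (inj₁ (x∈⁅x⁆ x))
  ∈-fromList⁺ (there x∈)          = x∈p∪q⁺ (inj₂ (∈-fromList⁺ x∈))

  ∈-fromList⁻ : ∀ {n} {x : Fin n} xs → x Subset.∈ fromList xs → x ∈ xs
  ∈-fromList⁻ []       x∈ = contradiction x∈ ∉⊥
  ∈-fromList⁻ (y ∷ xs) x∈ with x∈p∪q⁻ ⁅ y ⁆ (fromList xs) x∈
  ... | inj₁ x∈y  = here (x∈⁅y⁆⇒x≡y y x∈y)
  ... | inj₂ x∈xs = there (∈-fromList⁻ xs x∈xs)

  2≤∣p∣ : ∀ {n} {x y : Fin n} {p} → x Subset.∈ p → y Subset.∈ p → x ≢ y → 2 ≤ ∣ p ∣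
  2≤∣p∣ {x = x} {y} {p} x∈p y∈p x≢y = ≤-trans (s≤s (≤-trans (≤-reflexive (sym (∣⁅x⁆∣≡1 x)))
    (p⊆q⇒∣p∣≤∣q∣ λ z∈ → subst (Subset._∈ (p Subset.- y)) (sym (x∈⁅y⁆⇒x≡y x z∈)) (x∈p∧x≢y⇒x∈p-y x∈p x≢y))))
    (x∈p⇒∣p-x∣<∣p∣ y∈p)

  module _ (p : Prime≥3) where

    open AbelianGroup (ℤ/p p) using (_∙_; ε; comm; _⁻¹)

    private
      q : ℕ
      q = value p

      instance
        q≢0 : NonZero q
        q≢0 = value-nonZero p

    -- Each unordered pair is listed once. This saves the factor 2 on which the constant 1/2 of the
    -- main term depends.
    pairSums : List (Fin q) → List (Fin q)
    pairSums []       = []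
    pairSums (x ∷ xs) = map (x ∙_) (x ∷ xs) ++ pairSums xs

    length-pairSums : ∀ xs → 2 * length (pairSums xs) ≡ length xs * suc (length xs)
    length-pairSums []       = refl
    length-pairSums (x ∷ xs) = begin
      2 * length (map (x ∙_) (x ∷ xs) ++ pairSums xs)
        ≡⟨ cong (2 *_) (trans (length-++ (map (x ∙_) (x ∷ xs))) (cong (_+ length (pairSums xs)) (length-map (x ∙_) (x ∷ xs)))) ⟩
      2 * (suc l + length (pairSums xs))
        ≡⟨ *-distribˡ-+ 2 (suc l) (length (pairSums xs)) ⟩
      2 * suc l + 2 * length (pairSums xs)
        ≡⟨ cong (2 * suc l +_) (length-pairSums xs) ⟩
      2 * suc l + l * suc l
        ≡⟨ regroup l ⟩
      suc l * suc (suc l) ∎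
      where
      open ≡-Reasoning
      l = length xs
      regroup : ∀ l → 2 * (1 + l) + l * (1 + l) ≡ (1 + l) * (1 + (1 + l))
      regroup = solve-∀

    ∈-pairSums⁺ : ∀ {y z xs} → y ∈ xs → z ∈ xs → y ∙ z ∈ pairSums xs
    ∈-pairSums⁺ {xs = x ∷ xs} (here refl) z∈ = ∈-++⁺ˡ (∈-map⁺ (x ∙_) z∈)
    ∈-pairSums⁺ {y} {xs = x ∷ xs} (there y∈) (here refl) =
      subst (_∈ pairSums (x ∷ xs)) (comm x y) (∈-++⁺ˡ (∈-map⁺ (x ∙_) (there y∈)))
    ∈-pairSums⁺ {xs = x ∷ xs} (there y∈) (there z∈) = ∈-++⁺ʳ (map (x ∙_) (x ∷ xs)) (∈-pairSums⁺ y∈ z∈)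

    ∈-pairSums⁻ : ∀ {v} xs → v ∈ pairSums xs → v ∈ₚ sumset (ℤ/p p) (_∈ xs)
    ∈-pairSums⁻ (x ∷ xs) v∈ with ∈-++⁻ (map (x ∙_) (x ∷ xs)) v∈
    ... | inj₁ v∈₁ with ∈-map⁻ (x ∙_) v∈₁
    ...   | z , z∈ , v≡ = x , z , here refl , z∈ , v≡
    ∈-pairSums⁻ (x ∷ xs) v∈ | inj₂ v∈₂ with ∈-pairSums⁻ xs v∈₂
    ...   | y , z , y∈ , z∈ , v≡ = y , z , there y∈ , there z∈ , v≡

    toℕ-mod : ∀ a → toℕ (a mod q) ≡ a % q
    toℕ-mod a = Fin.toℕ-fromℕ< (m%n<n a q)

    mod-cong : ∀ {a b} → a % q ≡ b % q → a mod q ≡ b mod q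
    mod-cong {a} {b} e = Fin.toℕ-injective (trans (toℕ-mod a) (trans e (sym (toℕ-mod b))))

    mod-toℕ : ∀ x → toℕ x mod q ≡ x
    mod-toℕ x = Fin.toℕ-injective (trans (toℕ-mod (toℕ x)) (m<n⇒m%n≡m (Fin.toℕ<n x)))

    mod-+ : ∀ a b → (a mod q) ∙ (b mod q) ≡ (a + b) mod q
    mod-+ a b = mod-cong (trans (cong₂ (λ s t → (s + t) % q) (toℕ-mod a) (toℕ-mod b)) (sym (%-distribˡ-+ a b q)))

    private
      0%q≡0 : 0 % q ≡ 0
      0%q≡0 = m<n⇒m%n≡m (>-nonZero⁻¹ q)

    -- The prime q divides c x, hence c or x, and it is too large for c. The cases c = 2 and c = 3
    -- are covered by 5 ≤ q.
    torsion-free : ∀ c .{{_ : NonZero c}} → c < q → ∀ x → (c * toℕ x) mod q ≡ ε → x ≡ ε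
    torsion-free c c<q x cx≡0
      with euclidsLemma c (toℕ x) (isPrime p) (m%n≡0⇒n∣m (c * toℕ x) q
        (trans (sym (toℕ-mod (c * toℕ x))) (trans (cong toℕ cx≡0) (trans (toℕ-mod 0) 0%q≡0))))
    ... | inj₁ q∣c = contradiction (∣⇒≤ q∣c) (<⇒≱ c<q)
    ... | inj₂ q∣x = trans (sym (mod-toℕ x)) (cong (_mod q) x≡0)
      where
      multiple<⇒0 : ∀ t → q ∣ t → t < q → t ≡ 0
      multiple<⇒0 zero    _   _   = refl
      multiple<⇒0 (suc t) q∣t t<q = contradiction (∣⇒≤ q∣t) (<⇒≱ t<q)
      x≡0 : toℕ x ≡ 0
      x≡0 = multiple<⇒0 (toℕ x) q∣x (Fin.toℕ<n x)

    module _ (5≤q : 5 ≤ q) (k : ℕ) .{{_ : NonZero k}} (m : ℕ) (q≤ : q ≤ 3 ^ (k * m)) where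

      private
        n : ℕ
        n = 3 ^ k + k * m

        L : List ℕ
        L = powers n ++ yao k m (q ∸ 1) ++ yao k m (3 ^ suc n % q)

      -- 2 + n for the powers, with n = 3ᵏ + k m, and 2 · 3ᵏ + m for each of the two chains.
      size : ℕ
      size = k * m + 2 * m + 5 * 3 ^ k + 2

      length-L : length L ≤ size
      length-L = begin
        length L
          ≡⟨ trans (length-++ (powers n)) (cong₂ _+_ (length-powers n) (length-++ (yao k m (q ∸ 1)))) ⟩
        2 + n + (length (yao k m (q ∸ 1)) + length (yao k m (3 ^ suc n % q)))
          ≤⟨ +-monoʳ-≤ (2 + n) (+-mono-≤ (length-yao k m (q ∸ 1)) (length-yao k m (3 ^ suc n % q))) ⟩
        2 + (3 ^ k + k * m) + (2 * 3 ^ k + m + (2 * 3 ^ k + m))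
          ≡⟨ regroup (3 ^ k) (k * m) m ⟩
        size ∎
        where
        open ≤-Reasoning
        regroup : ∀ b c m → 2 + (b + c) + (2 * b + m + (2 * b + m)) ≡ c + 2 * m + 5 * b + 2
        regroup = solve-∀

      private
        E : List (Fin q)
        E = map (_mod q) L

        powers⊆ : ∀ {x} → x ∈ powers n → x ∈ L
        powers⊆ = ∈-++⁺ˡ
        yao₁⊆ : ∀ {x} → x ∈ yao k m (q ∸ 1) → x ∈ L
        yao₁⊆ x∈ = ∈-++⁺ʳ (powers n) (∈-++⁺ˡ x∈)
        yao₂⊆ : ∀ {x} → x ∈ yao k m (3 ^ suc n % q) → x ∈ L
        yao₂⊆ x∈ = ∈-++⁺ʳ (powers n) (∈-++⁺ʳ (yao k m (q ∸ 1)) x∈)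

        mod∈E : ∀ {x} → x ∈ L → x mod q ∈ E
        mod∈E = ∈-map⁺ (_mod q)

        -- The missing power is adjoined as a natural number, so that all relations can be proved in
        -- ℕ. Modulo q it is already present as its residue, which is the target of the second
        -- chain; see `mod∈E′`.
        supported : Supported (3 ^ suc n ∷ L) L
        supported = supported-++ (powers n) (supported-powers n (here refl) (λ x∈ → there (powers⊆ x∈)))
          (supported-++ (yao k m (q ∸ 1))
            (supported-yao k (λ x∈ → there (powers⊆ x∈)) (λ x∈ → there (yao₁⊆ x∈)))
            (supported-yao k (λ x∈ → there (powers⊆ x∈)) (λ x∈ → there (yao₂⊆ x∈))))

        mod∈E′ : ∀ {x} → x ∈ 3 ^ suc n ∷ L → x mod q ∈ E
        mod∈E′ (there x∈)  = mod∈E x∈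
        mod∈E′ (here refl) = subst (_∈ E) (mod-cong (m%n%n≡m%n (3 ^ suc n) q))
          (mod∈E (Y∈yao k powers⊆ yao₂⊆ (<-≤-trans (m%n<n (3 ^ suc n) q) q≤)))

        thirds : ∀ {e} → e ∈ E → ∃₂ λ g h → g ∈ E × h ∈ E × e ∙ (e ∙ e) ≡ g ∙ h
        thirds e∈ with ∈-map⁻ (_mod q) e∈
        ... | x , x∈ , refl with supported x∈
        ...   | g , h , g∈ , h∈ , 3x≡g+h = g mod q , h mod q , mod∈E′ g∈ , mod∈E′ h∈ , (begin
          (x mod q) ∙ ((x mod q) ∙ (x mod q))  ≡⟨ cong ((x mod q) ∙_) (mod-+ x x) ⟩
          (x mod q) ∙ ((x + x) mod q)          ≡⟨ mod-+ x (x + x) ⟩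
          (x + (x + x)) mod q                  ≡⟨ cong (λ t → (x + (x + t)) mod q) (+-identityʳ x) ⟨
          (3 * x) mod q                        ≡⟨ cong (_mod q) 3x≡g+h ⟩
          (g + h) mod q                        ≡⟨ mod-+ g h ⟨
          (g mod q) ∙ (h mod q)                ∎)
          where open ≡-Reasoning

        0∈E : ε ∈ E
        0∈E = mod∈E (powers⊆ (0∈powers n))
        1∈E : 1 mod q ∈ E
        1∈E = mod∈E (powers⊆ (3^∈powers {0} z≤n))

        1%q≡1 : 1 % q ≡ 1
        1%q≡1 = m<n⇒m%n≡m (≤-trans (s≤s (s≤s z≤n)) 5≤q)

        -1∈E : (1 mod q) ⁻¹ ∈ E
        -1∈E = subst (λ t → (q ∸ t) mod q ∈ E) (sym (trans (toℕ-mod 1) 1%q≡1))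
          (mod∈E (Y∈yao k powers⊆ yao₁⊆ (<-≤-trans (∸-monoʳ-< (s≤s z≤n) (≤-trans (s≤s z≤n) 5≤q)) q≤)))

        1≢0 : 1 mod q ≢ ε
        1≢0 e = contradiction (trans (sym 1%q≡1) (trans (sym (toℕ-mod 1)) (trans (cong toℕ e) (trans (toℕ-mod 0) 0%q≡0)))) λ ()

        double : ∀ x → x ∙ x ≡ (2 * toℕ x) mod q
        double x = cong (λ t → (toℕ x + t) mod q) (sym (+-identityʳ (toℕ x)))

        treble : ∀ x → x ∙ (x ∙ x) ≡ (3 * toℕ x) mod q
        treble x = trans (cong₂ _∙_ (sym (mod-toℕ x)) (double x)) (mod-+ (toℕ x) (2 * toℕ x))

        A : Subset q
        A = fromList (pairSums E)

        sumset⊆A : ∀ {x} → x ∈ₚ sumset (ℤ/p p) (_∈ E) → x Subset.∈ A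
        sumset⊆A (y , z , y∈ , z∈ , refl) = ∈-fromList⁺ (∈-pairSums⁺ y∈ z∈)

        A⊆sumset : ∀ {x} → x Subset.∈ A → x ∈ₚ sumset (ℤ/p p) (_∈ E)
        A⊆sumset x∈ = ∈-pairSums⁻ E (∈-fromList⁻ (pairSums E) x∈)

      A-noUniqueSum : HasNoUniqueSum p A
      A-noUniqueSum a b a∈ b∈
        with sumset-noUniqueSum (ℤ/p p) Fin._≟_
          (λ x e → torsion-free 2 (≤-trans (s≤s (s≤s (s≤s z≤n))) 5≤q) x (trans (sym (double x)) e))
          (λ x e → torsion-free 3 (≤-trans (s≤s (s≤s (s≤s (s≤s z≤n)))) 5≤q) x (trans (sym (treble x)) e))
          1≢0 0∈E 1∈E -1∈E thirds a b (A⊆sumset a∈) (A⊆sumset b∈)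
      ... | c , d , c∈ , d∈ , rest = c , d , sumset⊆A c∈ , sumset⊆A d∈ , rest

      small-set : ∃ λ (A : Subset q) → 2 ≤ ∣ A ∣ × HasNoUniqueSum p A × 2 * ∣ A ∣ ≤ size * suc size
      small-set = A ,
        2≤∣p∣ (sumset⊆A (ε , ε , 0∈E , 0∈E , sym (AbelianGroup.identityˡ (ℤ/p p) ε)))
              (sumset⊆A (ε , 1 mod q , 0∈E , 1∈E , sym (AbelianGroup.identityˡ (ℤ/p p) (1 mod q))))
              (λ e → 1≢0 (sym e)) ,
        A-noUniqueSum , (begin
        2 * ∣ A ∣                      ≤⟨ *-monoʳ-≤ 2 (∣fromList∣≤length (pairSums E)) ⟩
        2 * length (pairSums E)        ≡⟨ length-pairSums E ⟩
        length E * suc (length E)      ≤⟨ *-mono-≤ length-E (s≤s length-E) ⟩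
        size * suc size                ∎)
        where
        open ≤-Reasoning
        length-E : length E ≤ size
        length-E = ≤-trans (≤-reflexive (length-map (_mod q) L)) length-L

-- Choice of the window length and the cardinality bound in natural numbers.

module Asymptotics where

  open import Data.Fin.Subset using (Subset; ∣_∣)
  open import Data.Nat
  open import Data.Nat.DivMod
  open import Data.Nat.Properties
  open import Data.Nat.Tactic.RingSolver using (solve-∀)
  open import Data.Product using (∃; ∃₂; _×_; _,_; proj₁; proj₂)
  open import Defs using (Prime≥3; value; ≥3; HasNoUniqueSum)
  open import Relation.Binary.PropositionalEquality
  open import Relation.Nullary using (yes; no; contradiction)
  open Construction

  floor-log₃ : ∀ n → 1 ≤ n → ∃ λ l → 3 ^ l ≤ n × n < 3 ^ suc l
  floor-log₃ (suc zero)    _ = 0 , ≤-refl , s≤s (s≤s z≤n)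
  floor-log₃ (suc (suc n)) _ with floor-log₃ (suc n) (s≤s z≤n)
  ... | l , lo , hi with suc (suc n) <? 3 ^ suc l
  ...   | yes < = l , m≤n⇒m≤1+n lo , <
  ...   | no ≮  = suc l , ≮⇒≥ ≮ ,
    <-≤-trans (s≤s hi) (≤-trans (m<m*n (3 ^ suc l) 3 {{m^n≢0 3 (suc l)}} (s≤s (s≤s z≤n))) (≤-reflexive (*-comm (3 ^ suc l) 3)))

  3^≤⇒≤ : ∀ {a l n} → 3 ^ a ≤ n → n < 3 ^ suc l → a ≤ l
  3^≤⇒≤ {a} {l} 3^a≤n n< = ≮⇒≥ λ l<a → <⇒≱ n< (≤-trans (^-monoʳ-≤ 3 l<a) 3^a≤n)

  m<[1+m/n]*n : ∀ m n .{{_ : NonZero n}} → m < suc (m / n) * n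
  m<[1+m/n]*n m n = ≤-trans (≤-reflexive (cong suc (m≡m%n+[m/n]*n m n))) (+-monoˡ-≤ (m / n * n) (m%n<n m n))

  -- Bernoulli's inequality for (1 + 2)ⁿ.
  1+2n≤3^n : ∀ n → 1 + 2 * n ≤ 3 ^ n
  1+2n≤3^n zero    = ≤-refl
  1+2n≤3^n (suc n) = begin
    1 + 2 * suc n              ≤⟨ m≤m+n _ (4 * n) ⟩
    1 + 2 * suc n + 4 * n      ≡⟨ regroup n ⟩
    3 * (1 + 2 * n)            ≤⟨ *-monoʳ-≤ 3 (1+2n≤3^n n) ⟩
    3 ^ suc n                  ∎
    where
    open ≤-Reasoning
    regroup : ∀ n → 1 + 2 * (1 + n) + 4 * n ≡ 3 * (1 + 2 * n)
    regroup = solve-∀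

  n≤3^n : ∀ n → n ≤ 3 ^ n
  n≤3^n n = ≤-trans (≤-trans (m≤n*m n 2) (n≤1+n (2 * n))) (1+2n≤3^n n)

  -- Any window length k = K - u with u = o(K) and 3ᵘ / K unbounded would do.
  module _ (q : ℕ) .{{_ : NonZero q}} where

    private
      D C : ℕ
      D = 4 * q + 1
      C = 22 * q * (4 * D + 1)

    -- The first summand ensures v = ⌊K / (4 D)⌋ ≥ C, the second 8 q ≤ K / 2.
    windowThreshold : ℕ
    windowThreshold = 4 * D * C + 16 * q

    -- The first inequality makes 3ᵏ = 3ᴷ / 3ᵘ negligible against 3ᴷ / K. The second says 1 / k ≤ (1
    -- + 1 / (4 q)) / (K + 2), so shortening the window from K to k hardly increases the number of
    -- digits.
    window : ∀ K → windowThreshold ≤ K → ∃₂ λ k u → k + u ≡ K ×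
             22 * q * (K + 2) ≤ 3 ^ u × 4 * q * (K + 2) ≤ (4 * q + 1) * k
    window K K≥ = K ∸ u , u , m∸n+n≡m u≤K , exponential , linear
      where
      open ≤-Reasoning
      instance
        4D≢0 : NonZero (4 * D)
        4D≢0 = >-nonZero (≤-trans (s≤s z≤n) (≤-trans (m≤n+m 4 (4 * (4 * q))) (≤-reflexive (sym (*-distribˡ-+ 4 (4 * q) 1)))))
      v u : ℕ
      v = K / (4 * D)
      -- As u is even, 3ᵘ = 3ᵛ 3ᵛ ≥ (1 + 2 v)², which is quadratic in K and outgrows 22 q (K + 2).
      -- On the other hand D u is at most K / 2.
      u = 2 * v
      C≤v : C ≤ v
      C≤v = begin
        C                     ≡⟨ m*n/n≡m C (4 * D) ⟨
        C * (4 * D) / (4 * D) ≤⟨ /-monoˡ-≤ (4 * D) (≤-trans (≤-reflexive (*-comm C (4 * D))) (≤-trans (m≤m+n (4 * D * C) (16 * q)) K≥)) ⟩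
        v                     ∎
      slack : D * u + 8 * q ≤ K
      slack = *-cancelˡ-≤ 2 (begin
        2 * (D * (2 * v) + 8 * q)  ≡⟨ regroup D v q ⟩
        v * (4 * D) + 16 * q       ≤⟨ +-mono-≤ (m/n*n≤m K (4 * D)) (≤-trans (m≤n+m (16 * q) (4 * D * C)) K≥) ⟩
        K + K                      ≡⟨ cong (K +_) (+-identityʳ K) ⟨
        2 * K                      ∎)
        where
        regroup : ∀ D v q → 2 * (D * (2 * v) + 8 * q) ≡ v * (4 * D) + 16 * q
        regroup = solve-∀
      u≤K : u ≤ K
      u≤K = ≤-trans (m≤n*m u D {{>-nonZero (m≤n+m 1 (4 * q))}}) (≤-trans (m≤m+n (D * u) (8 * q)) slack)
      exponential : 22 * q * (K + 2) ≤ 3 ^ u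
      exponential = begin
        22 * q * (K + 2)                         ≤⟨ *-monoʳ-≤ (22 * q) K+2≤ ⟩
        22 * q * ((4 * D + 1) * (1 + 2 * v))     ≡⟨ *-assoc (22 * q) (4 * D + 1) (1 + 2 * v) ⟨
        C * (1 + 2 * v)                          ≤⟨ *-monoˡ-≤ (1 + 2 * v) (≤-trans C≤v (≤-trans (m≤n*m v 2) (n≤1+n (2 * v)))) ⟩
        (1 + 2 * v) * (1 + 2 * v)                ≤⟨ *-mono-≤ (1+2n≤3^n v) (1+2n≤3^n v) ⟩
        3 ^ v * 3 ^ v                            ≡⟨ ^-distribˡ-+-* 3 v v ⟨
        3 ^ (v + v)                              ≡⟨ cong (λ t → 3 ^ (v + t)) (+-identityʳ v) ⟨
        3 ^ u                                    ∎
        where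
        regroup : ∀ D v → (4 * D + 1) * (1 + 2 * v) ≡ (1 + v) * (4 * D) + 1 + (4 * D * v + 2 * v)
        regroup = solve-∀
        K+2≤ : K + 2 ≤ (4 * D + 1) * (1 + 2 * v)
        K+2≤ = begin
          K + 2                                              ≡⟨ +-suc K 1 ⟩
          suc K + 1                                          ≤⟨ +-monoˡ-≤ 1 (m<[1+m/n]*n K (4 * D)) ⟩
          suc v * (4 * D) + 1                                ≤⟨ m≤m+n _ (4 * D * v + 2 * v) ⟩
          (1 + v) * (4 * D) + 1 + (4 * D * v + 2 * v)        ≡⟨ regroup D v ⟨
          (4 * D + 1) * (1 + 2 * v)                          ∎
      linear : 4 * q * (K + 2) ≤ (4 * q + 1) * (K ∸ u)
      linear = +-cancelʳ-≤ (D * u) (4 * q * (K + 2)) (D * (K ∸ u)) (begin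
        4 * q * (K + 2) + D * u        ≡⟨ regroup q K (D * u) ⟩
        4 * q * K + (D * u + 8 * q)    ≤⟨ +-monoʳ-≤ (4 * q * K) slack ⟩
        4 * q * K + K                  ≡⟨ regroup′ q K ⟩
        D * K                          ≡⟨ cong (D *_) (m∸n+n≡m u≤K) ⟨
        D * (K ∸ u + u)                ≡⟨ *-distribˡ-+ D (K ∸ u) u ⟩
        D * (K ∸ u) + D * u            ∎)
        where
        regroup : ∀ q K x → 4 * q * (K + 2) + x ≡ 4 * q * K + (x + 8 * q)
        regroup = solve-∀
        regroup′ : ∀ q K → 4 * q * K + K ≡ (4 * q + 1) * K
        regroup′ = solve-∀

  -- After division: M / l ≤ 1 + (2 + 1 / (2 s)) / K′ is squared and halved, giving a / l² ≤ 1/2 +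
  -- (2 + 1 / s) / K′. The quadratic term is absorbed by the remaining 1 / (2 s K′), because K′ ≥ 4
  -- s + 3 exceeds s (2 + 1 / (2 s))².
  square-bound : ∀ s M K′ l a → 4 * s + 3 ≤ K′ → .{{_ : NonZero s}} →
                 M * (4 * s * K′) ≤ l * (4 * s * K′ + (8 * s + 2)) → 2 * a ≤ M * M →
                 2 * s * K′ * a ≤ l * l * (s * K′ + 4 * s + 2)
  square-bound s M K′ l a K′≥ {{s≢0}} M≤ a≤ = *-cancelʳ-≤ (2 * s * K′ * a) (l * l * (X + 4 * s + 2)) (16 * X) (begin
    2 * s * K′ * a * (16 * X)            ≡⟨ regroup₁ s K′ a ⟩
    2 * a * (F * F)                      ≤⟨ *-monoˡ-≤ (F * F) a≤ ⟩
    M * M * (F * F)                      ≡⟨ regroup₂ M F ⟩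
    M * F * (M * F)                      ≤⟨ *-mono-≤ M≤ M≤ ⟩
    l * (F + e) * (l * (F + e))          ≡⟨ regroup₂ l (F + e) ⟨
    l * l * ((F + e) * (F + e))          ≤⟨ *-monoʳ-≤ (l * l) quadratic ⟩
    l * l * ((X + 4 * s + 2) * (16 * X)) ≡⟨ *-assoc (l * l) (X + 4 * s + 2) (16 * X) ⟨
    l * l * (X + 4 * s + 2) * (16 * X)   ∎)
    where
    open ≤-Reasoning
    X F e : ℕ
    X = s * K′
    F = 4 * s * K′
    e = 8 * s + 2
    instance
      X≢0 : NonZero (16 * X)
      X≢0 = m*n≢0 16 X {{_}} {{m*n≢0 s K′ {{s≢0}} {{>-nonZero (≤-trans (s≤s z≤n) (≤-trans (m≤n+m 3 (4 * s)) K′≥))}}}}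
    regroup₁ : ∀ s K a → 2 * s * K * a * (16 * (s * K)) ≡ 2 * a * (4 * s * K * (4 * s * K))
    regroup₁ = solve-∀
    regroup₂ : ∀ a b → a * a * (b * b) ≡ a * b * (a * b)
    regroup₂ = solve-∀
    quadratic : (F + e) * (F + e) ≤ (X + 4 * s + 2) * (16 * X)
    quadratic = begin
      (F + e) * (F + e)
        ≡⟨ regroup₃ s K′ ⟩
      16 * (X * X) + 64 * (s * X) + 16 * X + 4 * (16 * (s * s) + 8 * s + 1)
        ≤⟨ +-monoʳ-≤ (16 * (X * X) + 64 * (s * X) + 16 * X) (*-monoʳ-≤ 4 small) ⟩
      16 * (X * X) + 64 * (s * X) + 16 * X + 4 * (4 * s * K′)
        ≡⟨ regroup₄ s K′ ⟩
      (X + 4 * s + 2) * (16 * X) ∎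
      where
      regroup₃ : ∀ s K → (4 * s * K + (8 * s + 2)) * (4 * s * K + (8 * s + 2)) ≡
        16 * (s * K * (s * K)) + 64 * (s * (s * K)) + 16 * (s * K) + 4 * (16 * (s * s) + 8 * s + 1)
      regroup₃ = solve-∀
      regroup₄ : ∀ s K → 16 * (s * K * (s * K)) + 64 * (s * (s * K)) + 16 * (s * K) + 4 * (4 * s * K) ≡
        (s * K + 4 * s + 2) * (16 * (s * K))
      regroup₄ = solve-∀
      regroup₅ : ∀ s → 16 * (s * s) + 8 * s + 4 * s ≡ 4 * s * (4 * s + 3)
      regroup₅ = solve-∀
      small : 16 * (s * s) + 8 * s + 1 ≤ 4 * s * K′
      small = begin
        16 * (s * s) + 8 * s + 1       ≤⟨ +-monoʳ-≤ (16 * (s * s) + 8 * s) (≤-trans (>-nonZero⁻¹ s) (m≤n*m s 4)) ⟩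
        16 * (s * s) + 8 * s + 4 * s   ≡⟨ regroup₅ s ⟩
        4 * s * (4 * s + 3)            ≤⟨ *-monoʳ-≤ (4 * s) K′≥ ⟩
        4 * s * K′                     ∎

  window-nonZero : ∀ q K k .{{_ : NonZero q}} → 4 * q * (K + 2) ≤ (4 * q + 1) * k → NonZero k
  window-nonZero q K (suc k) _      = _
  window-nonZero q K zero    linear = contradiction (≤-trans linear (≤-reflexive (*-zeroʳ (4 * q + 1))))
    (<⇒≱ (>-nonZero⁻¹ (4 * q * (K + 2)) {{m*n≢0 (4 * q) (K + 2) {{m*n≢0 4 q}} {{>-nonZero (m≤n⇒m≤o+n K (s≤s z≤n))}}}}))

  -- Multiplied by 4 s (K + 2), the term 2 w costs at most (8 s + 1) l by the linear condition, and
  -- the term 11 · 3ᵏ at most 3ᵏ 3ᵘ = 3ᴷ ≤ l by the exponential one.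
  windows-bound : ∀ s K k u l .{{_ : NonZero k}} → k + u ≡ K → 3 ^ K ≤ l →
    22 * (2 * s) * (K + 2) ≤ 3 ^ u → 4 * (2 * s) * (K + 2) ≤ (4 * (2 * s) + 1) * k →
    suc (k * suc (l / k) + 2 * suc (l / k) + 5 * 3 ^ k + 2) * (4 * s * (K + 2)) ≤ l * (4 * s * (K + 2) + (8 * s + 2))
  windows-bound s K k u l k+u≡K 3^K≤l exponential linear = M≤
    where
    open ≤-Reasoning
    q w B M : ℕ
    q = 2 * s
    w = l / k
    B = 3 ^ k
    M = suc (k * suc w + 2 * suc w + 5 * B + 2)
    -- 11 = 1 + 5 + 5: k ≤ 3ᵏ, the constants add up to 5 ≤ 5 · 3ᵏ, and 5 · 3ᵏ is there already.
    crude : M ≤ l + 2 * w + 11 * B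
    crude = begin
      suc (k * suc w + 2 * suc w + 5 * B + 2)   ≡⟨ regroup k w B ⟩
      w * k + 2 * w + (k + 5 + 5 * B)           ≤⟨ +-mono-≤ (+-monoˡ-≤ (2 * w) (m/n*n≤m l k)) (+-monoˡ-≤ (5 * B)
                                                     (+-mono-≤ (n≤3^n k) (*-monoʳ-≤ 5 (m^n>0 3 k)))) ⟩
      l + 2 * w + (B + 5 * B + 5 * B)           ≡⟨ regroup′ (l + 2 * w) B ⟩
      l + 2 * w + 11 * B                        ∎
      where
      regroup : ∀ k w B → suc (k * suc w + 2 * suc w + 5 * B + 2) ≡ w * k + 2 * w + (k + 5 + 5 * B)
      regroup = solve-∀
      regroup′ : ∀ x B → x + (B + 5 * B + 5 * B) ≡ x + 11 * B
      regroup′ = solve-∀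
    windows : w * (4 * q * (K + 2)) ≤ (4 * q + 1) * l
    windows = begin
      w * (4 * q * (K + 2))      ≤⟨ *-monoʳ-≤ w linear ⟩
      w * ((4 * q + 1) * k)      ≡⟨ regroup w (4 * q + 1) k ⟩
      (4 * q + 1) * (w * k)      ≤⟨ *-monoʳ-≤ (4 * q + 1) (m/n*n≤m l k) ⟩
      (4 * q + 1) * l            ∎
      where
      regroup : ∀ w x k → w * (x * k) ≡ x * (w * k)
      regroup = solve-∀
    digits : B * (22 * q * (K + 2)) ≤ l
    digits = begin
      B * (22 * q * (K + 2))     ≤⟨ *-monoʳ-≤ B exponential ⟩
      3 ^ k * 3 ^ u              ≡⟨ ^-distribˡ-+-* 3 k u ⟨
      3 ^ (k + u)                ≡⟨ cong (3 ^_) k+u≡K ⟩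
      3 ^ K                      ≤⟨ 3^K≤l ⟩
      l                          ∎
    M≤ : M * (4 * s * (K + 2)) ≤ l * (4 * s * (K + 2) + (8 * s + 2))
    M≤ = begin
      M * (4 * s * (K + 2))
        ≤⟨ *-monoˡ-≤ (4 * s * (K + 2)) crude ⟩
      (l + 2 * w + 11 * B) * (4 * s * (K + 2))
        ≡⟨ regroup l w B s (K + 2) ⟩
      l * (4 * s * (K + 2)) + (w * (4 * (2 * s) * (K + 2)) + B * (22 * (2 * s) * (K + 2)))
        ≤⟨ +-monoʳ-≤ (l * (4 * s * (K + 2))) (+-mono-≤ windows digits) ⟩
      l * (4 * s * (K + 2)) + ((4 * (2 * s) + 1) * l + l)
        ≡⟨ regroup′ l s (K + 2) ⟩
      l * (4 * s * (K + 2) + (8 * s + 2)) ∎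
      where
      regroup : ∀ l w B s K → (l + 2 * w + 11 * B) * (4 * s * K) ≡
        l * (4 * s * K) + (w * (4 * (2 * s) * K) + B * (22 * (2 * s) * K))
      regroup = solve-∀
      regroup′ : ∀ l s K → l * (4 * s * K) + ((4 * (2 * s) + 1) * l + l) ≡ l * (4 * s * K + (8 * s + 2))
      regroup′ = solve-∀

  -- The last condition is |A| ≤ l² (1/2 + (2 + 1 / s) / (K + 2)) with denominators cleared.
  GoodSet : (p : Prime≥3) → ℕ → ℕ → ℕ → Subset (value p) → Set
  GoodSet p s l K A = 2 ≤ ∣ A ∣ × HasNoUniqueSum p A ×
    2 * s * (K + 2) * ∣ A ∣ ≤ l * l * (s * (K + 2) + 4 * s + 2)

  module _ (s : ℕ) .{{_ : NonZero s}} where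

    private instance
      2s≢0 : NonZero (2 * s)
      2s≢0 = m*n≢0 2 s

    K₀ : ℕ
    K₀ = windowThreshold (2 * s) + (4 * s + 3)

    -- p ≥ 3^(3^K₀) forces l ≥ 3^K₀ for the integer part l of log₃ p, and then K ≥ K₀ for the
    -- integer part K of log₃ l. The summand 5 gives p ≥ 5.
    threshold : ℕ
    threshold = 5 + 3 ^ (3 ^ K₀)

    windowed : ∀ p l K k u → 5 ≤ value p → 3 ^ K ≤ l → value p < 3 ^ suc l → 4 * s + 3 ≤ K + 2 → k + u ≡ K →
      22 * (2 * s) * (K + 2) ≤ 3 ^ u → 4 * (2 * s) * (K + 2) ≤ (4 * (2 * s) + 1) * k → ∃ (GoodSet p s l K)
    windowed p l K k u 5≤p 3^K≤l p<3^1+l K≥ k+u≡K exponential linear = conclude (small-set p 5≤p k m p≤3^km)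
      where
      instance
        k≢0 : NonZero k
        k≢0 = window-nonZero (2 * s) K k linear
      m N : ℕ
      -- Rounding up makes k m > l, so m digits are enough for every number below 3ˡ⁺¹, in
      -- particular for all residues modulo p.
      m = suc (l / k)
      N = k * m + 2 * m + 5 * 3 ^ k + 2
      p≤3^km : value p ≤ 3 ^ (k * m)
      p≤3^km = ≤-trans (<⇒≤ p<3^1+l) (^-monoʳ-≤ 3 (≤-trans (m<[1+m/n]*n l k) (≤-reflexive (*-comm m k))))
      conclude : (∃ λ (A : Subset (value p)) → 2 ≤ ∣ A ∣ × HasNoUniqueSum p A × 2 * ∣ A ∣ ≤ N * suc N) → ∃ (GoodSet p s l K)
      conclude (A , 2≤A , A-noUniqueSum , A≤) = A , 2≤A , A-noUniqueSum , square-bound s (suc N) (K + 2) l ∣ A ∣ K≥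
        (windows-bound s K k u l k+u≡K 3^K≤l exponential linear) (≤-trans A≤ (*-monoˡ-≤ (suc N) (n≤1+n N)))

    bounded : ∀ p l K → 5 ≤ value p → 3 ^ K ≤ l → value p < 3 ^ suc l → K₀ ≤ K → ∃ (GoodSet p s l K)
    bounded p l K 5≤p 3^K≤l p<3^1+l K₀≤K = go (window (2 * s) K (≤-trans (m≤m+n (windowThreshold (2 * s)) (4 * s + 3)) K₀≤K))
      where
      go : (∃₂ λ k u → k + u ≡ K × 22 * (2 * s) * (K + 2) ≤ 3 ^ u × 4 * (2 * s) * (K + 2) ≤ (4 * (2 * s) + 1) * k) → ∃ (GoodSet p s l K)
      go (k , u , k+u≡K , exponential , linear) = windowed p l K k u 5≤p 3^K≤l p<3^1+l
        (≤-trans (≤-trans (m≤n+m (4 * s + 3) (windowThreshold (2 * s))) K₀≤K) (m≤m+n K 2)) k+u≡K exponential linear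

    good-set : ∀ p → threshold ≤ value p → ∃₂ λ l K → ∃ λ A → GoodSet p s l K A ×
      4 * s + 3 ≤ K × 1 ≤ l × 3 ^ l ≤ value p × value p ≤ 3 ^ suc l × suc l ≤ 3 ^ suc K
    good-set p p≥ = outer (floor-log₃ (value p) (≤-trans (s≤s z≤n) (≥3 p)))
      where
      outer : (∃ λ l → 3 ^ l ≤ value p × value p < 3 ^ suc l) → _
      outer (l , 3^l≤p , p<3^1+l) = inner (floor-log₃ l 1≤l)
        where
        3^K₀≤l : 3 ^ K₀ ≤ l
        3^K₀≤l = 3^≤⇒≤ (≤-trans (m≤n+m (3 ^ (3 ^ K₀)) 5) p≥) p<3^1+l
        1≤l : 1 ≤ l
        1≤l = ≤-trans (m^n>0 3 K₀) 3^K₀≤l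
        inner : (∃ λ K → 3 ^ K ≤ l × l < 3 ^ suc K) → _
        inner (K , 3^K≤l , l<3^1+K) = l , K ,
          proj₁ good , proj₂ good , ≤-trans (m≤n+m (4 * s + 3) (windowThreshold (2 * s))) K₀≤K ,
          1≤l , 3^l≤p , <⇒≤ p<3^1+l , l<3^1+K
          where
          K₀≤K : K₀ ≤ K
          K₀≤K = 3^≤⇒≤ 3^K₀≤l l<3^1+K
          good : ∃ (GoodSet p s l K)
          good = bounded p l K (≤-trans (m≤m+n 5 _) p≥) 3^K≤l p<3^1+l K₀≤K

-- Difference quotients of the partial sums of the logarithm.

module LogEstimates where

  open import Algebra.Bundles using (CommutativeRing)
  import Data.Integer as ℤ
  open import Data.Nat as ℕ using (ℕ; zero; suc; z≤n; s≤s)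
  import Data.Nat.Properties as ℕ
  open import Data.Product using (∃; _×_; _,_; proj₁; proj₂)
  open import Data.Rational using (ℚ; 0ℚ; 1ℚ; ½; _+_; _*_; _-_; -_; ∣_∣; _≤_; _<_; _/_)
  import Data.Rational.Properties as ℚ
  open import Data.Rational.Solver using (module +-*-Solver)
  open import Algebra.Properties.Semiring.Exp (CommutativeRing.semiring ℚ.+-*-commutativeRing) using (_^_)
  open import Relation.Binary.PropositionalEquality using (_≡_; refl; sym; trans; cong; cong₂; subst; subst₂; module ≡-Reasoning)
  open import Defs using (module Estimates)
  open Estimates
  open +-*-Solver using (solve; _:=_; _:+_; _:*_; _:-_; :-_; con)

  0≤ι : ∀ n → 0ℚ ≤ ι n
  0≤ι n = ι-mono {0} {n} z≤n

  0≤1 : 0ℚ ≤ 1ℚ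
  0≤1 = ℚ.<⇒≤ Estimates.0<1

  ι-+ : ∀ m n → ι (m ℕ.+ n) ≡ ι m + ι n
  ι-+ zero    n = sym (ℚ.+-identityˡ (ι n))
  ι-+ (suc m) n = trans (ι-suc (m ℕ.+ n)) (trans (cong (λ t → 1ℚ + t) (ι-+ m n))
    (trans (sym (ℚ.+-assoc 1ℚ (ι m) (ι n))) (cong (_+ ι n) (sym (ι-suc m)))))

  ι-* : ∀ m n → ι (m ℕ.* n) ≡ ι m * ι n
  ι-* zero    n = sym (ℚ.*-zeroˡ (ι n))
  ι-* (suc m) n = trans (ι-+ n (m ℕ.* n)) (trans (cong (ι n +_) (ι-* m n))
    (trans (solve 2 (λ m n → n :+ m :* n := (con 1ℚ :+ m) :* n) refl (ι m) (ι n)) (cong (_* ι n) (sym (ι-suc m)))))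

  small-unitFrac : ∀ {ε} → 0ℚ < ε → ∃ λ N → ℤ.+ 1 / suc N ≤ ε
  small-unitFrac {ε} 0<ε =
    let 0<r , εr≡1 = recip-pos 0<ε
        N , r≤N    = archimedean (recip ε)
    in N , cancel 0<r (begin
      recip ε * (ℤ.+ 1 / suc N)       ≤⟨ *-monoʳ (ℚ.<⇒≤ (unitFrac-pos N)) (ℚ.≤-trans r≤N (ι-mono (ℕ.n≤1+n N))) ⟩
      ι (suc N) * (ℤ.+ 1 / suc N)     ≡⟨ trans (ℚ.*-comm (ι (suc N)) (ℤ.+ 1 / suc N)) (unitFrac N) ⟩
      1ℚ                            ≡⟨ trans (sym εr≡1) (ℚ.*-comm ε (recip ε)) ⟩
      recip ε * ε                   ∎)
    where open ℚ.≤-Reasoning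

  module _ {w z : ℚ} (0≤w : 0ℚ ≤ w) (w≤z : w ≤ z) where

    private
      d : ℚ
      d = z - w

      0≤z : 0ℚ ≤ z
      0≤z = ℚ.≤-trans 0≤w w≤z

      0≤d : 0ℚ ≤ d
      0≤d = diff-nonNeg w≤z

      0≤pow : ∀ {q} → 0ℚ ≤ q → ∀ j → 0ℚ ≤ q ^ j
      0≤pow 0≤q j = proj₁ (Estimates.^-mono 0≤q ℚ.≤-refl j)

      expand : ∀ j → z ^ suc (suc j) - w ^ suc (suc j) ≡ z * (z ^ suc j - w ^ suc j) + w ^ suc j * d
      expand j = solve 4 (λ z p w q → z :* p :- w :* q := z :* (p :- q) :+ q :* (z :- w)) refl
        z (z ^ suc j) w (w ^ suc j)

      collect : ∀ i q j → q * (i * (q ^ j * d)) + q ^ suc j * d ≡ (1ℚ + i) * (q ^ suc j * d)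
      collect i q j = solve 4 (λ q i p d → q :* (i :* (p :* d)) :+ (q :* p) :* d := (con 1ℚ :+ i) :* ((q :* p) :* d))
        refl q i (q ^ j) d

      first : ∀ q → z ^ 1 - w ^ 1 ≡ ι 1 * (q ^ 0 * d)
      first q = solve 2 (λ z w → z :* con 1ℚ :- w :* con 1ℚ := con 1ℚ :* (con 1ℚ :* (z :- w))) refl z w

    -- Mean value estimate: on [w, z] the derivative (j + 1) tʲ is largest at z. In `^-diff-≥` it is
    -- smallest at w.
    ^-diff-≤ : ∀ j → z ^ suc j - w ^ suc j ≤ ι (suc j) * (z ^ j * d)
    ^-diff-≤ zero    = ℚ.≤-reflexive (first z)
    ^-diff-≤ (suc j) = begin
      z ^ suc (suc j) - w ^ suc (suc j)                      ≡⟨ expand j ⟩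
      z * (z ^ suc j - w ^ suc j) + w ^ suc j * d            ≤⟨ ℚ.+-mono-≤ (*-monoˡ 0≤z (^-diff-≤ j))
                                                                  (*-monoʳ 0≤d (proj₂ (^-mono 0≤w w≤z (suc j)))) ⟩
      z * (ι (suc j) * (z ^ j * d)) + z ^ suc j * d          ≡⟨ collect (ι (suc j)) z j ⟩
      (1ℚ + ι (suc j)) * (z ^ suc j * d)                     ≡⟨ cong (_* (z ^ suc j * d)) (ι-suc (suc j)) ⟨
      ι (suc (suc j)) * (z ^ suc j * d)                      ∎
      where open ℚ.≤-Reasoning

    ^-diff-≥ : ∀ j → ι (suc j) * (w ^ j * d) ≤ z ^ suc j - w ^ suc j
    ^-diff-≥ zero    = ℚ.≤-reflexive (sym (first w))
    ^-diff-≥ (suc j) = begin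
      ι (suc (suc j)) * (w ^ suc j * d)                      ≡⟨ cong (_* (w ^ suc j * d)) (ι-suc (suc j)) ⟩
      (1ℚ + ι (suc j)) * (w ^ suc j * d)                     ≡⟨ collect (ι (suc j)) w j ⟨
      w * (ι (suc j) * (w ^ j * d)) + w ^ suc j * d          ≤⟨ ℚ.+-monoˡ-≤ (w ^ suc j * d)
                                                                  (*-mono 0≤w w≤z (*-nonNeg (0≤ι (suc j)) (*-nonNeg (0≤pow 0≤w j) 0≤d)) (^-diff-≥ j)) ⟩
      z * (z ^ suc j - w ^ suc j) + w ^ suc j * d            ≡⟨ expand j ⟨
      z ^ suc (suc j) - w ^ suc (suc j)                      ∎
      where open ℚ.≤-Reasoning

    private
      factor : ∀ k → artanhTerm k z - artanhTerm k w ≡ (ℤ.+ 1 / suc (2 ℕ.* k)) * (z ^ suc (2 ℕ.* k) - w ^ suc (2 ℕ.* k))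
      factor k = solve 3 (λ c p q → c :* p :- c :* q := c :* (p :- q)) refl
        (ℤ.+ 1 / suc (2 ℕ.* k)) (z ^ suc (2 ℕ.* k)) (w ^ suc (2 ℕ.* k))

      absorb : ∀ k x → (ℤ.+ 1 / suc (2 ℕ.* k)) * (ι (suc (2 ℕ.* k)) * x) ≡ x
      absorb k x = trans (sym (ℚ.*-assoc (ℤ.+ 1 / suc (2 ℕ.* k)) (ι (suc (2 ℕ.* k))) x))
        (trans (cong (_* x) (unitFrac (2 ℕ.* k))) (ℚ.*-identityˡ x))

      0≤c : ∀ k → 0ℚ ≤ ℤ.+ 1 / suc (2 ℕ.* k)
      0≤c k = ℚ.<⇒≤ (unitFrac-pos (2 ℕ.* k))

      even-suc : ∀ q n → q * (q * q ^ (2 ℕ.* n)) ≡ q ^ (2 ℕ.* suc n)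
      even-suc q n = cong (q ^_) (sym (ℕ.*-suc 2 n))

    artanhTerm-diff-≤ : ∀ k → artanhTerm k z - artanhTerm k w ≤ z ^ (2 ℕ.* k) * d
    artanhTerm-diff-≤ k = subst₂ _≤_ (sym (factor k)) (absorb k _) (*-monoˡ (0≤c k) (^-diff-≤ (2 ℕ.* k)))

    artanhTerm-diff-≥ : ∀ k → w ^ (2 ℕ.* k) * d ≤ artanhTerm k z - artanhTerm k w
    artanhTerm-diff-≥ k = subst₂ _≤_ (absorb k _) (sym (factor k)) (*-monoˡ (0≤c k) (^-diff-≥ (2 ℕ.* k)))

    private
      split : ∀ q n → (1ℚ - q * q) * (artanhSum (suc n) z - artanhSum (suc n) w) ≡
        (1ℚ - q * q) * (artanhSum n z - artanhSum n w) + (1ℚ - q * q) * (artanhTerm n z - artanhTerm n w)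
      split q n = solve 5 (λ q a s b t → (con 1ℚ :- q :* q) :* ((a :+ s) :- (b :+ t)) :=
        (con 1ℚ :- q :* q) :* (a :- b) :+ (con 1ℚ :- q :* q) :* (s :- t)) refl
        q (artanhSum n z) (artanhTerm n z) (artanhSum n w) (artanhTerm n w)

      telescope : ∀ q n → d * (1ℚ - q ^ (2 ℕ.* n)) + (1ℚ - q * q) * (q ^ (2 ℕ.* n) * d) ≡ d * (1ℚ - q ^ (2 ℕ.* suc n))
      telescope q n = trans (solve 3 (λ d q p → d :* (con 1ℚ :- p) :+ (con 1ℚ :- q :* q) :* (p :* d) :=
        d :* (con 1ℚ :- q :* (q :* p))) refl d q (q ^ (2 ℕ.* n))) (cong (λ t → d * (1ℚ - t)) (even-suc q n))

      1-sq : ∀ {q} → 0ℚ ≤ q → q ≤ 1ℚ → 0ℚ ≤ 1ℚ - q * q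
      1-sq {q} 0≤q q≤1 = diff-nonNeg (subst (q * q ≤_) (ℚ.*-identityˡ 1ℚ) (*-mono 0≤q q≤1 0≤q q≤1))

      start : ∀ q → (1ℚ - q * q) * (0ℚ - 0ℚ) ≡ d * (1ℚ - 1ℚ)
      start q = trans (ℚ.*-zeroʳ (1ℚ - q * q)) (sym (ℚ.*-zeroʳ d))

    -- The k-th terms differ by at most z²ᵏ (z - w), and (1 - z²) times the geometric sum of the z²ᵏ
    -- is 1 - z²ⁿ. In the limit this says that the derivative of artanh is at most 1 / (1 - z²) up
    -- to z.
    artanhSum-diff-≤ : z ≤ 1ℚ → ∀ n → (1ℚ - z * z) * (artanhSum n z - artanhSum n w) ≤ d * (1ℚ - z ^ (2 ℕ.* n))
    artanhSum-diff-≤ z≤1 zero    = ℚ.≤-reflexive (start z)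
    artanhSum-diff-≤ z≤1 (suc n) = subst₂ _≤_ (sym (split z n)) (telescope z n)
      (ℚ.+-mono-≤ (artanhSum-diff-≤ z≤1 n) (*-monoˡ (1-sq 0≤z z≤1) (artanhTerm-diff-≤ n)))

    artanhSum-diff-≥ : w ≤ 1ℚ → ∀ n → d * (1ℚ - w ^ (2 ℕ.* n)) ≤ (1ℚ - w * w) * (artanhSum n z - artanhSum n w)
    artanhSum-diff-≥ w≤1 zero    = ℚ.≤-reflexive (sym (start w))
    artanhSum-diff-≥ w≤1 (suc n) = subst₂ _≤_ (telescope w n) (sym (split w n))
      (ℚ.+-mono-≤ (artanhSum-diff-≥ w≤1 n) (*-monoˡ (1-sq 0≤w w≤1) (artanhTerm-diff-≥ n)))

  -- The n-th term of the sequence that represents log q.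
  logSum : ℕ → ℚ → ℚ
  logSum n q = ι 2 * artanhSum n (mobius q)

  module _ {q : ℚ} (1≤q : 1ℚ ≤ q) where

    0<q : 0ℚ < q
    0<q = ℚ.<-≤-trans Estimates.0<1 1≤q

    private
      u : ℚ
      u = recip (q + 1ℚ)

      0<u : 0ℚ < u
      0<u = proj₁ (recip-pos (pos+1 0<q))

    0<q+1 : 0ℚ < q + 1ℚ
    0<q+1 = pos+1 0<q

    mobius-unit : (q + 1ℚ) * u ≡ 1ℚ
    mobius-unit = proj₂ (recip-pos 0<q+1)

    0≤mobius : 0ℚ ≤ mobius q
    0≤mobius = *-nonNeg (diff-nonNeg 1≤q) (ℚ.<⇒≤ 0<u)

    mobius<1 : mobius q < 1ℚ
    mobius<1 = subst₂ _<_ (ℚ.+-identityʳ (mobius q))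
      (trans (solve 2 (λ q u → (q :- con 1ℚ) :* u :+ (u :+ u) := (q :+ con 1ℚ) :* u) refl q u) mobius-unit)
      (ℚ.+-monoʳ-< (mobius q) (ℚ.+-mono-< 0<u 0<u))

    mobius-sq : (q + 1ℚ) * (q + 1ℚ) * (1ℚ - mobius q * mobius q) ≡ ι 4 * q
    mobius-sq = begin
      (q + 1ℚ) * (q + 1ℚ) * (1ℚ - (q - 1ℚ) * u * ((q - 1ℚ) * u))
        ≡⟨ solve 2 (λ q u → (q :+ con 1ℚ) :* (q :+ con 1ℚ) :* (con 1ℚ :- (q :- con 1ℚ) :* u :* ((q :- con 1ℚ) :* u)) :=
             (q :+ con 1ℚ) :* (q :+ con 1ℚ) :- (q :- con 1ℚ) :* (q :- con 1ℚ) :* (((q :+ con 1ℚ) :* u) :* ((q :+ con 1ℚ) :* u)))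
             refl q u ⟩
      (q + 1ℚ) * (q + 1ℚ) - (q - 1ℚ) * (q - 1ℚ) * (((q + 1ℚ) * u) * ((q + 1ℚ) * u))
        ≡⟨ cong (λ t → (q + 1ℚ) * (q + 1ℚ) - (q - 1ℚ) * (q - 1ℚ) * (t * t)) mobius-unit ⟩
      (q + 1ℚ) * (q + 1ℚ) - (q - 1ℚ) * (q - 1ℚ) * (1ℚ * 1ℚ)
        ≡⟨ solve 1 (λ q → (q :+ con 1ℚ) :* (q :+ con 1ℚ) :- (q :- con 1ℚ) :* (q :- con 1ℚ) :* (con 1ℚ :* con 1ℚ) := con (ι 4) :* q) refl q ⟩
      ι 4 * q ∎
      where open ≡-Reasoning

  module _ {x y : ℚ} (1≤y : 1ℚ ≤ y) (y≤x : y ≤ x) where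

    private
      1≤x : 1ℚ ≤ x
      1≤x = ℚ.≤-trans 1≤y y≤x
      u v z w : ℚ
      u = recip (x + 1ℚ)
      v = recip (y + 1ℚ)
      z = mobius x
      w = mobius y

    mobius-diff : (x + 1ℚ) * (y + 1ℚ) * (mobius x - mobius y) ≡ ι 2 * (x - y)
    mobius-diff = begin
      (x + 1ℚ) * (y + 1ℚ) * ((x - 1ℚ) * u - (y - 1ℚ) * v)
        ≡⟨ solve 4 (λ x y u v → (x :+ con 1ℚ) :* (y :+ con 1ℚ) :* ((x :- con 1ℚ) :* u :- (y :- con 1ℚ) :* v) :=
             (x :- con 1ℚ) :* (y :+ con 1ℚ) :* ((x :+ con 1ℚ) :* u) :- (y :- con 1ℚ) :* (x :+ con 1ℚ) :* ((y :+ con 1ℚ) :* v))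
             refl x y u v ⟩
      (x - 1ℚ) * (y + 1ℚ) * ((x + 1ℚ) * u) - (y - 1ℚ) * (x + 1ℚ) * ((y + 1ℚ) * v)
        ≡⟨ cong₂ (λ s t → (x - 1ℚ) * (y + 1ℚ) * s - (y - 1ℚ) * (x + 1ℚ) * t) (mobius-unit 1≤x) (mobius-unit 1≤y) ⟩
      (x - 1ℚ) * (y + 1ℚ) * 1ℚ - (y - 1ℚ) * (x + 1ℚ) * 1ℚ
        ≡⟨ solve 2 (λ x y → (x :- con 1ℚ) :* (y :+ con 1ℚ) :* con 1ℚ :- (y :- con 1ℚ) :* (x :+ con 1ℚ) :* con 1ℚ :=
             con (ι 2) :* (x :- y)) refl x y ⟩
      ι 2 * (x - y) ∎
      where open ≡-Reasoning

    mobius-mono : mobius y ≤ mobius x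
    mobius-mono = subst₂ _≤_ (ℚ.+-identityˡ w) (solve 2 (λ z w → (z :- w) :+ w := z) refl z w)
      (ℚ.+-monoˡ-≤ w (cancel (pos*pos (0<q+1 1≤x) (0<q+1 1≤y))
        (subst₂ _≤_ (sym (ℚ.*-zeroʳ ((x + 1ℚ) * (y + 1ℚ)))) (sym mobius-diff)
          (*-nonNeg (0≤ι 2) (diff-nonNeg y≤x)))))

    logSum-mono : ∀ n → logSum n y ≤ logSum n x
    logSum-mono n = *-monoˡ (0≤ι 2) (sum-mono (0≤mobius 1≤y) mobius-mono n)

    private
      F : ℕ → ℚ
      F n = logSum n x - logSum n y

      0≤F : ∀ n → 0ℚ ≤ F n
      0≤F n = diff-nonNeg (logSum-mono n)

      y[x+1]≤x[y+1] : y * (x + 1ℚ) ≤ x * (y + 1ℚ)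
      y[x+1]≤x[y+1] = subst₂ _≤_
        (solve 2 (λ x y → x :* y :+ y := y :* (x :+ con 1ℚ)) refl x y)
        (solve 2 (λ x y → x :* y :+ x := x :* (y :+ con 1ℚ)) refl x y)
        (ℚ.+-monoʳ-≤ (x * y) y≤x)

    -- Substituting 1 - z² = 4 x / (x + 1)² and z - w = 2 (x - y) / ((x + 1)(y + 1)) into
    -- `artanhSum-diff-≤` bounds x (y + 1) times the difference by (x + 1)(x - y); then y (x + 1) ≤
    -- x (y + 1).
    logSum-diff-≤ : ∀ n → y * (logSum n x - logSum n y) ≤ x - y
    logSum-diff-≤ n = cancel (0<q+1 1≤x) (begin
      (x + 1ℚ) * (y * F n)           ≡⟨ solve 3 (λ x y f → (x :+ con 1ℚ) :* (y :* f) := y :* (x :+ con 1ℚ) :* f) refl x y (F n) ⟩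
      y * (x + 1ℚ) * F n             ≤⟨ *-monoʳ (0≤F n) y[x+1]≤x[y+1] ⟩
      x * (y + 1ℚ) * F n             ≤⟨ cancel {ι 2} (ℚ.positive⁻¹ (ι 2)) doubled ⟩
      (x + 1ℚ) * (x - y)             ∎)
      where
      open ℚ.≤-Reasoning
      a = artanhSum n z
      b = artanhSum n w
      P = z ^ (2 ℕ.* n)
      doubled : ι 2 * (x * (y + 1ℚ) * F n) ≤ ι 2 * ((x + 1ℚ) * (x - y))
      doubled = begin
        ι 2 * (x * (y + 1ℚ) * (ι 2 * a - ι 2 * b))
          ≡⟨ solve 4 (λ x y a b → con (ι 2) :* (x :* (y :+ con 1ℚ) :* (con (ι 2) :* a :- con (ι 2) :* b)) :=
               (y :+ con 1ℚ) :* ((con (ι 4) :* x) :* (a :- b))) refl x y a b ⟩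
        (y + 1ℚ) * ((ι 4 * x) * (a - b))
          ≡⟨ cong (λ t → (y + 1ℚ) * (t * (a - b))) (mobius-sq 1≤x) ⟨
        (y + 1ℚ) * ((x + 1ℚ) * (x + 1ℚ) * (1ℚ - z * z) * (a - b))
          ≡⟨ solve 4 (λ x y s t → (y :+ con 1ℚ) :* ((x :+ con 1ℚ) :* (x :+ con 1ℚ) :* s :* t) :=
               (x :+ con 1ℚ) :* ((x :+ con 1ℚ) :* (y :+ con 1ℚ)) :* (s :* t)) refl x y (1ℚ - z * z) (a - b) ⟩
        (x + 1ℚ) * ((x + 1ℚ) * (y + 1ℚ)) * ((1ℚ - z * z) * (a - b))
          ≤⟨ *-monoˡ (ℚ.<⇒≤ (pos*pos (0<q+1 1≤x) (pos*pos (0<q+1 1≤x) (0<q+1 1≤y))))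
               (artanhSum-diff-≤ (0≤mobius 1≤y) mobius-mono (ℚ.<⇒≤ (mobius<1 1≤x)) n) ⟩
        (x + 1ℚ) * ((x + 1ℚ) * (y + 1ℚ)) * ((z - w) * (1ℚ - P))
          ≡⟨ solve 4 (λ s c d p → s :* c :* (d :* (con 1ℚ :- p)) := s :* ((c :* d) :* (con 1ℚ :- p))) refl
               (x + 1ℚ) ((x + 1ℚ) * (y + 1ℚ)) (z - w) P ⟩
        (x + 1ℚ) * (((x + 1ℚ) * (y + 1ℚ) * (z - w)) * (1ℚ - P))
          ≡⟨ cong (λ t → (x + 1ℚ) * (t * (1ℚ - P))) mobius-diff ⟩
        (x + 1ℚ) * (ι 2 * (x - y) * (1ℚ - P))
          ≤⟨ *-monoˡ (ℚ.<⇒≤ (0<q+1 1≤x)) (*-monoˡ (*-nonNeg (0≤ι 2) (diff-nonNeg y≤x))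
               (subst (1ℚ - P ≤_) (ℚ.+-identityʳ 1ℚ) (ℚ.+-monoʳ-≤ 1ℚ (ℚ.neg-antimono-≤
                 (proj₁ (^-mono (0≤mobius 1≤x) ℚ.≤-refl (2 ℕ.* n))))))) ⟩
        (x + 1ℚ) * (ι 2 * (x - y) * 1ℚ)
          ≡⟨ solve 2 (λ x d → (x :+ con 1ℚ) :* (con (ι 2) :* d :* con 1ℚ) := con (ι 2) :* ((x :+ con 1ℚ) :* d)) refl x (x - y) ⟩
        ι 2 * ((x + 1ℚ) * (x - y)) ∎

    -- The mirror image, with 1 - w² = 4 y / (y + 1)². Truncation helps the upper bound but costs
    -- the lower one the factor 1 - w²ⁿ.
    logSum-diff-≥ : ∀ n → (x - y) * (1ℚ - mobius y ^ (2 ℕ.* n)) ≤ x * (logSum n x - logSum n y)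
    logSum-diff-≥ n = cancel (0<q+1 1≤y) (begin
      (y + 1ℚ) * ((x - y) * (1ℚ - P))   ≤⟨ cancel {ι 2} (ℚ.positive⁻¹ (ι 2)) doubled ⟩
      y * (x + 1ℚ) * F n                ≤⟨ *-monoʳ (0≤F n) y[x+1]≤x[y+1] ⟩
      x * (y + 1ℚ) * F n                ≡⟨ solve 3 (λ x y f → x :* (y :+ con 1ℚ) :* f := (y :+ con 1ℚ) :* (x :* f)) refl x y (F n) ⟩
      (y + 1ℚ) * (x * F n)              ∎)
      where
      open ℚ.≤-Reasoning
      a = artanhSum n z
      b = artanhSum n w
      P = w ^ (2 ℕ.* n)
      doubled : ι 2 * ((y + 1ℚ) * ((x - y) * (1ℚ - P))) ≤ ι 2 * (y * (x + 1ℚ) * F n)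
      doubled = begin
        ι 2 * ((y + 1ℚ) * ((x - y) * (1ℚ - P)))
          ≡⟨ solve 3 (λ y d p → con (ι 2) :* ((y :+ con 1ℚ) :* (d :* (con 1ℚ :- p))) :=
               (y :+ con 1ℚ) :* (con (ι 2) :* d :* (con 1ℚ :- p))) refl y (x - y) P ⟩
        (y + 1ℚ) * (ι 2 * (x - y) * (1ℚ - P))
          ≡⟨ cong (λ t → (y + 1ℚ) * (t * (1ℚ - P))) mobius-diff ⟨
        (y + 1ℚ) * (((x + 1ℚ) * (y + 1ℚ) * (z - w)) * (1ℚ - P))
          ≡⟨ solve 4 (λ s c d p → s :* ((c :* d) :* (con 1ℚ :- p)) := s :* c :* (d :* (con 1ℚ :- p))) refl
               (y + 1ℚ) ((x + 1ℚ) * (y + 1ℚ)) (z - w) P ⟩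
        (y + 1ℚ) * ((x + 1ℚ) * (y + 1ℚ)) * ((z - w) * (1ℚ - P))
          ≤⟨ *-monoˡ (ℚ.<⇒≤ (pos*pos (0<q+1 1≤y) (pos*pos (0<q+1 1≤x) (0<q+1 1≤y))))
               (artanhSum-diff-≥ (0≤mobius 1≤y) mobius-mono (ℚ.<⇒≤ (mobius<1 1≤y)) n) ⟩
        (y + 1ℚ) * ((x + 1ℚ) * (y + 1ℚ)) * ((1ℚ - w * w) * (a - b))
          ≡⟨ solve 4 (λ x y s t → (y :+ con 1ℚ) :* ((x :+ con 1ℚ) :* (y :+ con 1ℚ)) :* (s :* t) :=
               (x :+ con 1ℚ) :* ((y :+ con 1ℚ) :* (y :+ con 1ℚ) :* s :* t)) refl x y (1ℚ - w * w) (a - b) ⟩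
        (x + 1ℚ) * ((y + 1ℚ) * (y + 1ℚ) * (1ℚ - w * w) * (a - b))
          ≡⟨ cong (λ t → (x + 1ℚ) * (t * (a - b))) (mobius-sq 1≤y) ⟩
        (x + 1ℚ) * ((ι 4 * y) * (a - b))
          ≡⟨ solve 4 (λ x y a b → (x :+ con 1ℚ) :* ((con (ι 4) :* y) :* (a :- b)) :=
               con (ι 2) :* (y :* (x :+ con 1ℚ) :* (con (ι 2) :* a :- con (ι 2) :* b))) refl x y a b ⟩
        ι 2 * (y * (x + 1ℚ) * (ι 2 * a - ι 2 * b)) ∎

  -- The functional equation in the limit.

  -- Since `mobius` is increasing, its value at Q controls all of [1, Q]; one n thus serves every
  -- node of a subdivision.
  mobius-^-small : ∀ {Q} → 1ℚ ≤ Q → ∀ δ → 0ℚ < δ →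
                   Eventually λ n → ∀ y → 1ℚ ≤ y → y ≤ Q → mobius y ^ (2 ℕ.* n) ≤ δ
  mobius-^-small {Q} 1≤Q δ 0<δ =
    let N , small = Estimates.^-small (0≤mobius 1≤Q) (mobius<1 1≤Q) δ 0<δ
    in N , λ n N≤n y 1≤y y≤Q → ℚ.≤-trans (proj₂ (^-mono (0≤mobius 1≤y) (mobius-mono 1≤y y≤Q) (2 ℕ.* n)))
      (ℚ.≤-trans (^-even (0≤mobius 1≤Q) (mobius<1 1≤Q) n) (small n N≤n))

  -- Says that a lies between (1 - δ)(x - y) / x and (x - y) / y. Without reciprocals a common
  -- factor of x and y can be cancelled directly.
  Sandwiched : ℚ → ℚ → ℚ → ℚ → Set
  Sandwiched δ x y a = y * a ≤ x - y × (x - y) * (1ℚ - δ) ≤ x * a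

  -- Both numbers lie in an interval of length (x - y)(1 / y - (1 - δ) / x), and 1 / x ≤ 1.
  sandwiched-close : ∀ {δ x y a b} → 0ℚ ≤ δ → 1ℚ ≤ y → y ≤ x → Sandwiched δ x y a → Sandwiched δ x y b →
                     ∣ a - b ∣ ≤ (x - y) * (recip y - recip x) + (x - y) * δ
  sandwiched-close {δ} {x} {y} {a} {b} 0≤δ 1≤y y≤x sa sb =
    ∣∣≤ (one-sided sa sb) (subst (_≤ e) (solve 2 (λ a b → b :- a := :- (a :- b)) refl a b) (one-sided sb sa))
    where
    open ℚ.≤-Reasoning
    1≤x : 1ℚ ≤ x
    1≤x = ℚ.≤-trans 1≤y y≤x
    ry rx d e : ℚ
    ry = recip y
    rx = recip x
    d = x - y
    e = d * (ry - rx) + d * δ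
    0≤d : 0ℚ ≤ d
    0≤d = diff-nonNeg y≤x
    divided : ∀ {q} → 1ℚ ≤ q → ∀ t → recip q * (q * t) ≡ t
    divided {q} 1≤q t = trans (solve 3 (λ r q t → r :* (q :* t) := (q :* r) :* t) refl (recip q) q t)
      (trans (cong (_* t) (proj₂ (recip-pos (0<q 1≤q)))) (ℚ.*-identityˡ t))
    0≤recip : ∀ {q} → 1ℚ ≤ q → 0ℚ ≤ recip q
    0≤recip 1≤q = ℚ.<⇒≤ (proj₁ (recip-pos (0<q 1≤q)))
    one-sided : ∀ {a b} → Sandwiched δ x y a → Sandwiched δ x y b → a - b ≤ e
    one-sided {a} {b} (upper , _) (_ , lower) = begin
      a - b
        ≡⟨ cong₂ _-_ (sym (divided 1≤y a)) (sym (divided 1≤x b)) ⟩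
      ry * (y * a) - rx * (x * b)
        ≤⟨ ℚ.+-mono-≤ (*-monoˡ (0≤recip 1≤y) upper) (ℚ.neg-antimono-≤ (*-monoˡ (0≤recip 1≤x) lower)) ⟩
      ry * d - rx * (d * (1ℚ - δ))
        ≡⟨ solve 4 (λ s r d δ → s :* d :- r :* (d :* (con 1ℚ :- δ)) := d :* (s :- r) :+ d :* δ :* r) refl ry rx d δ ⟩
      d * (ry - rx) + d * δ * rx
        ≤⟨ ℚ.+-monoʳ-≤ (d * (ry - rx)) (*-monoˡ (*-nonNeg 0≤d 0≤δ) (recip-anti Estimates.0<1 1≤x)) ⟩
      d * (ry - rx) + d * δ * 1ℚ
        ≡⟨ cong (d * (ry - rx) +_) (ℚ.*-identityʳ (d * δ)) ⟩
      e ∎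

  module _ {Δ : ℚ} (0≤Δ : 0ℚ ≤ Δ) where

    node : ℕ → ℚ
    node zero    = 1ℚ
    node (suc j) = node j + Δ

    1≤node : ∀ j → 1ℚ ≤ node j
    1≤node zero    = ℚ.≤-refl
    1≤node (suc j) = ℚ.≤-trans (1≤node j) (≤+ʳ 0≤Δ)

    node≡ : ∀ j → node j ≡ 1ℚ + ι j * Δ
    node≡ zero    = sym (trans (cong (λ t → 1ℚ + t) (ℚ.*-zeroˡ Δ)) (ℚ.+-identityʳ 1ℚ))
    node≡ (suc j) = trans (cong (_+ Δ) (node≡ j)) (trans
      (solve 2 (λ i d → (con 1ℚ :+ i :* d) :+ d := con 1ℚ :+ (con 1ℚ :+ i) :* d) refl (ι j) Δ)
      (cong (λ t → 1ℚ + t * Δ) (sym (ι-suc j))))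

  -- Both logSum n (c x) - logSum n (c y) and logSum n x - logSum n y lie between
  -- (x - y)/x and (x - y)/y up to a small error, so t ↦ logSum n (c t) - logSum n t
  -- changes by O(Δ²) over a step of length Δ.
  module _ {c : ℚ} (1≤c : 1ℚ ≤ c) where

    scaled : ℕ → ℚ → ℚ
    scaled n t = logSum n (c * t) - logSum n t

    private
      1≤c* : ∀ {t} → 1ℚ ≤ t → 1ℚ ≤ c * t
      1≤c* {t} 1≤t = subst (_≤ c * t) (ℚ.*-identityˡ 1ℚ) (*-mono 0≤1 1≤c 0≤1 1≤t)

      ≤c* : ∀ {t} → 1ℚ ≤ t → t ≤ c * t
      ≤c* {t} 1≤t = subst (_≤ c * t) (ℚ.*-identityˡ t) (*-monoʳ (ℚ.≤-trans 0≤1 1≤t) 1≤c)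

    module _ {Q δ : ℚ} {n : ℕ} (0≤δ : 0ℚ ≤ δ)
             (small : ∀ y → 1ℚ ≤ y → y ≤ Q → mobius y ^ (2 ℕ.* n) ≤ δ) where

      sandwich : ∀ {x y} → 1ℚ ≤ y → y ≤ x → y ≤ Q → Sandwiched δ x y (logSum n x - logSum n y)
      sandwich 1≤y y≤x y≤Q = logSum-diff-≤ 1≤y y≤x n , ℚ.≤-trans
        (*-monoˡ (diff-nonNeg y≤x) (ℚ.+-monoʳ-≤ 1ℚ (ℚ.neg-antimono-≤ (small _ 1≤y y≤Q)))) (logSum-diff-≥ 1≤y y≤x n)

      scaled-sandwich : ∀ {x y} → 1ℚ ≤ y → y ≤ x → c * y ≤ Q → Sandwiched δ x y (logSum n (c * x) - logSum n (c * y))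
      scaled-sandwich {x} {y} 1≤y y≤x cy≤Q =
        let a = logSum n (c * x) - logSum n (c * y)
            upper , lower = sandwich (1≤c* 1≤y) (*-monoˡ (ℚ.≤-trans 0≤1 1≤c) y≤x) cy≤Q
        in cancel (0<q 1≤c) (subst₂ _≤_
             (ℚ.*-assoc c y a) (solve 3 (λ c x y → c :* x :- c :* y := c :* (x :- y)) refl c x y) upper) ,
           cancel (0<q 1≤c) (subst₂ _≤_
             (solve 4 (λ c x y e → (c :* x :- c :* y) :* e := c :* ((x :- y) :* e)) refl c x y (1ℚ - δ))
             (ℚ.*-assoc c x a) lower)

      scaled-step : ∀ {x y} → 1ℚ ≤ y → y ≤ x → c * y ≤ Q →
                    ∣ scaled n x - scaled n y ∣ ≤ (x - y) * (recip y - recip x) + (x - y) * δ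
      scaled-step {x} {y} 1≤y y≤x cy≤Q = subst (λ t → ∣ t ∣ ≤ (x - y) * (recip y - recip x) + (x - y) * δ)
        (solve 4 (λ a b s t → (a :- b) :- (s :- t) := (a :- s) :- (b :- t)) refl
          (logSum n (c * x)) (logSum n (c * y)) (logSum n x) (logSum n y))
        (sandwiched-close 0≤δ 1≤y y≤x (scaled-sandwich 1≤y y≤x cy≤Q)
          (sandwich 1≤y y≤x (ℚ.≤-trans (≤c* 1≤y) cy≤Q)))

      module _ {Δ : ℚ} (0≤Δ : 0ℚ ≤ Δ) where

        private
          nodeΔ : ℕ → ℚ
          nodeΔ = node 0≤Δ

        -- The step errors Δ (1 / tᵢ - 1 / tᵢ₊₁) telescope: their total stays below Δ however many
        -- steps are taken. The truncation errors Δ δ merely add up.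
        scaled-node : ∀ j → c * nodeΔ j ≤ Q →
                      ∣ scaled n (nodeΔ j) - scaled n 1ℚ ∣ ≤ Δ * (1ℚ - recip (nodeΔ j)) + ι j * (Δ * δ)
        scaled-node zero    _     = ℚ.≤-reflexive (trans
          (cong ∣_∣ (ℚ.+-inverseʳ (scaled n 1ℚ)))
          (solve 2 (λ d e → con 0ℚ := d :* (con 1ℚ :- con 1ℚ) :+ con 0ℚ :* (d :* e)) refl Δ δ))
        scaled-node (suc j) bound = begin
          ∣ scaled n (t + Δ) - scaled n 1ℚ ∣
            ≡⟨ cong ∣_∣ (solve 3 (λ a b c → a :- c := (a :- b) :+ (b :- c)) refl (scaled n (t + Δ)) (scaled n t) (scaled n 1ℚ)) ⟩
          ∣ (scaled n (t + Δ) - scaled n t) + (scaled n t - scaled n 1ℚ) ∣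
            ≤⟨ ℚ.∣p+q∣≤∣p∣+∣q∣ (scaled n (t + Δ) - scaled n t) (scaled n t - scaled n 1ℚ) ⟩
          ∣ scaled n (t + Δ) - scaled n t ∣ + ∣ scaled n t - scaled n 1ℚ ∣
            ≤⟨ ℚ.+-mono-≤ (scaled-step (1≤node 0≤Δ j) (≤+ʳ 0≤Δ) ct≤Q) (scaled-node j ct≤Q) ⟩
          (t + Δ - t) * (recip t - recip (t + Δ)) + (t + Δ - t) * δ + (Δ * (1ℚ - recip t) + ι j * (Δ * δ))
            ≡⟨ solve 6 (λ t d r s e i → (t :+ d :- t) :* (r :- s) :+ (t :+ d :- t) :* e :+ (d :* (con 1ℚ :- r) :+ i :* (d :* e)) :=
                 d :* (con 1ℚ :- s) :+ (con 1ℚ :+ i) :* (d :* e)) refl t Δ (recip t) (recip (t + Δ)) δ (ι j) ⟩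
          Δ * (1ℚ - recip (t + Δ)) + (1ℚ + ι j) * (Δ * δ)
            ≡⟨ cong (λ i → Δ * (1ℚ - recip (t + Δ)) + i * (Δ * δ)) (ι-suc j) ⟨
          Δ * (1ℚ - recip (t + Δ)) + ι (suc j) * (Δ * δ) ∎
          where
          open ℚ.≤-Reasoning
          t : ℚ
          t = nodeΔ j
          ct≤Q : c * t ≤ Q
          ct≤Q = ℚ.≤-trans (*-monoˡ (ℚ.≤-trans 0≤1 1≤c) (≤+ʳ 0≤Δ)) bound

    -- X (N + 1) steps of length Δ = 1 / (N + 1) lead from 1 to X + 1. The total error is at most Δ
    -- + X δ, with Δ ≤ ε / 2 and (X + 1) δ = ε / 2.
    logSum-scale : ∀ X ε → 0ℚ < ε →
                   Eventually λ n → ∣ (logSum n (c * ι (suc X)) - logSum n (ι (suc X))) - (logSum n c - logSum n 1ℚ) ∣ ≤ ε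
    logSum-scale X ε 0<ε =
      let N , Δ≤       = small-unitFrac (half-pos 0<ε)
          δ , 0<δ , eδ = divide (ℚ.<-≤-trans Estimates.0<1 (ι-mono {1} {suc X} (s≤s z≤n))) (half-pos 0<ε)
          M , small    = mobius-^-small (1≤c* (ι-mono {1} {suc X} (s≤s z≤n))) δ 0<δ
      in M , λ n M≤n → bound N Δ≤ δ 0<δ eδ n (small n M≤n)
      where
      open ℚ.≤-Reasoning
      bound : ∀ N → ℤ.+ 1 / suc N ≤ ε * ½ → ∀ δ → 0ℚ < δ → ι (suc X) * δ ≡ ε * ½ → ∀ n →
              (∀ y → 1ℚ ≤ y → y ≤ c * ι (suc X) → mobius y ^ (2 ℕ.* n) ≤ δ) →
              ∣ (logSum n (c * ι (suc X)) - logSum n (ι (suc X))) - (logSum n c - logSum n 1ℚ) ∣ ≤ ε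
      bound N Δ≤ δ 0<δ eδ n small = begin
        ∣ scaled n (ι (suc X)) - (logSum n c - logSum n 1ℚ) ∣
          ≡⟨ cong₂ (λ a b → ∣ scaled n a - (logSum n b - logSum n 1ℚ) ∣) (sym last≡) (sym (ℚ.*-identityʳ c)) ⟩
        ∣ scaled n (node′ J) - scaled n 1ℚ ∣
          ≤⟨ scaled-node {n = n} (ℚ.<⇒≤ 0<δ) small (ℚ.<⇒≤ 0<Δ) J (ℚ.≤-reflexive (cong (c *_) last≡)) ⟩
        Δ * (1ℚ - recip (node′ J)) + ι J * (Δ * δ)
          ≤⟨ ℚ.+-mono-≤ (*-monoˡ (ℚ.<⇒≤ 0<Δ) (subst (1ℚ - recip (node′ J) ≤_) (ℚ.+-identityʳ 1ℚ) (ℚ.+-monoʳ-≤ 1ℚ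
               (ℚ.neg-antimono-≤ (ℚ.<⇒≤ (proj₁ (recip-pos (0<q (1≤node (ℚ.<⇒≤ 0<Δ) J)))))))))
               (ℚ.≤-reflexive (trans (sym (ℚ.*-assoc (ι J) Δ δ)) (cong (_* δ) JΔ≡))) ⟩
        Δ * 1ℚ + ι X * δ
          ≤⟨ ℚ.+-mono-≤ (ℚ.≤-reflexive (ℚ.*-identityʳ Δ)) (*-monoʳ (ℚ.<⇒≤ 0<δ) (ι-mono (ℕ.n≤1+n X))) ⟩
        Δ + ι (suc X) * δ
          ≤⟨ ℚ.+-mono-≤ Δ≤ (ℚ.≤-reflexive eδ) ⟩
        ε * ½ + ε * ½
          ≡⟨ halves ε ⟩
        ε ∎
        where
        Δ : ℚ
        Δ = ℤ.+ 1 / suc N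
        0<Δ : 0ℚ < Δ
        0<Δ = unitFrac-pos N
        J : ℕ
        J = X ℕ.* suc N
        node′ : ℕ → ℚ
        node′ = node (ℚ.<⇒≤ 0<Δ)
        JΔ≡ : ι J * Δ ≡ ι X
        JΔ≡ = trans (cong (_* Δ) (ι-* X (suc N))) (trans (ℚ.*-assoc (ι X) (ι (suc N)) Δ)
          (trans (cong (ι X *_) (trans (ℚ.*-comm (ι (suc N)) Δ) (unitFrac N))) (ℚ.*-identityʳ (ι X))))
        last≡ : node′ J ≡ ι (suc X)
        last≡ = trans (node≡ (ℚ.<⇒≤ 0<Δ) J) (trans (cong (λ t → 1ℚ + t) JΔ≡) (sym (ι-suc X)))

  artanhSum-0 : ∀ n → artanhSum n 0ℚ ≡ 0ℚ
  artanhSum-0 zero    = refl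
  artanhSum-0 (suc n) = trans (cong₂ _+_ (artanhSum-0 n)
    (trans (cong ((ℤ.+ 1 / suc (2 ℕ.* n)) *_) (ℚ.*-zeroˡ (0ℚ ^ (2 ℕ.* n)))) (ℚ.*-zeroʳ (ℤ.+ 1 / suc (2 ℕ.* n))))) (ℚ.+-identityʳ 0ℚ)

  logSum-1 : ∀ n → logSum n 1ℚ ≡ 0ℚ
  logSum-1 n = trans (cong (ι 2 *_) (artanhSum-0 n)) (ℚ.*-zeroʳ (ι 2))

  logSum-3^ : ∀ a ε → 0ℚ < ε → Eventually λ n → ∣ logSum n (ι (3 ℕ.^ a)) - ι a * logSum n (ι 3) ∣ ≤ ε
  logSum-3^ zero    ε 0<ε = 0 , λ n _ → subst (λ t → ∣ t ∣ ≤ ε)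
    (sym (trans (cong₂ _-_ (logSum-1 n) (ℚ.*-zeroˡ (logSum n (ι 3)))) (ℚ.+-inverseʳ 0ℚ))) (ℚ.<⇒≤ 0<ε)
  -- `logSum-scale` requires a successor, and 3ᵃ > 0 excludes the other form.
  logSum-3^ (suc a) ε 0<ε with 3 ℕ.^ a | ℕ.m^n>0 3 a | logSum-3^ a (ε * ½) (half-pos 0<ε)
  ... | suc X | _ | IH = Estimates.both combine IH (logSum-scale {ι 3} (ι-mono {1} {3} (s≤s z≤n)) X (ε * ½) (half-pos 0<ε))
    where
    open ℚ.≤-Reasoning
    combine : ∀ n → ∣ logSum n (ι (suc X)) - ι a * logSum n (ι 3) ∣ ≤ ε * ½ →
      ∣ (logSum n (ι 3 * ι (suc X)) - logSum n (ι (suc X))) - (logSum n (ι 3) - logSum n 1ℚ) ∣ ≤ ε * ½ →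
      ∣ logSum n (ι (3 ℕ.* suc X)) - ι (suc a) * logSum n (ι 3) ∣ ≤ ε
    combine n h₁ h₂ = begin
      ∣ logSum n (ι (3 ℕ.* suc X)) - ι (suc a) * f3 ∣
        ≡⟨ cong₂ (λ s t → ∣ logSum n s - t * f3 ∣) (ι-* 3 (suc X)) (ι-suc a) ⟩
      ∣ g - (1ℚ + ι a) * f3 ∣
        ≡⟨ cong ∣_∣ (solve 4 (λ g f i f3 → g :- (con 1ℚ :+ i) :* f3 := (f :- i :* f3) :+ ((g :- f) :- (f3 :- con 0ℚ))) refl g f (ι a) f3) ⟩
      ∣ (f - ι a * f3) + ((g - f) - (f3 - 0ℚ)) ∣
        ≤⟨ ℚ.∣p+q∣≤∣p∣+∣q∣ (f - ι a * f3) ((g - f) - (f3 - 0ℚ)) ⟩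
      ∣ f - ι a * f3 ∣ + ∣ (g - f) - (f3 - 0ℚ) ∣
        ≤⟨ ℚ.+-mono-≤ h₁ (subst (λ t → ∣ (g - f) - (f3 - t) ∣ ≤ ε * ½) (logSum-1 n) h₂) ⟩
      ε * ½ + ε * ½
        ≡⟨ halves ε ⟩
      ε ∎
      where
      f3 f g : ℚ
      f3 = logSum n (ι 3)
      f = logSum n (ι (suc X))
      g = logSum n (ι 3 * ι (suc X))

-- Termwise inequalities behind the real bounds.

module RationalEstimates where

  import Data.Nat as ℕ
  open ℕ using (ℕ)
  open import Data.Product using (proj₁; proj₂)
  open import Data.Sum using (inj₁; inj₂)
  open import Data.Rational using (ℚ; 0ℚ; 1ℚ; ½; _+_; _*_; _≤_; _<_)
  import Data.Rational.Properties as ℚ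
  open import Data.Rational.Solver using (module +-*-Solver)
  open import Relation.Binary.PropositionalEquality using (_≡_; refl; sym; trans; cong; cong₂; subst; subst₂)
  open import Defs using (module Estimates)
  open Estimates
  open LogEstimates
  open +-*-Solver using (solve; _:=_; _:+_; _:*_; _:-_; :-_; con)

  recip-unique : ∀ {q t} → 0ℚ < q → q * t ≡ 1ℚ → recip q ≡ t
  recip-unique {q} {t} 0<q qt≡1 = trans (sym (ℚ.*-identityʳ (recip q))) (trans (cong (recip q *_) (sym qt≡1))
    (trans (solve 3 (λ r q t → r :* (q :* t) := (q :* r) :* t) refl (recip q) q t)
      (trans (cong (_* t) (proj₂ (recip-pos 0<q))) (ℚ.*-identityˡ t))))

  0≤sq : ∀ x → 0ℚ ≤ x * x
  0≤sq x with ℚ.≤-total 0ℚ x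
  ... | inj₁ 0≤x = *-nonNeg 0≤x 0≤x
  ... | inj₂ x≤0 = subst (0ℚ ≤_) (solve 1 (λ x → (:- x) :* (:- x) := x :* x) refl x)
    (*-nonNeg (ℚ.neg-antimono-≤ x≤0) (ℚ.neg-antimono-≤ x≤0))

  0≤½ : 0ℚ ≤ ½
  0≤½ = ℚ.<⇒≤ (ℚ.positive⁻¹ ½)

  ½≤1 : ½ ≤ 1ℚ
  ½≤1 = ≤+ʳ {½} {½} 0≤½

  0<2q² : ∀ {q} → 0ℚ < q → 0ℚ < ι 2 * (q * q)
  0<2q² 0<q = pos*pos (ℚ.positive⁻¹ (ι 2)) (pos*pos 0<q 0<q)

  recip≤1 : ∀ {q} → 1ℚ ≤ q → recip q ≤ 1ℚ
  recip≤1 = recip-anti Estimates.0<1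

  -- To be read with L = log p, b = log 3, r = 1 / log log p and σ = 1 / s. Both sides agree except
  -- for σ / b against ε, and b ≥ 1.
  main-term : ∀ {L b r σ ε} → 1ℚ ≤ b → 0ℚ ≤ L * L * r → 0ℚ ≤ σ → σ ≤ ε →
    (L * recip b) * (L * recip b) * (½ + (ι 2 + σ) * (b * r)) ≤
    L * L * recip (ι 2 * (b * b)) + (ι 2 * recip b + ε) * (L * L * r)
  main-term {L} {b} {r} {σ} {ε} 1≤b 0≤LLr 0≤σ σ≤ε = begin
    (L * ρ) * (L * ρ) * (½ + (ι 2 + σ) * (b * r))
      ≡⟨ solve 5 (λ L ρ b r σ → (L :* ρ) :* (L :* ρ) :* (con ½ :+ (con (ι 2) :+ σ) :* (b :* r)) :=
           L :* L :* (con ½ :* (ρ :* ρ)) :+ (con (ι 2) :* ρ :+ σ :* ρ) :* (L :* L :* r) :* (b :* ρ)) refl L ρ b r σ ⟩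
    L * L * (½ * (ρ * ρ)) + (ι 2 * ρ + σ * ρ) * (L * L * r) * (b * ρ)
      ≡⟨ cong₂ (λ s t → L * L * s + (ι 2 * ρ + σ * ρ) * (L * L * r) * t) (sym recip-2b²) bρ≡1 ⟩
    L * L * recip (ι 2 * (b * b)) + (ι 2 * ρ + σ * ρ) * (L * L * r) * 1ℚ
      ≡⟨ cong (L * L * recip (ι 2 * (b * b)) +_) (ℚ.*-identityʳ _) ⟩
    L * L * recip (ι 2 * (b * b)) + (ι 2 * ρ + σ * ρ) * (L * L * r)
      ≤⟨ ℚ.+-monoʳ-≤ (L * L * recip (ι 2 * (b * b))) (*-monoʳ 0≤LLr (ℚ.+-monoʳ-≤ (ι 2 * ρ) σρ≤ε)) ⟩
    L * L * recip (ι 2 * (b * b)) + (ι 2 * ρ + ε) * (L * L * r) ∎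
    where
    open ℚ.≤-Reasoning
    ρ : ℚ
    ρ = recip b
    bρ≡1 : b * ρ ≡ 1ℚ
    bρ≡1 = proj₂ (recip-pos (0<q 1≤b))
    recip-2b² : recip (ι 2 * (b * b)) ≡ ½ * (ρ * ρ)
    recip-2b² = recip-unique (0<2q² (0<q 1≤b)) (trans
      (solve 2 (λ b ρ → con (ι 2) :* (b :* b) :* (con ½ :* (ρ :* ρ)) := (b :* ρ) :* (b :* ρ)) refl b ρ)
      (cong₂ _*_ bρ≡1 bρ≡1))
    σρ≤ε : σ * ρ ≤ ε
    σρ≤ε = ℚ.≤-trans (*-monoˡ 0≤σ (recip≤1 1≤b)) (ℚ.≤-trans (ℚ.≤-reflexive (ℚ.*-identityʳ σ)) σ≤ε)

  recip-ratio : ∀ {a b} → 0ℚ < a → 0ℚ < b →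
                recip (ι 2 * ((b * recip a) * (b * recip a))) ≡ ½ * ((a * recip b) * (a * recip b))
  recip-ratio {a} {b} 0<a 0<b = recip-unique (0<2q² (pos*pos 0<b (proj₁ (recip-pos 0<a)))) (trans
    (solve 4 (λ a b α β → con (ι 2) :* ((b :* α) :* (b :* α)) :* (con ½ :* ((a :* β) :* (a :* β))) :=
      ((a :* α) :* (a :* α)) :* ((b :* β) :* (b :* β))) refl a b (recip a) (recip b))
    (cong₂ (λ s t → (s * s) * (t * t)) (proj₂ (recip-pos 0<a)) (proj₂ (recip-pos 0<b))))

  -- With a = log 2 and b = log 3 the leading terms agree, as (a / b)² (L / a)² = (L / b)². The rest
  -- is σ / (2 b²) ≤ ε / a², by a ≤ 1 ≤ b.
  constant-term : ∀ {L a b σ ε} → 0ℚ < a → a ≤ 1ℚ → 1ℚ ≤ b → 0ℚ ≤ σ → σ ≤ ε →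
    (L * recip b) * (L * recip b) * (½ * (1ℚ + σ)) ≤
    (1ℚ * recip (ι 2 * ((b * recip a) * (b * recip a))) + ε) * ((L * recip a) * (L * recip a))
  constant-term {L} {a} {b} {σ} {ε} 0<a a≤1 1≤b 0≤σ σ≤ε = begin
    (L * β) * (L * β) * (½ * (1ℚ + σ))
      ≡⟨ solve 3 (λ L β σ → (L :* β) :* (L :* β) :* (con ½ :* (con 1ℚ :+ σ)) :=
           con ½ :* (β :* β) :* (L :* L) :* (con 1ℚ :* con 1ℚ) :+ con ½ :* σ :* (β :* β) :* (L :* L)) refl L β σ ⟩
    ½ * (β * β) * (L * L) * (1ℚ * 1ℚ) + ½ * σ * (β * β) * (L * L)
      ≤⟨ ℚ.+-mono-≤ (ℚ.≤-reflexive (cong (λ t → ½ * (β * β) * (L * L) * (t * t)) (sym aα≡1))) (*-monoʳ (0≤sq L) small) ⟩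
    ½ * (β * β) * (L * L) * ((a * α) * (a * α)) + ε * (α * α) * (L * L)
      ≡⟨ solve 5 (λ L a α β ε → con ½ :* (β :* β) :* (L :* L) :* ((a :* α) :* (a :* α)) :+ ε :* (α :* α) :* (L :* L) :=
           (con 1ℚ :* (con ½ :* ((a :* β) :* (a :* β))) :+ ε) :* ((L :* α) :* (L :* α))) refl L a α β ε ⟩
    (1ℚ * (½ * ((a * β) * (a * β))) + ε) * ((L * α) * (L * α))
      ≡⟨ cong (λ t → (1ℚ * t + ε) * ((L * α) * (L * α))) (recip-ratio 0<a (0<q 1≤b)) ⟨
    (1ℚ * recip (ι 2 * ((b * α) * (b * α))) + ε) * ((L * α) * (L * α)) ∎
    where
    open ℚ.≤-Reasoning
    α β : ℚ
    α = recip a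
    β = recip b
    aα≡1 : a * α ≡ 1ℚ
    aα≡1 = proj₂ (recip-pos 0<a)
    0≤β : 0ℚ ≤ β
    0≤β = ℚ.<⇒≤ (proj₁ (recip-pos (0<q 1≤b)))
    1≤α : 1ℚ ≤ α
    1≤α = recip-anti 0<a a≤1
    small : ½ * σ * (β * β) ≤ ε * (α * α)
    small = *-mono (*-nonNeg 0≤½ 0≤σ) (ℚ.≤-trans (ℚ.≤-trans (*-monoʳ 0≤σ ½≤1) (ℚ.≤-reflexive (ℚ.*-identityˡ σ))) σ≤ε)
      (*-nonNeg 0≤β 0≤β) (ℚ.≤-trans (*-mono 0≤β (recip≤1 1≤b) 0≤β (recip≤1 1≤b)) (*-mono 0≤1 1≤α 0≤1 1≤α))

  module _ {s K l a : ℕ} {σ κ : ℚ} (0≤σ : 0ℚ ≤ σ) (sσ≡1 : ι s * σ ≡ 1ℚ) (0≤κ : 0ℚ ≤ κ) (Kκ≡1 : ι K * κ ≡ 1ℚ)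
           (bounded : 2 ℕ.* s ℕ.* K ℕ.* a ℕ.≤ l ℕ.* l ℕ.* (s ℕ.* K ℕ.+ 4 ℕ.* s ℕ.+ 2)) where

    cardinality-≤ : ι a ≤ ι l * ι l * (½ + (ι 2 + σ) * κ)
    cardinality-≤ = begin
      ι a
        ≡⟨ solve 1 (λ a → a := con ½ :* (con (ι 2) :* a) :* (con 1ℚ :* con 1ℚ)) refl (ι a) ⟩
      ½ * (ι 2 * ι a) * (1ℚ * 1ℚ)
        ≡⟨ cong₂ (λ x y → ½ * (ι 2 * ι a) * (x * y)) (sym sσ≡1) (sym Kκ≡1) ⟩
      ½ * (ι 2 * ι a) * ((ι s * σ) * (ι K * κ))
        ≡⟨ solve 5 (λ a s K σ κ → con ½ :* (con (ι 2) :* a) :* ((s :* σ) :* (K :* κ)) :=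
             con ½ :* (σ :* κ) :* (con (ι 2) :* s :* K :* a)) refl (ι a) (ι s) (ι K) σ κ ⟩
      ½ * (σ * κ) * (ι 2 * ι s * ι K * ι a)
        ≤⟨ *-monoˡ (*-nonNeg 0≤½ (*-nonNeg 0≤σ 0≤κ)) (subst₂ _≤_ lhs≡ rhs≡ (ι-mono bounded)) ⟩
      ½ * (σ * κ) * (ι l * ι l * (ι s * ι K + ι 4 * ι s + ι 2))
        ≡⟨ solve 5 (λ l s K σ κ → con ½ :* (σ :* κ) :* (l :* l :* (s :* K :+ con (ι 4) :* s :+ con (ι 2))) :=
             l :* l :* (con ½ :* ((s :* σ) :* (K :* κ)) :+ (con (ι 2) :* (s :* σ) :+ σ) :* κ)) refl (ι l) (ι s) (ι K) σ κ ⟩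
      ι l * ι l * (½ * ((ι s * σ) * (ι K * κ)) + (ι 2 * (ι s * σ) + σ) * κ)
        ≡⟨ cong₂ (λ x y → ι l * ι l * (½ * (x * y) + (ι 2 * x + σ) * κ)) sσ≡1 Kκ≡1 ⟩
      ι l * ι l * (½ * (1ℚ * 1ℚ) + (ι 2 * 1ℚ + σ) * κ)
        ≡⟨ cong (λ y → ι l * ι l * (½ + (y + σ) * κ)) (ℚ.*-identityʳ (ι 2)) ⟩
      ι l * ι l * (½ + (ι 2 + σ) * κ) ∎
      where
      open ℚ.≤-Reasoning
      lhs≡ : ι (2 ℕ.* s ℕ.* K ℕ.* a) ≡ ι 2 * ι s * ι K * ι a
      lhs≡ = trans (ι-* (2 ℕ.* s ℕ.* K) a) (cong (_* ι a) (trans (ι-* (2 ℕ.* s) K) (cong (_* ι K) (ι-* 2 s))))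
      rhs≡ : ι (l ℕ.* l ℕ.* (s ℕ.* K ℕ.+ 4 ℕ.* s ℕ.+ 2)) ≡ ι l * ι l * (ι s * ι K + ι 4 * ι s + ι 2)
      rhs≡ = trans (ι-* (l ℕ.* l) (s ℕ.* K ℕ.+ 4 ℕ.* s ℕ.+ 2)) (cong₂ _*_ (ι-* l l)
        (trans (ι-+ (s ℕ.* K ℕ.+ 4 ℕ.* s) 2) (cong (_+ ι 2) (trans (ι-+ (s ℕ.* K) (4 ℕ.* s)) (cong₂ _+_ (ι-* s K) (ι-* 4 s))))))

    -- K ≥ 4 s + 2 is the condition under which (2 + σ) κ ≤ σ / 2.
    cardinality-≤′ : 4 ℕ.* s ℕ.+ 2 ℕ.≤ K → ι a ≤ ι l * ι l * (½ * (1ℚ + σ))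
    cardinality-≤′ K≥ = ℚ.≤-trans cardinality-≤ (*-monoˡ (0≤sq (ι l)) (begin
      ½ + (ι 2 + σ) * κ
        ≡⟨ cong (λ t → ½ + (ι 2 * t + σ) * κ) sσ≡1 ⟨
      ½ + (ι 2 * (ι s * σ) + σ) * κ
        ≡⟨ solve 3 (λ s σ κ → con ½ :+ (con (ι 2) :* (s :* σ) :+ σ) :* κ :=
             con ½ :+ con ½ :* σ :* ((con (ι 4) :* s :+ con (ι 2)) :* κ)) refl (ι s) σ κ ⟩
      ½ + ½ * σ * ((ι 4 * ι s + ι 2) * κ)
        ≤⟨ ℚ.+-monoʳ-≤ ½ (*-monoˡ (*-nonNeg 0≤½ 0≤σ) (*-monoʳ 0≤κ
             (subst (_≤ ι K) (trans (ι-+ (4 ℕ.* s) 2) (cong (_+ ι 2) (ι-* 4 s))) (ι-mono K≥)))) ⟩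
      ½ + ½ * σ * (ι K * κ)
        ≡⟨ cong (λ t → ½ + ½ * σ * t) Kκ≡1 ⟩
      ½ + ½ * σ * 1ℚ
        ≡⟨ solve 1 (λ σ → con ½ :+ con ½ :* σ :* con 1ℚ := con ½ :* (con 1ℚ :+ σ)) refl σ ⟩
      ½ * (1ℚ + σ) ∎))
      where open ℚ.≤-Reasoning

-- The decimal digits of c₀ in fixed-point arithmetic.

module Numerics where

  open import Algebra.Bundles using (CommutativeRing)
  import Data.Integer as ℤ
  import Data.Nat as ℕ
  open ℕ using (ℕ; zero; suc; NonZero; z≤n; s≤s)
  import Data.Nat.DivMod as ℕ
  import Data.Nat.Properties as ℕ
  open import Data.Product using (_×_; _,_; proj₁; proj₂)
  open import Data.Rational using (ℚ; 0ℚ; 1ℚ; ½; _+_; _*_; _-_; -_; ∣_∣; _≤_; _<_; _/_; *<*; *≤*)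
  import Data.Rational.Properties as ℚ
  open import Data.Rational.Solver using (module +-*-Solver)
  open import Algebra.Properties.Semiring.Exp (CommutativeRing.semiring ℚ.+-*-commutativeRing) using (_^_)
  open import Data.Unit using (tt)
  open import Relation.Binary.PropositionalEquality using (_≡_; refl; sym; trans; cong; cong₂; subst; subst₂)
  open import Defs using (module Estimates)
  open Estimates
  open LogEstimates
  open RationalEstimates
  open +-*-Solver using (solve; _:=_; _:+_; _:*_; _:-_; :-_; con)

  -- 25 decimals: the total uncertainty of 70 + 16941 units is below 2 · 10⁻²¹, while 18 decimals of
  -- c₀ are to be secured.
  scale : ℕ
  scale = 10000000000000000000000000

  denominator : ℕ → ℕ → ℕ
  denominator m k = suc (2 ℕ.* k) ℕ.* m ℕ.^ suc (2 ℕ.* k)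

  denominator≢0 : ∀ m .{{_ : NonZero m}} k → NonZero (denominator m k)
  denominator≢0 m k = ℕ.m*n≢0 (suc (2 ℕ.* k)) (m ℕ.^ suc (2 ℕ.* k)) {{_}} {{ℕ.m^n≢0 m (suc (2 ℕ.* k))}}

  scaledFloor : (m : ℕ) .{{_ : NonZero m}} → ℕ → ℕ
  scaledFloor m k = ℕ._/_ scale (denominator m k) {{denominator≢0 m k}}

  floorSum : (m : ℕ) .{{_ : NonZero m}} → ℕ → ℕ
  floorSum m zero    = 0
  floorSum m (suc n) = floorSum m n ℕ.+ scaledFloor m n

  module _ (m : ℕ) .{{_ : NonZero m}} {z : ℚ} (0≤z : 0ℚ ≤ z) (zm≡1 : z * ι m ≡ 1ℚ) where

    private
      absorb : ∀ {t} D → t * ι D ≡ 1ℚ → ∀ x → ι x ≡ t * ι (x ℕ.* D)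
      absorb {t} D tD≡1 x = trans (sym (ℚ.*-identityʳ (ι x))) (trans (cong (ι x *_) (sym tD≡1))
        (trans (solve 3 (λ x t d → x :* (t :* d) := t :* (x :* d)) refl (ι x) t (ι D)) (cong (t *_) (sym (ι-* x D)))))

      ^-unit : ∀ j → z ^ j * ι (m ℕ.^ j) ≡ 1ℚ
      ^-unit zero    = ℚ.*-identityˡ 1ℚ
      ^-unit (suc j) = trans (cong (z ^ suc j *_) (ι-* m (m ℕ.^ j)))
        (trans (solve 4 (λ z p m i → (z :* p) :* (m :* i) := (z :* m) :* (p :* i)) refl z (z ^ j) (ι m) (ι (m ℕ.^ j)))
          (cong₂ _*_ zm≡1 (^-unit j)))

      term-unit : ∀ k → artanhTerm k z * ι (denominator m k) ≡ 1ℚ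
      term-unit k = trans (cong (artanhTerm k z *_) (ι-* (suc (2 ℕ.* k)) (m ℕ.^ suc (2 ℕ.* k))))
        (trans (solve 4 (λ c p d i → (c :* p) :* (d :* i) := (c :* d) :* (p :* i)) refl
          (ℤ.+ 1 / suc (2 ℕ.* k)) (z ^ suc (2 ℕ.* k)) (ι (suc (2 ℕ.* k))) (ι (m ℕ.^ suc (2 ℕ.* k))))
          (cong₂ _*_ (unitFrac (2 ℕ.* k)) (^-unit (suc (2 ℕ.* k)))))

      term-bounds : ∀ k → ι (scaledFloor m k) ≤ ι scale * artanhTerm k z ×
                          ι scale * artanhTerm k z ≤ ι (suc (scaledFloor m k))
      term-bounds k =
        subst₂ _≤_ (sym (absorb {t} D unit (scaledFloor m k))) (ℚ.*-comm t (ι scale))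
          (*-monoˡ 0≤t (ι-mono (ℕ.m/n*n≤m scale D))) ,
        subst₂ _≤_ (ℚ.*-comm t (ι scale)) (sym (absorb {t} D unit (suc (scaledFloor m k))))
          (*-monoˡ 0≤t (ι-mono (ℕ.≤-trans (ℕ.≤-reflexive (ℕ.m≡m%n+[m/n]*n scale D))
            (ℕ.+-monoˡ-≤ (scaledFloor m k ℕ.* D) (ℕ.<⇒≤ (ℕ.m%n<n scale D))))))
        where
        D : ℕ
        D = denominator m k
        instance
          D≢0 : NonZero D
          D≢0 = denominator≢0 m k
        t : ℚ
        t = artanhTerm k z
        0≤t : 0ℚ ≤ t
        0≤t = proj₁ (term-mono 0≤z ℚ.≤-refl k)
        unit : t * ι D ≡ 1ℚ
        unit = term-unit k

    -- Rounding down loses at most one unit per term.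
    sum-bounds : ∀ n → ι (floorSum m n) ≤ ι scale * artanhSum n z ×
                       ι scale * artanhSum n z ≤ ι (floorSum m n ℕ.+ n)
    sum-bounds zero    = ℚ.≤-reflexive (sym (ℚ.*-zeroʳ (ι scale))) , ℚ.≤-reflexive (ℚ.*-zeroʳ (ι scale))
    sum-bounds (suc n) =
      let lo , hi   = sum-bounds n
          lo′ , hi′ = term-bounds n
          split     = ℚ.*-distribˡ-+ (ι scale) (artanhSum n z) (artanhTerm n z)
      in subst₂ _≤_ (sym (ι-+ (floorSum m n) (scaledFloor m n))) (sym split) (ℚ.+-mono-≤ lo lo′) ,
         subst₂ _≤_ (sym split) (trans (sym (ι-+ (floorSum m n ℕ.+ n) (suc (scaledFloor m n))))
           (cong ι (regroup (floorSum m n) n (scaledFloor m n)))) (ℚ.+-mono-≤ hi hi′)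
      where
      regroup : ∀ a n b → a ℕ.+ n ℕ.+ suc b ≡ a ℕ.+ b ℕ.+ suc n
      regroup a n b = trans (ℕ.+-assoc a n (suc b)) (trans (cong (a ℕ.+_) (trans (ℕ.+-suc n b)
        (trans (cong suc (ℕ.+-comm n b)) (sym (ℕ.+-suc b n))))) (sym (ℕ.+-assoc a b (suc n))))

    module _ (z≤½ : z ≤ ½) {n₀ T : ℕ} (tail : 2 ℕ.* scale ℕ.≤ T ℕ.* m ℕ.^ n₀) where

      -- The tail after n₀ terms is at most z^n₀ / (1 - z) ≤ 2 z^n₀ for z ≤ 1/2, and the hypothesis
      -- on T says that this amounts to at most T units.
      enclosure : ∀ n → n₀ ℕ.≤ n → ι (floorSum m n₀) ≤ ι scale * artanhSum n z ×
                                   ι scale * artanhSum n z ≤ ι (floorSum m n₀ ℕ.+ n₀ ℕ.+ T)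
      enclosure n n₀≤n = ℚ.≤-trans (proj₁ (sum-bounds n₀)) (*-monoˡ (0≤ι scale) (sum-inc 0≤z n₀≤n)) , (begin
        ι scale * artanhSum n z
          ≡⟨ solve 3 (λ s a b → s :* a := s :* b :+ s :* (a :- b)) refl (ι scale) (artanhSum n z) (artanhSum n₀ z) ⟩
        ι scale * artanhSum n₀ z + ι scale * diff
          ≤⟨ ℚ.+-mono-≤ (proj₂ (sum-bounds n₀)) tail-≤ ⟩
        ι (floorSum m n₀ ℕ.+ n₀) + ι T
          ≡⟨ ι-+ (floorSum m n₀ ℕ.+ n₀) T ⟨
        ι (floorSum m n₀ ℕ.+ n₀ ℕ.+ T) ∎)
        where
        open ℚ.≤-Reasoning
        diff : ℚ
        diff = artanhSum n z - artanhSum n₀ z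
        z<1 : z < 1ℚ
        z<1 = ℚ.≤-<-trans z≤½ (*<* (ℤ.+<+ (s≤s (s≤s z≤n))))
        geometric-tail : (1ℚ - z) * ∣ diff ∣ ≤ z ^ n₀
        geometric-tail = subst (λ j → (1ℚ - z) * ∣ artanhSum j z - artanhSum n₀ z ∣ ≤ z ^ n₀) (ℕ.m∸n+n≡m n₀≤n)
          (sum-tail 0≤z z<1 (ℚ.≤-reflexive (ℚ.0≤p⇒∣p∣≡p 0≤z)) n₀ (n ℕ.∸ n₀))
        half≤ : ½ ≤ 1ℚ - z
        half≤ = ≤-shift {½} {1ℚ} {z} (ℚ.+-monoʳ-≤ ½ {z} {½} z≤½)
        tail-≤ : ι scale * diff ≤ ι T
        tail-≤ = begin
          ι scale * diff
            ≡⟨ solve 2 (λ s d → s :* d := (con (ι 2) :* s) :* (con ½ :* d)) refl (ι scale) diff ⟩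
          (ι 2 * ι scale) * (½ * diff)
            ≤⟨ *-monoˡ (*-nonNeg (0≤ι 2) (0≤ι scale)) (ℚ.≤-trans (*-monoˡ 0≤½ (≤∣∣ diff))
                 (ℚ.≤-trans (*-monoʳ (ℚ.0≤∣p∣ diff) half≤) geometric-tail)) ⟩
          (ι 2 * ι scale) * z ^ n₀
            ≡⟨ trans (ℚ.*-comm (ι 2 * ι scale) (z ^ n₀)) (cong (z ^ n₀ *_) (sym (ι-* 2 scale))) ⟩
          z ^ n₀ * ι (2 ℕ.* scale)
            ≤⟨ *-monoˡ (proj₁ (^-mono 0≤z ℚ.≤-refl n₀)) (ι-mono tail) ⟩
          z ^ n₀ * ι (T ℕ.* m ℕ.^ n₀)
            ≡⟨ absorb {z ^ n₀} (m ℕ.^ n₀) (^-unit n₀) T ⟨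
          ι T ∎

  module _ {a b N D : ℚ} (0<b : 0ℚ < b) where

    private
      β : ℚ
      β = recip b

      expand : N ≡ ½ * (β * β) * (ι 2 * N * (b * b))
      expand = trans (solve 1 (λ n → n := n :* (con 1ℚ :* con 1ℚ)) refl N)
        (trans (cong (λ t → N * (t * t)) (sym (proj₂ (recip-pos 0<b))))
          (solve 3 (λ n b β → n :* ((b :* β) :* (b :* β)) := con ½ :* (β :* β) :* (con (ι 2) :* n :* (b :* b))) refl N b β))

      expand′ : D * (½ * ((a * β) * (a * β))) ≡ ½ * (β * β) * (D * (a * a))
      expand′ = solve 3 (λ d a β → d :* (con ½ :* ((a :* β) :* (a :* β))) := con ½ :* (β :* β) :* (d :* (a :* a))) refl D a β

      0≤½β² : 0ℚ ≤ ½ * (β * β)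
      0≤½β² = *-nonNeg 0≤½ (0≤sq β)

    ratio-≥ : ι 2 * N * (b * b) ≤ D * (a * a) → N ≤ D * (½ * ((a * β) * (a * β)))
    ratio-≥ h = subst₂ _≤_ (sym expand) (sym expand′) (*-monoˡ 0≤½β² h)

    ratio-≤ : D * (a * a) ≤ ι 2 * N * (b * b) → D * (½ * ((a * β) * (a * β))) ≤ N
    ratio-≤ h = subst₂ _≤_ (sym expand′) (sym expand) (*-monoˡ 0≤½β² h)

  -- `mobius` maps 2 to 1/3 and 3 to 1/2, so this value and the next approximate 10²⁵ (log 2) / 2
  -- and 10²⁵ (log 3) / 2 from below.
  floorSum-⅓ : floorSum 3 70 ≡ 3465735902799726547086147
  floorSum-⅓ = refl

  floorSum-½ : floorSum 2 70 ≡ 5493061443340548456976206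
  floorSum-½ = refl

  private
    lo₂ hi₂ lo₃ hi₃ : ℕ
    lo₂ = 3465735902799726547086147
    -- 70 units for rounding; 16941 is 2 · 10²⁵ / 2⁷⁰ rounded up, the tail bound at 1/2, which also
    -- covers 1/3.
    hi₂ = lo₂ ℕ.+ 70 ℕ.+ 16941
    lo₃ = 5493061443340548456976206
    hi₃ = lo₃ ℕ.+ 70 ℕ.+ 16941

    ⅓ : ℚ
    ⅓ = ℤ.+ 1 / 3

    0≤⅓ : 0ℚ ≤ ⅓
    0≤⅓ = ℚ.<⇒≤ (ℚ.positive⁻¹ ⅓)

    enclosure₂ : ∀ n → 70 ℕ.≤ n → ι lo₂ ≤ ι scale * artanhSum n ⅓ × ι scale * artanhSum n ⅓ ≤ ι hi₂
    enclosure₂ n 70≤n = subst (λ l → ι l ≤ ι scale * artanhSum n ⅓ × ι scale * artanhSum n ⅓ ≤ ι (l ℕ.+ 70 ℕ.+ 16941))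
      floorSum-⅓ (enclosure 3 0≤⅓ refl (*≤* (ℤ.+≤+ (ℕ.≤ᵇ⇒≤ 2 3 tt))) {70} {16941} (ℕ.≤ᵇ⇒≤ _ _ tt) n 70≤n)

    enclosure₃ : ∀ n → 70 ℕ.≤ n → ι lo₃ ≤ ι scale * artanhSum n ½ × ι scale * artanhSum n ½ ≤ ι hi₃
    enclosure₃ n 70≤n = subst (λ l → ι l ≤ ι scale * artanhSum n ½ × ι scale * artanhSum n ½ ≤ ι (l ℕ.+ 70 ℕ.+ 16941))
      floorSum-½ (enclosure 2 0≤½ refl ℚ.≤-refl {70} {16941} (ℕ.≤ᵇ⇒≤ _ _ tt) n 70≤n)

    rescale : ∀ {c d x y} → ι scale * c * (ι scale * c) * x ≤ ι scale * d * (ι scale * d) * y →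
              (ι 2 * c * (ι 2 * c)) * x ≤ (ι 2 * d * (ι 2 * d)) * y
    rescale {c} {d} {x} {y} h = cancel {ι scale * ι scale} (pos*pos 0<scale 0<scale)
      (subst₂ _≤_ (commute c x) (commute d y) (*-monoˡ (0≤ι 4) h))
      where
      0<scale : 0ℚ < ι scale
      0<scale = ℚ.<-≤-trans Estimates.0<1 (ι-mono (ℕ.≤ᵇ⇒≤ 1 scale tt))
      commute : ∀ c x → ι 4 * (ι scale * c * (ι scale * c) * x) ≡ ι scale * ι scale * ((ι 2 * c * (ι 2 * c)) * x)
      commute c x = solve 3 (λ s c x → con (ι 4) :* (s :* c :* (s :* c) :* x) := s :* s :* ((con (ι 2) :* c :* (con (ι 2) :* c)) :* x))
        refl (ι scale) c x

    squares : ∀ {c d lo hi} x y → 0ℚ ≤ ι scale * c → ι scale * c ≤ ι hi → ι lo ≤ ι scale * d → hi ℕ.* hi ℕ.* x ℕ.≤ lo ℕ.* lo ℕ.* y →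
              (ι 2 * c * (ι 2 * c)) * ι x ≤ (ι 2 * d * (ι 2 * d)) * ι y
    squares {c} {d} {lo} {hi} x y 0≤c c≤ ≤d h = rescale {c} {d} (begin
      ι scale * c * (ι scale * c) * ι x    ≤⟨ *-monoʳ (0≤ι x) (*-mono 0≤c c≤ 0≤c c≤) ⟩
      ι hi * ι hi * ι x                    ≡⟨ trans (ι-* (hi ℕ.* hi) x) (cong (_* ι x) (ι-* hi hi)) ⟨
      ι (hi ℕ.* hi ℕ.* x)                  ≤⟨ ι-mono h ⟩
      ι (lo ℕ.* lo ℕ.* y)                  ≡⟨ trans (ι-* (lo ℕ.* lo) y) (cong (_* ι y) (ι-* lo lo)) ⟩
      ι lo * ι lo * ι y                    ≤⟨ *-monoʳ (0≤ι y) (*-mono (0≤ι lo) ≤d (0≤ι lo) ≤d) ⟩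
      ι scale * d * (ι scale * d) * ι y    ∎)
      where open ℚ.≤-Reasoning

    -- The upper bound carries three further digits 999, so that adding 10⁻¹⁸ gives exactly the next
    -- 15-digit decimal; this `gap` makes the inequality for c₀ strict.
    digits digits⁺ unit unit⁺ : ℕ
    digits = 199036176970870
    unit = 1000000000000000
    digits⁺ = 199036176970870999
    unit⁺ = 1000000000000000000

  -- The n-th term of the sequence of c₀.
  logRatio : ℕ → ℚ
  logRatio n = 1ℚ * recip (ι 2 * ((logSum n (ι 3) * recip (logSum n (ι 2))) * (logSum n (ι 3) * recip (logSum n (ι 2)))))

  private
    0<artanh : ∀ {z n} → 0ℚ < z → 70 ℕ.≤ n → 0ℚ < ι 2 * artanhSum n z
    0<artanh 0<z 70≤n = pos*pos (ℚ.positive⁻¹ (ι 2))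
      (ℚ.<-≤-trans 0<z (sum-≥ (ℚ.<⇒≤ 0<z) (ℕ.≤-trans (ℕ.≤ᵇ⇒≤ 1 70 tt) 70≤n)))

    logRatio≡ : ∀ n → 70 ℕ.≤ n → logRatio n ≡ ½ * ((logSum n (ι 2) * recip (logSum n (ι 3))) * (logSum n (ι 2) * recip (logSum n (ι 3))))
    logRatio≡ n 70≤n = trans (ℚ.*-identityˡ _) (recip-ratio (0<artanh {⅓} (ℚ.positive⁻¹ ⅓) 70≤n) (0<artanh {½} (ℚ.positive⁻¹ ½) 70≤n))

    0≤scaled : ∀ {lo x} → ι lo ≤ x → 0ℚ ≤ x
    0≤scaled {lo} h = ℚ.≤-trans (0≤ι lo) h

  gap : ℚ
  gap = ℤ.+ 1 / 1000000000000000000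

  0<gap : 0ℚ < gap
  0<gap = ℚ.positive⁻¹ gap

  logRatio-≥ : ∀ n → 70 ℕ.≤ n → ℤ.+ 199036176970870 / 1000000000000000 ≤ logRatio n
  logRatio-≥ n 70≤n = cancel {ι unit} (ℚ.positive⁻¹ (ι unit)) (subst₂ _≤_ refl (cong (ι unit *_) (sym (logRatio≡ n 70≤n)))
    (ratio-≥ {logSum n (ι 2)} {logSum n (ι 3)} {ι digits} {ι unit} (0<artanh {½} (ℚ.positive⁻¹ ½) 70≤n)
      (subst₂ _≤_
        (trans (cong ((b * b) *_) (ι-* 2 digits)) (ℚ.*-comm (b * b) (ι 2 * ι digits)))
        (ℚ.*-comm (a * a) (ι unit))
        (squares {artanhSum n ½} {artanhSum n ⅓} {lo₂} {hi₃} (2 ℕ.* digits) unit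
          (0≤scaled {lo₃} (proj₁ (enclosure₃ n 70≤n))) (proj₂ (enclosure₃ n 70≤n)) (proj₁ (enclosure₂ n 70≤n))
          (ℕ.≤ᵇ⇒≤ _ _ tt)))))
    where
    a b : ℚ
    a = logSum n (ι 2)
    b = logSum n (ι 3)

  logRatio-< : ∀ n → 70 ℕ.≤ n → logRatio n + gap ≤ ℤ.+ 199036176970871 / 1000000000000000
  logRatio-< n 70≤n = cancel {ι unit⁺} (ℚ.positive⁻¹ (ι unit⁺)) (begin
    ι unit⁺ * (logRatio n + gap)
      ≡⟨ ℚ.*-distribˡ-+ (ι unit⁺) (logRatio n) gap ⟩
    ι unit⁺ * logRatio n + 1ℚ
      ≤⟨ ℚ.+-monoˡ-≤ 1ℚ (subst (_≤ ι digits⁺) (cong (ι unit⁺ *_) (sym (logRatio≡ n 70≤n)))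
           (ratio-≤ {a} {b} {ι digits⁺} {ι unit⁺} (0<artanh {½} (ℚ.positive⁻¹ ½) 70≤n)
             (subst₂ _≤_
               (ℚ.*-comm (a * a) (ι unit⁺))
               (trans (cong ((b * b) *_) (ι-* 2 digits⁺)) (ℚ.*-comm (b * b) (ι 2 * ι digits⁺)))
               (squares {artanhSum n ⅓} {artanhSum n ½} {lo₃} {hi₂} unit⁺ (2 ℕ.* digits⁺)
                 (0≤scaled {lo₂} (proj₁ (enclosure₂ n 70≤n))) (proj₂ (enclosure₂ n 70≤n)) (proj₁ (enclosure₃ n 70≤n))
                 (ℕ.≤ᵇ⇒≤ _ _ tt))))) ⟩
    ι digits⁺ + 1ℚ
      ≡⟨ refl ⟩
    ι unit⁺ * (ℤ.+ 199036176970871 / 1000000000000000) ∎)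
    where
    open ℚ.≤-Reasoning
    a b : ℚ
    a = logSum n (ι 2)
    b = logSum n (ι 3)

-- Order, logarithms and the o(1) term over the reals.

module Reals where

  import Data.Nat as ℕ
  open ℕ using (ℕ; suc; NonZero; z≤n; s≤s)
  import Data.Nat.Properties as ℕ
  open import Data.Product using (∃; _×_; _,_; proj₁; proj₂; map₂)
  import Data.Rational as ℚ
  open ℚ using (ℚ; 0ℚ; 1ℚ; ½)
  import Data.Rational.Properties as ℚ
  open import Data.Rational.Solver using (module +-*-Solver)
  open import Data.Sum using (inj₁; inj₂)
  open import Defs
  open import Relation.Binary.PropositionalEquality using (_≡_; refl; sym; trans; cong; cong₂; subst; subst₂)
  open +-*-Solver using (solve; _:=_; _:+_; _:*_; _:-_; :-_; con)
  open Estimates using (ι; ι-mono; Eventually; both)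
  open LogEstimates using (logSum; logSum-3^; logSum-mono; logSum-diff-≤; logSum-1; 0≤ι; 0<q)
  open RationalEstimates

  eventually-≤ : ∀ {x y} → Eventually (λ n → seq x n ℚ.≤ seq y n) → x ≤ y
  eventually-≤ {x} {y} (N , h) = *≤* λ ε 0<ε → N , λ n N≤n → ℚ.≤-trans (h n N≤n) (Estimates.≤+ʳ (ℚ.<⇒≤ 0<ε))

  always-≤ : ∀ {x y} → (∀ n → seq x n ℚ.≤ seq y n) → x ≤ y
  always-≤ h = eventually-≤ (0 , λ n _ → h n)

  ≤-trans : ∀ {x y z} → x ≤ y → y ≤ z → x ≤ z
  ≤-trans {x} {y} {z} (*≤* h) (*≤* k) = *≤* λ ε 0<ε → both
    (λ n p q → ℚ.≤-trans p (ℚ.≤-trans (ℚ.+-monoˡ-≤ (ε ℚ.* ½) q) (ℚ.≤-reflexive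
      (trans (ℚ.+-assoc (seq z n) (ε ℚ.* ½) (ε ℚ.* ½)) (cong (seq z n ℚ.+_) (Estimates.halves ε))))))
    (h (ε ℚ.* ½) (Estimates.half-pos 0<ε)) (k (ε ℚ.* ½) (Estimates.half-pos 0<ε))

  +-monoʳ-≤ : ∀ z {x y} → x ≤ y → z + x ≤ z + y
  +-monoʳ-≤ z {x} {y} (*≤* h) = *≤* λ ε 0<ε → map₂ (λ k n N≤n → subst₂ ℚ._≤_ (sym (seq-+ z x n))
    (trans (sym (ℚ.+-assoc (seq z n) (seq y n) ε)) (cong (ℚ._+ ε) (sym (seq-+ z y n))))
    (ℚ.+-monoʳ-≤ (seq z n) (k n N≤n))) (h ε 0<ε)

  lower-bound : ∀ {x} → 0ℝ < x → ∃ λ e → 0ℚ ℚ.< e × Eventually (λ n → e ℚ.≤ seq x n)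
  lower-bound {x} (*<* (e , 0<e , N , h)) = e , 0<e , N , λ n N≤n → subst (ℚ._≤ seq x n) (ℚ.+-identityˡ e) (h n N≤n)

  eventually-pos : ∀ {x} → 0ℝ < x → Eventually (λ n → 0ℚ ℚ.< seq x n)
  eventually-pos 0<x = let e , 0<e , N , h = lower-bound 0<x in N , λ n N≤n → ℚ.<-≤-trans 0<e (h n N≤n)

  -- The slack in x ≤ y gets multiplied by the terms of z; these are eventually at most B, so slack
  -- ε / B is requested.
  *-monoʳ-≤ : ∀ {x y z} → 0ℝ < z → x ≤ y → x * z ≤ y * z
  *-monoʳ-≤ {x} {y} {z} 0<z (*≤* h) = *≤* λ ε 0<ε →
    let B , 0<B , bounded = Estimates.cauchy-bounded {seq z} (cauchy z)
        δ , 0<δ , Bδ≡ε    = Estimates.divide 0<B 0<ε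
    in both (λ n x≤ (0<zₙ , zₙ≤B) → subst₂ ℚ._≤_ (sym (seq-* x z n)) (cong (ℚ._+ ε) (sym (seq-* y z n))) (begin
         seq x n ℚ.* seq z n                    ≤⟨ Estimates.*-monoʳ (ℚ.<⇒≤ 0<zₙ) x≤ ⟩
         (seq y n ℚ.+ δ) ℚ.* seq z n            ≡⟨ ℚ.*-distribʳ-+ (seq z n) (seq y n) δ ⟩
         seq y n ℚ.* seq z n ℚ.+ δ ℚ.* seq z n  ≤⟨ ℚ.+-monoʳ-≤ (seq y n ℚ.* seq z n) (Estimates.*-monoˡ (ℚ.<⇒≤ 0<δ)
                                                     (ℚ.≤-trans (Estimates.≤∣∣ (seq z n)) zₙ≤B)) ⟩
         seq y n ℚ.* seq z n ℚ.+ δ ℚ.* B        ≡⟨ cong (seq y n ℚ.* seq z n ℚ.+_) (trans (ℚ.*-comm δ B) Bδ≡ε) ⟩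
         seq y n ℚ.* seq z n ℚ.+ ε              ∎))
       (h δ 0<δ) (both (λ n p q → p , q) (eventually-pos 0<z) bounded)
    where open ℚ.≤-Reasoning

  *-comm-≤ : ∀ x y → x * y ≤ y * x
  *-comm-≤ x y = always-≤ λ n → ℚ.≤-reflexive (trans (seq-* x y n) (trans (ℚ.*-comm (seq x n) (seq y n)) (sym (seq-* y x n))))

  *-monoˡ-≤ : ∀ {x y z} → 0ℝ < z → x ≤ y → z * x ≤ z * y
  *-monoˡ-≤ {x} {y} {z} 0<z x≤y = ≤-trans (*-comm-≤ z x) (≤-trans (*-monoʳ-≤ 0<z x≤y) (*-comm-≤ y z))

  0<fromℚ : ∀ {q} → 0ℚ ℚ.< q → 0ℝ < fromℚ q
  0<fromℚ {q} 0<q = *<* (q , 0<q , 0 , λ _ _ → ℚ.≤-reflexive (ℚ.+-identityˡ q))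

  seq-/ : ∀ x y (0<y : 0ℝ < y) n → seq (x / y [ 0<y ]) n ≡ seq x n ℚ.* Estimates.recip (seq y n)
  seq-/ x y 0<y n = trans (seq-* x (recip y 0<y) n) (cong (seq x n ℚ.*_) (seq-recip y 0<y n))

  seq-logℕ : ∀ m .{{_ : NonZero m}} n → seq (logℕ m) n ≡ logSum n (ι m)
  seq-logℕ m n = seq-log (fromℕ m) (0<fromℕ m) n

  1≤ι : ∀ {m} → 1 ℕ.≤ m → 1ℚ ℚ.≤ ι m
  1≤ι = ι-mono {1}

  logSum-≤ : ∀ m n → 1 ℕ.≤ m → logSum n (ι m) ℚ.≤ ι m ℚ.- 1ℚ
  logSum-≤ m n 1≤m = subst (ℚ._≤ ι m ℚ.- 1ℚ)
    (trans (ℚ.*-identityˡ _) (trans (cong (λ t → logSum n (ι m) ℚ.- t) (logSum-1 n)) (ℚ.+-identityʳ (logSum n (ι m)))))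
    (logSum-diff-≤ {ι m} {1ℚ} ℚ.≤-refl (1≤ι 1≤m) n)

  1≤log3 : Eventually (λ n → 1ℚ ℚ.≤ logSum n (ι 3))
  1≤log3 = close (1<logℕ 3 ℕ.≤-refl)
    where
    close : 1ℝ < logℕ 3 → Eventually (λ n → 1ℚ ℚ.≤ logSum n (ι 3))
    close (*<* (e , 0<e , N , h)) = N , λ n N≤n → ℚ.≤-trans (Estimates.≤+ʳ (ℚ.<⇒≤ 0<e))
      (subst (1ℚ ℚ.+ e ℚ.≤_) (seq-logℕ 3 n) (h n N≤n))

  *log3≤logℕ : ∀ l m .{{_ : NonZero m}} → 3 ℕ.^ l ℕ.≤ m → fromℕ l * logℕ 3 ≤ logℕ m
  *log3≤logℕ l m 3^l≤m = *≤* λ ε 0<ε → let N , h = logSum-3^ l ε 0<ε in N , λ n N≤n →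
    subst₂ ℚ._≤_ (sym (trans (seq-* (fromℕ l) (logℕ 3) n) (cong (ι l ℚ.*_) (seq-logℕ 3 n)))) (cong (ℚ._+ ε) (sym (seq-logℕ m n)))
      (ℚ.≤-trans (subtract (logSum n (ι (3 ℕ.^ l))) (ι l ℚ.* logSum n (ι 3)) (h n N≤n))
        (ℚ.+-monoˡ-≤ ε (logSum-mono (1≤ι (ℕ.m^n>0 3 l)) (ι-mono 3^l≤m) n)))
    where
    subtract : ∀ a b {ε} → ℚ.∣ a ℚ.- b ∣ ℚ.≤ ε → b ℚ.≤ a ℚ.+ ε
    subtract a b {ε} h = subst (ℚ._≤ a ℚ.+ ε) (solve 2 (λ a b → a :+ (b :- a) := b) refl a b)
      (ℚ.+-monoʳ-≤ a (ℚ.≤-trans (Estimates.≤∣∣ (b ℚ.- a)) (subst (ℚ._≤ ε) (Estimates.∣-∣-sym a b) h)))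

  logSum-≤-*log3 : ∀ {m l} → 1 ℕ.≤ m → m ℕ.≤ 3 ℕ.^ l → ∀ ε → 0ℚ ℚ.< ε →
                   Eventually λ n → logSum n (ι m) ℚ.≤ ι l ℚ.* logSum n (ι 3) ℚ.+ ε
  logSum-≤-*log3 {m} {l} 1≤m m≤3^l ε 0<ε = let N , h = logSum-3^ l ε 0<ε in N , λ n N≤n →
    ℚ.≤-trans (logSum-mono (1≤ι 1≤m) (ι-mono m≤3^l) n) (add (logSum n (ι (3 ℕ.^ l))) (ι l ℚ.* logSum n (ι 3)) (h n N≤n))
    where
    add : ∀ a b {ε} → ℚ.∣ a ℚ.- b ∣ ℚ.≤ ε → a ℚ.≤ b ℚ.+ ε
    add a b {ε} h = subst (ℚ._≤ b ℚ.+ ε) (solve 2 (λ a b → b :+ (a :- b) := a) refl a b)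
      (ℚ.+-monoʳ-≤ b (ℚ.≤-trans (Estimates.≤∣∣ (a ℚ.- b)) h))

  -- x ≤ 3ˡ holds termwise only up to a slack. By the difference bound, log has slope at most 1
  -- beyond 1, so slack ε / 2 in the argument stays at most ε / 2 in the value.
  log-≤-*log3 : ∀ x (0<x : 0ℝ < x) l → 1ℝ < x → x ≤ fromℕ (3 ℕ.^ l) → log x 0<x ≤ fromℕ l * logℕ 3
  log-≤-*log3 x 0<x l (*<* (e , 0<e , E)) (*≤* x≤) = *≤* λ ε 0<ε → both
    (λ n x≤ₙ (1+e≤x , log≤) → subst₂ ℚ._≤_ (sym (seq-log x 0<x n))
      (cong (ℚ._+ ε) (sym (trans (seq-* (fromℕ l) (logℕ 3) n) (cong (ι l ℚ.*_) (seq-logℕ 3 n))))) (begin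
        logSum n (seq x n)
          ≤⟨ logSum-mono (ℚ.≤-trans (Estimates.≤+ʳ (ℚ.<⇒≤ 0<e)) 1+e≤x) x≤ₙ n ⟩
        logSum n (M ℚ.+ ε ℚ.* ½)
          ≡⟨ solve 2 (λ a b → a := b :+ (a :- b)) refl (logSum n (M ℚ.+ ε ℚ.* ½)) (logSum n M) ⟩
        logSum n M ℚ.+ (logSum n (M ℚ.+ ε ℚ.* ½) ℚ.- logSum n M)
          ≤⟨ ℚ.+-mono-≤ log≤ (increment n (ε ℚ.* ½) (ℚ.<⇒≤ (Estimates.half-pos 0<ε))) ⟩
        ι l ℚ.* logSum n (ι 3) ℚ.+ ε ℚ.* ½ ℚ.+ ε ℚ.* ½
          ≡⟨ trans (ℚ.+-assoc (ι l ℚ.* logSum n (ι 3)) (ε ℚ.* ½) (ε ℚ.* ½)) (cong (ι l ℚ.* logSum n (ι 3) ℚ.+_) (Estimates.halves ε)) ⟩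
        ι l ℚ.* logSum n (ι 3) ℚ.+ ε ∎))
    (x≤ (ε ℚ.* ½) (Estimates.half-pos 0<ε))
    (both (λ n p q → p , q) E (logSum-≤-*log3 {l = l} (ℕ.m^n>0 3 l) ℕ.≤-refl (ε ℚ.* ½) (Estimates.half-pos 0<ε)))
    where
    open ℚ.≤-Reasoning
    M : ℚ
    M = ι (3 ℕ.^ l)
    1≤M : 1ℚ ℚ.≤ M
    1≤M = 1≤ι (ℕ.m^n>0 3 l)
    increment : ∀ n δ → 0ℚ ℚ.≤ δ → logSum n (M ℚ.+ δ) ℚ.- logSum n M ℚ.≤ δ
    increment n δ 0≤δ = begin
      d             ≡⟨ ℚ.*-identityˡ d ⟨
      1ℚ ℚ.* d      ≤⟨ Estimates.*-monoʳ (Estimates.diff-nonNeg (logSum-mono 1≤M (Estimates.≤+ʳ 0≤δ) n)) 1≤M ⟩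
      M ℚ.* d       ≤⟨ logSum-diff-≤ 1≤M (Estimates.≤+ʳ 0≤δ) n ⟩
      M ℚ.+ δ ℚ.- M ≡⟨ solve 2 (λ m d → m :+ d :- m := d) refl M δ ⟩
      δ             ∎
      where
      d : ℚ
      d = logSum n (M ℚ.+ δ) ℚ.- logSum n M

  private
    a₂ : ℕ → ℚ
    a₂ n = logSum n (ι 2)

  seq-log₂ : ∀ m .{{_ : NonZero m}} n → seq (log₂ m) n ≡ logSum n (ι m) ℚ.* Estimates.recip (a₂ n)
  seq-log₂ m n = trans (seq-/ (logℕ m) (logℕ 2) log2>0 n)
    (cong₂ (λ s t → s ℚ.* Estimates.recip t) (seq-logℕ m n) (seq-logℕ 2 n))

  seq-c₀ : ∀ n → seq c₀ n ≡ Numerics.logRatio n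
  seq-c₀ n = trans (seq-/ 1ℝ (2ℝ * log₂ 3 ²) (pos* 0<2 (pos* log₂3>0 log₂3>0)) n) (cong (λ t → 1ℚ ℚ.* Estimates.recip t)
    (trans (seq-* 2ℝ (log₂ 3 ²) n) (cong (ι 2 ℚ.*_) (trans (seq-* (log₂ 3) (log₂ 3) n) (cong₂ ℚ._*_ (seq-log₂ 3 n) (seq-log₂ 3 n))))))

  module _ (p : Prime≥3) where

    private
      instance
        p≢0 : NonZero (value p)
        p≢0 = value-nonZero p

      b : ℕ → ℚ
      b n = logSum n (ι 3)

    log₃-p : ℝ
    log₃-p = log-p p * recip (logℕ 3) log3>0

    seq-log₃-p : ∀ n → seq log₃-p n ≡ seq (log-p p) n ℚ.* Estimates.recip (b n)
    seq-log₃-p n = trans (seq-* (log-p p) (recip (logℕ 3) log3>0) n) (cong (seq (log-p p) n ℚ.*_)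
      (trans (seq-recip (logℕ 3) log3>0 n) (cong Estimates.recip (seq-logℕ 3 n))))

    0<log₃-p : 0ℝ < log₃-p
    0<log₃-p = pos* (log-p>0 p) (pos-recip log3>0)

    l≤log₃-p : ∀ {l} → 3 ℕ.^ l ℕ.≤ value p → fromℕ l ≤ log₃-p
    l≤log₃-p {l} 3^l≤p = ≤-trans
      (eventually-≤ (map₂ (λ h n N≤n → ℚ.≤-reflexive (sym (cancelled n (h n N≤n)))) 1≤log3))
      (*-monoʳ-≤ (pos-recip log3>0) (*log3≤logℕ l (value p) 3^l≤p))
      where
      cancelled : ∀ n → 1ℚ ℚ.≤ b n → seq (fromℕ l * logℕ 3 * recip (logℕ 3) log3>0) n ≡ ι l
      cancelled n 1≤b = trans (seq-* (fromℕ l * logℕ 3) (recip (logℕ 3) log3>0) n)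
        (trans (cong₂ ℚ._*_ (trans (seq-* (fromℕ l) (logℕ 3) n) (cong (ι l ℚ.*_) (seq-logℕ 3 n)))
          (trans (seq-recip (logℕ 3) log3>0 n) (cong Estimates.recip (seq-logℕ 3 n))))
        (trans (ℚ.*-assoc (ι l) (b n) (Estimates.recip (b n)))
          (trans (cong (ι l ℚ.*_) (proj₂ (Estimates.recip-pos (0<q 1≤b)))) (ℚ.*-identityʳ (ι l)))))

    1/log₃-log-p : ℝ
    1/log₃-log-p = logℕ 3 * recip (log-log-p p) (log-log-p>0 p)

    -- log p ≤ (l + 1) log 3 ≤ 3 (l + 1) ≤ 3ᴷ⁺², using log 3 ≤ 3. This is why K + 2 appears in the
    -- cardinality bound.
    log-log-p≤ : ∀ {l K} → value p ℕ.≤ 3 ℕ.^ suc l → suc l ℕ.≤ 3 ℕ.^ suc K → log-log-p p ≤ fromℕ (K ℕ.+ 2) * logℕ 3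
    log-log-p≤ {l} {K} p≤ l≤ = log-≤-*log3 (log-p p) (log-p>0 p) (K ℕ.+ 2) (1<logℕ (value p) (≥3 p))
      (*≤* λ ε 0<ε → map₂ (λ h n N≤n → subst (ℚ._≤ ι (3 ℕ.^ (K ℕ.+ 2)) ℚ.+ ε) (sym (seq-logℕ (value p) n))
        (ℚ.≤-trans (h n N≤n) (ℚ.+-monoˡ-≤ ε (step n))))
        (logSum-≤-*log3 {l = suc l} (ℕ.≤-trans (s≤s z≤n) (≥3 p)) p≤ ε 0<ε))
      where
      open ℚ.≤-Reasoning
      step : ∀ n → ι (suc l) ℚ.* b n ℚ.≤ ι (3 ℕ.^ (K ℕ.+ 2))
      step n = begin
        ι (suc l) ℚ.* b n              ≤⟨ Estimates.*-monoˡ (0≤ι (suc l)) (ℚ.≤-trans (logSum-≤ 3 n (s≤s z≤n)) (ι-mono {2} {3} (s≤s (s≤s z≤n)))) ⟩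
        ι (suc l) ℚ.* ι 3              ≡⟨ LogEstimates.ι-* (suc l) 3 ⟨
        ι (suc l ℕ.* 3)                ≤⟨ ι-mono (ℕ.≤-trans (ℕ.*-monoˡ-≤ 3 l≤) (ℕ.≤-reflexive (trans (ℕ.*-comm (3 ℕ.^ suc K) 3)
                                            (cong (3 ℕ.^_) (ℕ.+-comm 2 K))))) ⟩
        ι (3 ℕ.^ (K ℕ.+ 2))            ∎

    κ≤1/log₃-log-p : ∀ {κ K} → 0ℚ ℚ.< κ → ι K ℚ.* κ ≡ 1ℚ → log-log-p p ≤ fromℕ K * logℕ 3 → fromℚ κ ≤ 1/log₃-log-p
    κ≤1/log₃-log-p {κ} {K} 0<κ Kκ≡1 LL≤ = ≤-trans
      (eventually-≤ (map₂ (λ h n N≤n → ℚ.≤-reflexive (sym (lhs n (h n N≤n)))) (eventually-pos (log-log-p>0 p))))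
      (≤-trans (*-monoʳ-≤ (0<fromℚ 0<κ) (*-monoʳ-≤ (pos-recip (log-log-p>0 p)) LL≤))
        (always-≤ λ n → ℚ.≤-reflexive (rhs n)))
      where
      LL : ℕ → ℚ
      LL = seq (log-log-p p)
      R : ℝ
      R = recip (log-log-p p) (log-log-p>0 p)
      lhs : ∀ n → 0ℚ ℚ.< LL n → seq (log-log-p p * R * fromℚ κ) n ≡ κ
      lhs n 0<LL = trans (seq-* (log-log-p p * R) (fromℚ κ) n) (trans (cong (ℚ._* κ)
        (trans (seq-* (log-log-p p) R n) (trans (cong (LL n ℚ.*_) (seq-recip (log-log-p p) (log-log-p>0 p) n))
          (proj₂ (Estimates.recip-pos 0<LL))))) (ℚ.*-identityˡ κ))
      rhs : ∀ n → seq (fromℕ K * logℕ 3 * R * fromℚ κ) n ≡ seq 1/log₃-log-p n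
      rhs n = trans (seq-* (fromℕ K * logℕ 3 * R) (fromℚ κ) n) (trans (cong (ℚ._* κ) (trans (seq-* (fromℕ K * logℕ 3) R n)
        (cong (ℚ._* seq R n) (seq-* (fromℕ K) (logℕ 3) n))))
        (trans (solve 4 (λ k b r x → k :* b :* r :* x := (k :* x) :* (b :* r)) refl (ι K) (seq (logℕ 3) n) (seq R n) κ)
          (trans (cong (ℚ._* (seq (logℕ 3) n ℚ.* seq R n)) Kκ≡1) (trans (ℚ.*-identityˡ _) (sym (seq-* (logℕ 3) R n))))))

    card≤log₃-p² : ∀ {a l c} {w : ℝ} → 1 ℕ.≤ l → 3 ℕ.^ l ℕ.≤ value p → 0ℚ ℚ.< c → ι a ℚ.≤ ι l ℚ.* ι l ℚ.* c → fromℚ c ≤ w →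
                  fromℕ a ≤ log₃-p * log₃-p * w
    card≤log₃-p² {a} {l} {c} {w} 1≤l 3^l≤p 0<c a≤ c≤w = ≤-trans {y = fromℕ l * fromℕ l * fromℚ c}
      (always-≤ λ n → subst (ι a ℚ.≤_) (sym (trans (seq-* (fromℕ l * fromℕ l) (fromℚ c) n)
        (cong (ℚ._* c) (seq-* (fromℕ l) (fromℕ l) n)))) a≤)
      (≤-trans (*-monoʳ-≤ (0<fromℚ 0<c) (≤-trans
        (*-monoʳ-≤ (0<fromℕ l {{ℕ.>-nonZero 1≤l}}) (l≤log₃-p {l} 3^l≤p)) (*-monoˡ-≤ 0<log₃-p (l≤log₃-p {l} 3^l≤p))))
        (*-monoˡ-≤ (pos* 0<log₃-p 0<log₃-p) c≤w))

    seq-bound : ∀ x n → seq (bound p x) n ≡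
      seq (log-p p) n ℚ.* seq (log-p p) n ℚ.* Estimates.recip (ι 2 ℚ.* (b n ℚ.* b n)) ℚ.+
      (ι 2 ℚ.* Estimates.recip (b n) ℚ.+ seq x n) ℚ.* (seq (log-p p) n ℚ.* seq (log-p p) n ℚ.* Estimates.recip (seq (log-log-p p) n))
    seq-bound x n = trans (seq-+ _ _ n) (cong₂ ℚ._+_
      (trans (seq-/ (log-p p ²) _ _ n) (cong₂ ℚ._*_ (seq-* (log-p p) (log-p p) n) (cong Estimates.recip
        (trans (seq-* 2ℝ _ n) (cong (ι 2 ℚ.*_) (trans (seq-* (logℕ 3) (logℕ 3) n) (cong₂ ℚ._*_ (seq-logℕ 3 n) (seq-logℕ 3 n))))))))
      (trans (seq-* _ _ n) (cong₂ ℚ._*_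
        (trans (seq-+ _ x n) (cong (ℚ._+ seq x n) (trans (seq-/ 2ℝ (logℕ 3) log3>0 n)
          (cong (λ t → ι 2 ℚ.* Estimates.recip t) (seq-logℕ 3 n)))))
        (trans (seq-/ (log-p p ²) (log-log-p p) (log-log-p>0 p) n) (cong (ℚ._* Estimates.recip (seq (log-log-p p) n))
          (seq-* (log-p p) (log-p p) n))))))

    main-bound : ∀ {σ ε} → 0ℚ ℚ.≤ σ → Eventually (λ n → σ ℚ.≤ seq ε n) →
                 log₃-p * log₃-p * (fromℚ ½ + fromℚ (ι 2 ℚ.+ σ) * 1/log₃-log-p) ≤ bound p ε
    main-bound {σ} {ε} 0≤σ σ≤ε = eventually-≤ (both
      (λ n (1≤b , σ≤) 0<LL → subst₂ ℚ._≤_ (sym (lhs n)) (sym (seq-bound ε n))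
        (main-term {seq (log-p p) n} 1≤b (Estimates.*-nonNeg (0≤sq (seq (log-p p) n)) (ℚ.<⇒≤ (proj₁ (Estimates.recip-pos 0<LL)))) 0≤σ σ≤))
      (both (λ n p q → p , q) 1≤log3 σ≤ε) (eventually-pos (log-log-p>0 p)))
      where
      lhs : ∀ n → seq (log₃-p * log₃-p * (fromℚ ½ + fromℚ (ι 2 ℚ.+ σ) * 1/log₃-log-p)) n ≡
        (seq (log-p p) n ℚ.* Estimates.recip (b n)) ℚ.* (seq (log-p p) n ℚ.* Estimates.recip (b n)) ℚ.*
        (½ ℚ.+ (ι 2 ℚ.+ σ) ℚ.* (b n ℚ.* Estimates.recip (seq (log-log-p p) n)))
      lhs n = trans (seq-* (log₃-p * log₃-p) _ n) (cong₂ ℚ._*_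
        (trans (seq-* log₃-p log₃-p n) (cong₂ ℚ._*_ (seq-log₃-p n) (seq-log₃-p n)))
        (trans (seq-+ (fromℚ ½) _ n) (cong (½ ℚ.+_) (trans (seq-* (fromℚ (ι 2 ℚ.+ σ)) 1/log₃-log-p n)
          (cong ((ι 2 ℚ.+ σ) ℚ.*_) (trans (seq-* (logℕ 3) (recip (log-log-p p) (log-log-p>0 p)) n)
            (cong₂ ℚ._*_ (seq-logℕ 3 n) (seq-recip (log-log-p p) (log-log-p>0 p) n))))))))

    constant-bound : ∀ {σ ε} → 0ℚ ℚ.≤ σ → Eventually (λ n → σ ℚ.≤ seq ε n) →
                     log₃-p * log₃-p * fromℚ (½ ℚ.* (1ℚ ℚ.+ σ)) ≤ (c₀ + ε) * log₂-p p ²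
    constant-bound {σ} {ε} 0≤σ σ≤ε = eventually-≤ (both
      (λ n (1≤b , σ≤) 0<a → subst₂ ℚ._≤_ (sym (lhs n)) (sym (rhs n))
        (constant-term {seq (log-p p) n} {a₂ n} (subst (0ℚ ℚ.<_) (seq-logℕ 2 n) 0<a) (logSum-≤ 2 n (s≤s z≤n)) 1≤b 0≤σ σ≤))
      (both (λ n p q → p , q) 1≤log3 σ≤ε) (eventually-pos log2>0))
      where
      lhs : ∀ n → seq (log₃-p * log₃-p * fromℚ (½ ℚ.* (1ℚ ℚ.+ σ))) n ≡
        (seq (log-p p) n ℚ.* Estimates.recip (b n)) ℚ.* (seq (log-p p) n ℚ.* Estimates.recip (b n)) ℚ.* (½ ℚ.* (1ℚ ℚ.+ σ))
      lhs n = trans (seq-* (log₃-p * log₃-p) _ n) (cong (ℚ._* (½ ℚ.* (1ℚ ℚ.+ σ)))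
        (trans (seq-* log₃-p log₃-p n) (cong₂ ℚ._*_ (seq-log₃-p n) (seq-log₃-p n))))
      log₂p≡ : ∀ n → seq (log₂-p p) n ≡ seq (log-p p) n ℚ.* Estimates.recip (a₂ n)
      log₂p≡ n = trans (seq-log₂ (value p) n) (cong (ℚ._* Estimates.recip (a₂ n)) (sym (seq-logℕ (value p) n)))
      rhs : ∀ n → seq ((c₀ + ε) * log₂-p p ²) n ≡ (Numerics.logRatio n ℚ.+ seq ε n) ℚ.*
        ((seq (log-p p) n ℚ.* Estimates.recip (a₂ n)) ℚ.* (seq (log-p p) n ℚ.* Estimates.recip (a₂ n)))
      rhs n = trans (seq-* (c₀ + ε) (log₂-p p ²) n) (cong₂ ℚ._*_
        (trans (seq-+ c₀ ε n) (cong (ℚ._+ seq ε n) (seq-c₀ n)))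
        (trans (seq-* (log₂-p p) (log₂-p p) n) (cong₂ ℚ._*_ (log₂p≡ n) (log₂p≡ n))))

  -- The least nonnegative t with y ≤ C + (a + t) * D.
  defect : (C a y D : ℝ) → 0ℝ < D → ℝ
  defect C a y D 0<D = fromℚ ½ * (x + ∣ x ∣)
    where
    x : ℝ
    x = (y - C) * recip D 0<D - a

  module _ (C a y D : ℝ) (0<D : 0ℝ < D) where

    private
      x : ℕ → ℚ
      x n = (seq y n ℚ.- seq C n) ℚ.* Estimates.recip (seq D n) ℚ.- seq a n

      seq-defect : ∀ n → seq (defect C a y D 0<D) n ≡ ½ ℚ.* (x n ℚ.+ ℚ.∣ x n ∣)
      seq-defect n = trans (seq-* (fromℚ ½) _ n) (cong (½ ℚ.*_) (trans (seq-+ _ _ n)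
        (cong₂ ℚ._+_ x≡ (trans (seq-∣∣ _ n) (cong ℚ.∣_∣ x≡)))))
        where
        x≡ : seq ((y - C) * recip D 0<D - a) n ≡ x n
        x≡ = trans (seq-+ _ _ n) (cong₂ ℚ._+_
          (trans (seq-* _ _ n) (cong₂ ℚ._*_ (trans (seq-+ _ _ n) (cong (seq y n ℚ.+_) (seq-- C n))) (seq-recip D 0<D n)))
          (seq-- a n))

      seq-affine : ∀ t n → seq (C + (a + t) * D) n ≡ seq C n ℚ.+ (seq a n ℚ.+ seq t n) ℚ.* seq D n
      seq-affine t n = trans (seq-+ _ _ n) (cong (seq C n ℚ.+_) (trans (seq-* _ _ n) (cong (ℚ._* seq D n) (seq-+ a t n))))

      y≡ : ∀ n → 0ℚ ℚ.< seq D n → seq y n ≡ seq C n ℚ.+ (seq a n ℚ.+ x n) ℚ.* seq D n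
      y≡ n 0<Dₙ = sym (trans
        (solve 5 (λ y c d r a → c :+ (a :+ ((y :- c) :* r :- a)) :* d := c :+ (y :- c) :* (d :* r)) refl
          (seq y n) (seq C n) (seq D n) (Estimates.recip (seq D n)) (seq a n))
        (trans (cong (λ t → seq C n ℚ.+ (seq y n ℚ.- seq C n) ℚ.* t) (proj₂ (Estimates.recip-pos 0<Dₙ)))
          (solve 2 (λ y c → c :+ (y :- c) :* con 1ℚ := y) refl (seq y n) (seq C n))))

      average : ∀ q → q ≡ ½ ℚ.* (q ℚ.+ q)
      average = solve 1 (λ q → q := con ½ :* (q :+ q)) refl

    -- The number x = (y - C) / D - a gives equality, and (x + |x|) / 2 is the maximum of x and 0.
    ≤-defect : y ≤ C + (a + defect C a y D 0<D) * D
    ≤-defect = eventually-≤ (map₂ (λ h n N≤n → subst₂ ℚ._≤_ (sym (y≡ n (h n N≤n))) (sym (seq-affine (defect C a y D 0<D) n))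
      (ℚ.+-monoʳ-≤ (seq C n) (Estimates.*-monoʳ (ℚ.<⇒≤ (h n N≤n)) (ℚ.+-monoʳ-≤ (seq a n) (x≤ n))))) (eventually-pos 0<D))
      where
      x≤ : ∀ n → x n ℚ.≤ seq (defect C a y D 0<D) n
      x≤ n = subst₂ ℚ._≤_ (sym (average (x n))) (sym (seq-defect n)) (Estimates.*-monoˡ 0≤½ (ℚ.+-monoʳ-≤ (x n) (Estimates.≤∣∣ (x n))))

    ∣defect∣≤ : ∀ {ε} → 0ℝ < ε → y ≤ C + (a + ε) * D → ∣ defect C a y D 0<D ∣ ≤ ε
    ∣defect∣≤ {ε} 0<ε (*≤* h) = *≤* λ η 0<η →
      let d , 0<d , d≤D = lower-bound 0<D
      in both (λ n y≤ (d≤ , 0<εₙ) → bounded η d n 0<η 0<d d≤ 0<εₙ y≤)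
           -- Slack η d with d a lower bound for D leaves at most η after division by D.
           (h (η ℚ.* d) (Estimates.pos*pos 0<η 0<d)) (both (λ n p q → p , q) d≤D (eventually-pos 0<ε))
      where
      bounded : ∀ η d n → 0ℚ ℚ.< η → 0ℚ ℚ.< d → d ℚ.≤ seq D n → 0ℚ ℚ.< seq ε n →
                seq y n ℚ.≤ seq (C + (a + ε) * D) n ℚ.+ η ℚ.* d → seq ∣ defect C a y D 0<D ∣ n ℚ.≤ seq ε n ℚ.+ η
      bounded η d n 0<η 0<d d≤D 0<εₙ y≤ = subst (ℚ._≤ e) (sym (seq-∣∣ (defect C a y D 0<D) n))
        (Estimates.∣∣≤ (subst (ℚ._≤ e) (sym (seq-defect n)) ≤e)
          (ℚ.≤-trans (ℚ.neg-antimono-≤ (subst (0ℚ ℚ.≤_) (sym (seq-defect n)) 0≤)) 0≤e))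
        where
        open ℚ.≤-Reasoning
        e : ℚ
        e = seq ε n ℚ.+ η
        0≤e : 0ℚ ℚ.≤ e
        0≤e = ℚ.<⇒≤ (ℚ.+-mono-< 0<εₙ 0<η)
        0<Dₙ : 0ℚ ℚ.< seq D n
        0<Dₙ = ℚ.<-≤-trans 0<d d≤D
        x≤e : x n ℚ.≤ e
        x≤e = Estimates.cancel 0<Dₙ (begin
          seq D n ℚ.* x n
            ≡⟨ solve 4 (λ c a x d → d :* x := (c :+ (a :+ x) :* d) :- (c :+ a :* d)) refl (seq C n) (seq a n) (x n) (seq D n) ⟩
          (seq C n ℚ.+ (seq a n ℚ.+ x n) ℚ.* seq D n) ℚ.- (seq C n ℚ.+ seq a n ℚ.* seq D n)
            ≤⟨ ℚ.+-monoˡ-≤ (ℚ.- (seq C n ℚ.+ seq a n ℚ.* seq D n)) (subst₂ ℚ._≤_ (y≡ n 0<Dₙ)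
                 (cong (ℚ._+ η ℚ.* d) (seq-affine ε n)) y≤) ⟩
          (seq C n ℚ.+ (seq a n ℚ.+ seq ε n) ℚ.* seq D n ℚ.+ η ℚ.* d) ℚ.- (seq C n ℚ.+ seq a n ℚ.* seq D n)
            ≡⟨ solve 5 (λ c a ε d h → (c :+ (a :+ ε) :* d :+ h) :- (c :+ a :* d) := ε :* d :+ h) refl
                 (seq C n) (seq a n) (seq ε n) (seq D n) (η ℚ.* d) ⟩
          seq ε n ℚ.* seq D n ℚ.+ η ℚ.* d
            ≤⟨ ℚ.+-monoʳ-≤ (seq ε n ℚ.* seq D n) (Estimates.*-monoˡ (ℚ.<⇒≤ 0<η) d≤D) ⟩
          seq ε n ℚ.* seq D n ℚ.+ η ℚ.* seq D n
            ≡⟨ solve 3 (λ e h d → e :* d :+ h :* d := d :* (e :+ h)) refl (seq ε n) η (seq D n) ⟩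
          seq D n ℚ.* e ∎)
        0≤ : 0ℚ ℚ.≤ ½ ℚ.* (x n ℚ.+ ℚ.∣ x n ∣)
        0≤ = Estimates.*-nonNeg 0≤½ (subst (ℚ._≤ x n ℚ.+ ℚ.∣ x n ∣) (ℚ.+-inverseʳ (x n))
          (ℚ.+-monoʳ-≤ (x n) (subst (ℚ.- x n ℚ.≤_) (ℚ.∣-p∣≡∣p∣ (x n)) (Estimates.≤∣∣ (ℚ.- x n)))))
        ≤e : ½ ℚ.* (x n ℚ.+ ℚ.∣ x n ∣) ℚ.≤ e
        ≤e with ℚ.∣p∣≡p∨∣p∣≡-p (x n)
        ... | inj₁ ∣x∣≡x  = subst (ℚ._≤ e) (trans (average (x n)) (cong (λ t → ½ ℚ.* (x n ℚ.+ t)) (sym ∣x∣≡x))) x≤e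
        ... | inj₂ ∣x∣≡-x = subst (ℚ._≤ e) (trans (sym (ℚ.*-zeroʳ ½)) (cong (½ ℚ.*_)
          (trans (sym (ℚ.+-inverseʳ (x n))) (cong (x n ℚ.+_) (sym ∣x∣≡-x))))) 0≤e

-- From the natural-number bound to the real bounds and to m(p).

module Bounds where

  open import Data.Fin.Subset using (Subset; ∣_∣)
  import Data.Nat as ℕ
  open ℕ using (ℕ; suc; s≤s; z≤n)
  import Data.Nat.Properties as ℕ
  open import Data.Product using (∃; ∃₂; _×_; _,_; proj₁; proj₂; map₂)
  import Data.Integer as ℤ
  import Data.Rational as ℚ
  open ℚ using (ℚ; 0ℚ; 1ℚ; ½)
  import Data.Rational.Properties as ℚ
  open import Defs hiding (∣_∣)
  open import Relation.Binary.PropositionalEquality using (_≡_; refl; sym; trans; cong; subst)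
  open Estimates using (ι; ι-mono; Eventually; unitFrac; unitFrac-pos; recip-pos; pos*pos)
  open LogEstimates using (small-unitFrac)
  open RationalEstimates
  open Numerics using (logRatio-≥; logRatio-<; gap; 0<gap)
  open Asymptotics using (GoodSet; threshold; good-set)
  open Reals

  SmallSet : ℝ → (p : Prime≥3) → Subset (value p) → Set
  SmallSet ε p A = 2 ℕ.≤ ∣ A ∣ × HasNoUniqueSum p A × fromℕ ∣ A ∣ ≤ bound p ε × fromℕ ∣ A ∣ ≤ (c₀ + ε) * log₂-p p ²

  module _ (N : ℕ) where

    private
      s : ℕ
      s = suc N
      σ : ℚ
      σ = ℤ.+ 1 ℚ./ s
      0<σ : 0ℚ ℚ.< σ
      0<σ = unitFrac-pos N
      sσ≡1 : ι s ℚ.* σ ≡ 1ℚ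
      sσ≡1 = trans (ℚ.*-comm (ι s) σ) (unitFrac N)
      0<½ : 0ℚ ℚ.< ½
      0<½ = ℚ.positive⁻¹ ½
      0<2+σ : 0ℚ ℚ.< ι 2 ℚ.+ σ
      0<2+σ = ℚ.+-mono-< (ℚ.positive⁻¹ (ι 2)) 0<σ

    module _ (p : Prime≥3) (l K a : ℕ) (K≥ : 4 ℕ.* s ℕ.+ 3 ℕ.≤ K) (1≤l : 1 ℕ.≤ l) (3^l≤p : 3 ℕ.^ l ℕ.≤ value p)
             (card : 2 ℕ.* s ℕ.* (K ℕ.+ 2) ℕ.* a ℕ.≤ l ℕ.* l ℕ.* (s ℕ.* (K ℕ.+ 2) ℕ.+ 4 ℕ.* s ℕ.+ 2)) where

      private
        κ : ℚ
        κ = Estimates.recip (ι (K ℕ.+ 2))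
        0<K+2 : 0ℚ ℚ.< ι (K ℕ.+ 2)
        0<K+2 = ℚ.<-≤-trans Estimates.0<1 (ι-mono {1} (ℕ.≤-trans (s≤s z≤n) (ℕ.m≤n+m 2 K)))
        0<κ : 0ℚ ℚ.< κ
        0<κ = proj₁ (recip-pos 0<K+2)
        Kκ≡1 : ι (K ℕ.+ 2) ℚ.* κ ≡ 1ℚ
        Kκ≡1 = proj₂ (recip-pos 0<K+2)

      ≤bound : ∀ {ε} → Eventually (λ n → σ ℚ.≤ seq ε n) → value p ℕ.≤ 3 ℕ.^ suc l → suc l ℕ.≤ 3 ℕ.^ suc K →
               fromℕ a ≤ bound p ε
      ≤bound {ε} σ≤ε p≤ l≤ = ≤-trans
        (card≤log₃-p² p {a} {l} 1≤l 3^l≤p (ℚ.+-mono-< 0<½ (pos*pos 0<2+σ 0<κ))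
          (cardinality-≤ {s} {K ℕ.+ 2} {l} {a} (ℚ.<⇒≤ 0<σ) sσ≡1 (ℚ.<⇒≤ 0<κ) Kκ≡1 card) weight)
        (main-bound p {σ} {ε} (ℚ.<⇒≤ 0<σ) σ≤ε)
        where
        weight : fromℚ (½ ℚ.+ (ι 2 ℚ.+ σ) ℚ.* κ) ≤ fromℚ ½ + fromℚ (ι 2 ℚ.+ σ) * 1/log₃-log-p p
        weight = ≤-trans {y = fromℚ ½ + fromℚ (ι 2 ℚ.+ σ) * fromℚ κ}
          (always-≤ λ n → ℚ.≤-reflexive (sym (trans (seq-+ (fromℚ ½) (fromℚ (ι 2 ℚ.+ σ) * fromℚ κ) n)
            (cong (½ ℚ.+_) (seq-* (fromℚ (ι 2 ℚ.+ σ)) (fromℚ κ) n)))))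
          (+-monoʳ-≤ (fromℚ ½) (*-monoˡ-≤ (0<fromℚ 0<2+σ)
            (κ≤1/log₃-log-p p {κ} {K ℕ.+ 2} 0<κ Kκ≡1 (log-log-p≤ p {l} {K} p≤ l≤))))

      ≤constant : ∀ {ε} → Eventually (λ n → σ ℚ.≤ seq ε n) → fromℕ a ≤ (c₀ + ε) * log₂-p p ²
      ≤constant {ε} σ≤ε = ≤-trans
        (card≤log₃-p² p {a} {l} {w = fromℚ (½ ℚ.* (1ℚ ℚ.+ σ))} 1≤l 3^l≤p (pos*pos 0<½ (ℚ.+-mono-< Estimates.0<1 0<σ))
          (cardinality-≤′ {s} {K ℕ.+ 2} {l} {a} (ℚ.<⇒≤ 0<σ) sσ≡1 (ℚ.<⇒≤ 0<κ) Kκ≡1 card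
            (ℕ.≤-trans (ℕ.+-monoʳ-≤ (4 ℕ.* s) (ℕ.n≤1+n 2)) (ℕ.≤-trans K≥ (ℕ.m≤m+n K 2))))
          (always-≤ λ _ → ℚ.≤-refl))
        (constant-bound p {σ} {ε} (ℚ.<⇒≤ 0<σ) σ≤ε)

    small-set : ∀ {ε} → Eventually (λ n → σ ℚ.≤ seq ε n) → ∀ p → threshold s ℕ.≤ value p → ∃ (SmallSet ε p)
    small-set {ε} σ≤ε p p≥ = conclude (good-set s p p≥)
      where
      conclude : (∃₂ λ l K → ∃ λ A → GoodSet p s l K A × 4 ℕ.* s ℕ.+ 3 ℕ.≤ K × 1 ℕ.≤ l ×
                  3 ℕ.^ l ℕ.≤ value p × value p ℕ.≤ 3 ℕ.^ suc l × suc l ℕ.≤ 3 ℕ.^ suc K) → ∃ (SmallSet ε p)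
      conclude (l , K , A , (2≤A , noUniqueSum , card) , K≥ , 1≤l , 3^l≤p , p≤ , l≤) =
        A , 2≤A , noUniqueSum , ≤bound p l K (∣ A ∣) K≥ 1≤l 3^l≤p card {ε} σ≤ε p≤ l≤ ,
        ≤constant p l K (∣ A ∣) K≥ 1≤l 3^l≤p card {ε} σ≤ε

  unitFrac-below : ∀ ε → 0ℝ < ε → ∃ λ N → Eventually λ n → (ℤ.+ 1 ℚ./ suc N) ℚ.≤ seq ε n
  unitFrac-below ε 0<ε = close (lower-bound 0<ε)
    where
    close : (∃ λ e → 0ℚ ℚ.< e × Eventually (λ n → e ℚ.≤ seq ε n)) → _
    close (e , 0<e , e≤ε) = map₂ (λ σ≤e → map₂ (λ h n N≤n → ℚ.≤-trans σ≤e (h n N≤n)) e≤ε) (small-unitFrac 0<e)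

  small-sets : ∀ ε → 0ℝ < ε → ∃ λ pε → 5 ℕ.≤ pε × (∀ p → pε ℕ.≤ value p → ∃ (SmallSet ε p))
  small-sets ε 0<ε = close (unitFrac-below ε 0<ε)
    where
    close : (∃ λ N → Eventually λ n → (ℤ.+ 1 ℚ./ suc N) ℚ.≤ seq ε n) → _
    close (N , σ≤ε) = threshold (suc N) , ℕ.m≤m+n 5 _ , small-set N {ε} σ≤ε

  m≤∣A∣ : ∀ p {A : Subset (value p)} {x} → 2 ℕ.≤ ∣ A ∣ → HasNoUniqueSum p A → fromℕ ∣ A ∣ ≤ x → fromℕ (m p) ≤ x
  m≤∣A∣ p {A} 2≤A noUniqueSum A≤x =
    ≤-trans (always-≤ λ _ → ι-mono (proj₂ (m-isMinimum p) ∣ A ∣ (A , 2≤A , noUniqueSum , refl))) A≤x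

  -- The error term at p is the least nonnegative correction that makes the bound true there. So the
  -- inequality holds for every p, and the bound for each fixed ε shows that the correction tends to
  -- 0, without any choice of ε depending on p.
  ≤-little-o : (C a D : Prime≥3 → ℝ) (0<D : ∀ p → 0ℝ < D p) →
    (∀ ε → 0ℝ < ε → ForLargePrimes λ p → fromℕ (m p) ≤ C p + (a p + ε) * D p) →
    ∃ λ (o : Prime≥3 → ℝ) → Is-o1 o × ForLargePrimes (λ p → fromℕ (m p) ≤ C p + (a p + o p) * D p)
  ≤-little-o C a D 0<D h = (λ p → defect (C p) (a p) (fromℕ (m p)) (D p) (0<D p)) ,
    (λ ε 0<ε → map₂ (λ k p p≥ → ∣defect∣≤ (C p) (a p) (fromℕ (m p)) (D p) (0<D p) 0<ε (k p p≥)) (h ε 0<ε)) ,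
    0 , λ p _ → ≤-defect (C p) (a p) (fromℕ (m p)) (D p) (0<D p)

  0+-≤ : ∀ x → 0ℝ + x ≤ x
  0+-≤ x = always-≤ λ n → ℚ.≤-reflexive (trans (seq-+ 0ℝ x n) (ℚ.+-identityˡ (seq x n)))

  ≤-0+ : ∀ x → x ≤ 0ℝ + x
  ≤-0+ x = always-≤ λ n → ℚ.≤-reflexive (sym (trans (seq-+ 0ℝ x n) (ℚ.+-identityˡ (seq x n))))

  m≤bound : ∀ ε → 0ℝ < ε → ForLargePrimes λ p → fromℕ (m p) ≤ bound p ε
  m≤bound ε 0<ε = map₂ (λ (_ , h) p p≥ → conclude p (h p p≥)) (small-sets ε 0<ε)
    where
    conclude : ∀ p → ∃ (SmallSet ε p) → fromℕ (m p) ≤ bound p ε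
    conclude p (A , 2≤A , noUniqueSum , A≤ , _) = m≤∣A∣ p {A} 2≤A noUniqueSum A≤

  m≤constant : ∀ ε → 0ℝ < ε → ForLargePrimes λ p → fromℕ (m p) ≤ (c₀ + ε) * log₂-p p ²
  m≤constant ε 0<ε = map₂ (λ (_ , h) p p≥ → conclude p (h p p≥)) (small-sets ε 0<ε)
    where
    conclude : ∀ p → ∃ (SmallSet ε p) → fromℕ (m p) ≤ (c₀ + ε) * log₂-p p ²
    conclude p (A , 2≤A , noUniqueSum , _ , A≤) = m≤∣A∣ p {A} 2≤A noUniqueSum A≤

  m≤bound-o1 : ∃ λ (o : Prime≥3 → ℝ) → Is-o1 o × ForLargePrimes (λ p → fromℕ (m p) ≤ bound p (o p))
  m≤bound-o1 = ≤-little-o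
    (λ p → log-p p ² / (2ℝ * logℕ 3 ²) [ pos* 0<2 (pos* log3>0 log3>0) ])
    (λ _ → 2ℝ / logℕ 3 [ log3>0 ])
    (λ p → log-p p ² / log-log-p p [ log-log-p>0 p ])
    (λ p → pos/ (pos* (log-p>0 p) (log-p>0 p)) (log-log-p>0 p))
    m≤bound

  m≤constant-o1 : ∃ λ (o : Prime≥3 → ℝ) → Is-o1 o × ForLargePrimes (λ p → fromℕ (m p) ≤ (c₀ + o p) * log₂-p p ²)
  m≤constant-o1 = map₂ (λ {o} → map₂ (map₂ λ h p p≥ → ≤-trans (h p p≥) (0+-≤ ((c₀ + o p) * log₂-p p ²))))
    (≤-little-o (λ _ → 0ℝ) (λ _ → c₀) (λ p → log₂-p p ²) (λ p → pos* (log₂-p>0 p) (log₂-p>0 p))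
      λ ε 0<ε → map₂ (λ h p p≥ → ≤-trans (h p p≥) (≤-0+ ((c₀ + ε) * log₂-p p ²))) (m≤constant ε 0<ε))
    where
    log₂-p>0 : ∀ p → 0ℝ < log₂-p p
    log₂-p>0 p = pos/ (log-p>0 p) log2>0

  c₀-≥ : fromℚ (ℤ.+ 199036176970870 ℚ./ 1000000000000000) ≤ c₀
  c₀-≥ = eventually-≤ {fromℚ (ℤ.+ 199036176970870 ℚ./ 1000000000000000)} {c₀} (70 , λ n 70≤n →
    subst (ℤ.+ 199036176970870 ℚ./ 1000000000000000 ℚ.≤_) (sym (seq-c₀ n)) (logRatio-≥ n 70≤n))

  c₀-< : c₀ < fromℚ (ℤ.+ 199036176970871 ℚ./ 1000000000000000)
  c₀-< = *<* (gap , 0<gap , 70 , λ n 70≤n →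
    subst (λ t → t ℚ.+ gap ℚ.≤ ℤ.+ 199036176970871 ℚ./ 1000000000000000) (sym (seq-c₀ n)) (logRatio-< n 70≤n))

open import Defs
open import Data.Fin.Subset as Subset using (Subset)
open import Data.Integer using (+_)
open import Data.Nat as ℕ using (ℕ)
open import Data.Product using (∃; _×_; _,_; proj₁; proj₂; map₂)
open import Data.Rational as ℚ using (ℚ)

open Bounds

theorem1p3 : (∀ (ε : ℝ) → 0ℝ < ε →
    ∃ λ (pε : ℕ) → 5 ℕ.≤ pε ×
    (∀ (p : Prime≥3) → pε ℕ.≤ value p →
    ∃ λ (A : Subset (value p)) →
    2 ℕ.≤ Subset.∣ A ∣ × HasNoUniqueSum p A × fromℕ Subset.∣ A ∣ ≤ bound p ε))
    × (∃ λ (o : Prime≥3 → ℝ) → Is-o1 o ×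
    ForLargePrimes (λ p → fromℕ (m p) ≤ bound p (o p)))
    × (∃ λ (o : Prime≥3 → ℝ) → Is-o1 o ×
    ForLargePrimes (λ p → fromℕ (m p) ≤ (c₀ + o p) * log₂-p p ²))
    × fromℚ (+ 199036176970870 ℚ./ 1000000000000000) ≤ c₀
    × c₀ < fromℚ (+ 199036176970871 ℚ./ 1000000000000000)
theorem1p3 =
  (λ ε 0<ε → map₂ (map₂ λ h p p≥ → map₂ (map₂ (map₂ proj₁)) (h p p≥)) (small-sets ε 0<ε)) ,
  m≤bound-o1 , m≤constant-o1 , c₀-≥ , c₀-<
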